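{- Let $\epsilon$ be a positive constant. The $k$-Cycle Hypothesis implies that there exists no fully dynamic algorithm for finite-approximate Diameter, nor for finite-approximate Radius, nor for finite-approximate fixed-vertex Eccentricity, on directed, unweighted graphs with $n$ vertices and $\tilde{O}(n)$ edges, which has preprocessing time $p(n)=O(n^{2-\epsilon})$, amortized update time $u(n)=O(n^{1-\epsilon})$, and amortized query time $q(n)=O(n^{1-\epsilon})$.
   Context: $\tilde{O}$ suppresses polylogarithmic factors. For a directed graph $G=(V,E)$, $d(u,v)$ is the length of a shortest path from $u$ to $v$ ($\infty$ if there is none); the eccentricity of $v$ is $\varepsilon(v)=\max_{u\in V}d(v,u)$; the diameter is $\max_{v}\varepsilon(v)$ and the radius is $\min_v\varepsilon(v)$. Fixed-vertex Eccentricity: all queries ask about the eccentricity of one fixed vertex. A fully dynamic algorithm preprocesses an initial graph and then supports edge insertions and edge deletions (updates) as well as queries about the parameter of the current graph. A finite-approximation algorithm is one that can distinguish whether the value of the parameter is finite or infinite. $k$-Cycle Hypothesis: in the word-RAM model with $O(\log n)$-bit words, any possibly randomized algorithm needs $m^{2-f(k)-o(1)}$ time to find a $k$-cycle in an $m$-edge directed graph, for some continuous (over the reals) function $f(k)$ that goes to $0$ as $k$ goes to infinity. -}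

module Defs where

open import Data.Bool using (Bool; true; false; if_then_else_; _∧_; _∨_; _xor_)
open import Data.Fin using (Fin; zero; suc; toℕ)
import Data.Fin.Properties as Fin
open import Data.Integer using (ℤ; +_; -[1+_])
open import Data.List using (List; []; _∷_; length; filter; concatMap)
open import Data.List.Membership.Propositional using (_∈_; _∉_)
open import Data.List.Relation.Unary.All using (All)
open import Data.List.Relation.Unary.Unique.Propositional using (Unique)
open import Data.Nat using (ℕ; zero; suc; _+_; _*_; _∸_; _^_; _≤_; _<_; _≡ᵇ_; _<ᵇ_; NonZero)
open import Data.Nat.DivMod using (_/_; _%_; _mod_)
open import Data.Nat.Logarithm using (⌊log₂_⌋)
open import Data.Nat.Properties using (m^n≢0)
open import Data.Product using (_×_; _,_; ∃; ∃-syntax; proj₁; proj₂)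
open import Data.Product.Properties using (≡-dec)
open import Data.Rational as ℚ using (ℚ; 0ℚ; 1ℚ; ½)
import Data.Rational.Properties as ℚ
import Data.Rational.Solver as ℚ
open import Data.Sum using (_⊎_)
open import Data.Vec using (Vec; toList)
open import Function using (_∘_)
open import Function.Definitions using (Injective)
open import Relation.Binary.Construct.Add.Supremum.NonStrict _≤_ using (_≤⁺_)
open import Relation.Binary.Definitions using (DecidableEquality)
open import Relation.Binary.PropositionalEquality using (_≡_; _≢_; refl; sym; cong; cong₂)
open import Relation.Nullary using (¬_)
open import Relation.Nullary.Construct.Add.Supremum using (_⁺; [_]; ⊤⁺)
open import Relation.Nullary.Decidable using (¬?)

------------------------------------------------------------------------
-- Real numbers, as Cauchy sequences with the fixed rate 2⁻ⁿ

2⁻_ : ℕ → ℚ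
2⁻ zero  = 1ℚ
2⁻ suc n = ½ ℚ.* (2⁻ n)

record ℝ : Set where
  field
    approx  : ℕ → ℚ
    regular : ∀ m n → ℚ.∣ approx m ℚ.- approx n ∣ ℚ.≤ (2⁻ m) ℚ.+ (2⁻ n)

open ℝ public

private
  0≤2⁻ : ∀ n → 0ℚ ℚ.≤ 2⁻ n
  0≤2⁻ zero    = ℚ.nonNegative⁻¹ 1ℚ
  0≤2⁻ (suc n) = begin
    0ℚ              ≡⟨ sym (ℚ.*-zeroʳ ½) ⟩
    ½ ℚ.* 0ℚ        ≤⟨ ℚ.*-monoˡ-≤-nonNeg ½ (0≤2⁻ n) ⟩
    ½ ℚ.* (2⁻ n)    ∎
    where open ℚ.≤-Reasoning

  interchange : ∀ a b c d → (a ℚ.- b) ℚ.- (c ℚ.- d) ≡ (a ℚ.- c) ℚ.- (b ℚ.- d)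
  interchange = solve 4 (λ a b c d → (a :- b) :- (c :- d) := (a :- c) :- (b :- d)) refl
    where open ℚ.+-*-Solver

  halves : ∀ a b → (½ ℚ.* a ℚ.+ ½ ℚ.* b) ℚ.+ (½ ℚ.* a ℚ.+ ½ ℚ.* b) ≡ a ℚ.+ b
  halves = solve 2 (λ a b → (con ½ :* a :+ con ½ :* b) :+ (con ½ :* a :+ con ½ :* b) := a :+ b) refl
    where open ℚ.+-*-Solver

fromℚ : ℚ → ℝ
fromℚ q .approx _ = q
fromℚ q .regular m n = begin
  ℚ.∣ q ℚ.- q ∣          ≡⟨ cong ℚ.∣_∣ (ℚ.+-inverseʳ q) ⟩
  0ℚ ℚ.+ 0ℚ              ≤⟨ ℚ.+-mono-≤ (0≤2⁻ m) (0≤2⁻ n) ⟩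
  (2⁻ m) ℚ.+ (2⁻ n)      ∎
  where open ℚ.≤-Reasoning

fromℕ : ℕ → ℝ
fromℕ k = fromℚ ((+ k) ℚ./ 1)

infixl 6 _-ℝ_
infix 4 _<ℝ_ _≤ℝ_

_-ℝ_ : ℝ → ℝ → ℝ
(x -ℝ y) .approx n = approx x (suc n) ℚ.- approx y (suc n)
(x -ℝ y) .regular m n = begin
  ℚ.∣ (x′ m ℚ.- y′ m) ℚ.- (x′ n ℚ.- y′ n) ∣
    ≡⟨ cong ℚ.∣_∣ (interchange (x′ m) (y′ m) (x′ n) (y′ n)) ⟩
  ℚ.∣ (x′ m ℚ.- x′ n) ℚ.- (y′ m ℚ.- y′ n) ∣
    ≤⟨ ℚ.∣p-q∣≤∣p∣+∣q∣ (x′ m ℚ.- x′ n) (y′ m ℚ.- y′ n) ⟩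
  ℚ.∣ x′ m ℚ.- x′ n ∣ ℚ.+ ℚ.∣ y′ m ℚ.- y′ n ∣
    ≤⟨ ℚ.+-mono-≤ (regular x (suc m) (suc n)) (regular y (suc m) (suc n)) ⟩
  ((2⁻ suc m) ℚ.+ (2⁻ suc n)) ℚ.+ ((2⁻ suc m) ℚ.+ (2⁻ suc n))
    ≡⟨ halves (2⁻ m) (2⁻ n) ⟩
  (2⁻ m) ℚ.+ (2⁻ n) ∎
  where
  open ℚ.≤-Reasoning
  x′ y′ : ℕ → ℚ
  x′ i = approx x (suc i)
  y′ i = approx y (suc i)

_<ℝ_ : ℝ → ℝ → Set
x <ℝ y = ∃[ n ] approx x n ℚ.+ (2⁻ n) ℚ.< approx y n ℚ.- (2⁻ n)

_≤ℝ_ : ℝ → ℝ → Set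
x ≤ℝ y = ¬ (y <ℝ x)

-- |x - y| ≤ e
Within : ℝ → ℝ → ℝ → Set
Within e x y = (x -ℝ y ≤ℝ e) × (y -ℝ x ≤ℝ e)

Continuous : (ℝ → ℝ) → Set
Continuous f = ∀ x e → fromℕ 0 <ℝ e →
  ∃[ d ] (fromℕ 0 <ℝ d × (∀ y → Within d x y → Within e (f x) (f y)))

VanishesAtInfinity : (ℝ → ℝ) → Set
VanishesAtInfinity f = ∀ e → fromℕ 0 <ℝ e →
  ∃[ b ] (∀ x → b ≤ℝ x → Within e (f x) (fromℕ 0))

------------------------------------------------------------------------

-- t ≤ C · n^q, with q = a / d, raised to the power d to stay within ℕ.
PowerBound : (t C n : ℕ) → ℚ → Set
PowerBound t C n q with ℚ.↥ q
... | + a      = t ^ ℚ.↧ₙ q ≤ C ^ ℚ.↧ₙ q * n ^ a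
... | -[1+ a ] = t ^ ℚ.↧ₙ q * n ^ suc a ≤ C ^ ℚ.↧ₙ q

infix 4 _∈O[n^_]

-- For n ≥ 1, n^r is the infimum of n^q over the rationals q > r, so the
-- inequality T n ≤ C · n^r says exactly that T n ≤ C · n^q for all of them.
_∈O[n^_] : (ℕ → ℕ) → ℝ → Set
T ∈O[n^ r ] = ∃[ C ] ∃[ n₀ ] (∀ n → n₀ ≤ n → ∀ q → r <ℝ fromℚ q → PowerBound (T n) C n q)

-- M(n) = Õ(n)
SoftLinear : (ℕ → ℕ) → Set
SoftLinear M = ∃[ C ] ∃[ e ] ∃[ n₀ ] (∀ n → n₀ ≤ n → M n ≤ C * n * suc ⌊log₂ n ⌋ ^ e)

------------------------------------------------------------------------
-- Randomized word RAM.  A program has finitely many registers and a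
-- random-access memory, all holding w-bit words; arithmetic is modulo 2^w.
-- Control flow is structured: a program with jumps is, up to a constant factor
-- in time, a single loop dispatching on a program counter.

Register : Set
Register = ℕ

data Op : Set where
  add sub mul div rem and or xor shl shr lt eq : Op

data Program : Set where
  skip  : Program
  const : Register → ℕ → Program
  calc  : Register → Op → Register → Register → Program
  load  : (dst addr : Register) → Program
  store : (addr src : Register) → Program
  flip  : Register → Program
  _⨾_   : Program → Program → Program
  cond  : Register → Program → Program → Program
  while : Register → Program → Program

infixr 5 _⨾_

wrap : ℕ → ℕ → ℕ
wrap w x = (x % 2 ^ w) {{m^n≢0 2 w}}

bit : Bool → ℕ
bit b = if b then 1 else 0

bitwise : (Bool → Bool → Bool) → (w x y : ℕ) → ℕ
bitwise _∙_ zero    x y = 0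
bitwise _∙_ (suc w) x y =
  bit ((x % 2 ≡ᵇ 1) ∙ (y % 2 ≡ᵇ 1)) + 2 * bitwise _∙_ w (x / 2) (y / 2)

-- Division and remainder by 0 are 0.
evalOp : Op → (w x y : ℕ) → ℕ
evalOp add w x y       = wrap w (x + y)
evalOp sub w x y       = wrap w (x + 2 ^ w ∸ y)
evalOp mul w x y       = wrap w (x * y)
evalOp div w x zero    = 0
evalOp div w x (suc y) = wrap w (x / suc y)
evalOp rem w x zero    = 0
evalOp rem w x (suc y) = wrap w (x % suc y)
evalOp and w x y       = bitwise _∧_ w x y
evalOp or  w x y       = bitwise _∨_ w x y
evalOp xor w x y       = bitwise _xor_ w x y
evalOp shl w x y       = wrap w (x * 2 ^ y)
evalOp shr w x y       = wrap w ((x / 2 ^ y) {{m^n≢0 2 y}})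
evalOp lt  w x y       = wrap w (bit (x <ᵇ y))
evalOp eq  w x y       = wrap w (bit (x ≡ᵇ y))

infixl 6 _[_↦_]

_[_↦_] : (ℕ → ℕ) → ℕ → ℕ → (ℕ → ℕ)
(h [ i ↦ x ]) j = if i ≡ᵇ j then x else h j

record State : Set where
  constructor ⟨_,_,_⟩
  field
    reg   : ℕ → ℕ
    mem   : ℕ → ℕ
    coins : List Bool

open State public

infix 4 _⊢_,_⇓_,_

-- w ⊢ c , s ⇓ s′ , t : on w-bit words, c started in s halts in s′ after t steps.
-- There is no rule for flipping a coin when none is left.
data _⊢_,_⇓_,_ (w : ℕ) : Program → State → State → ℕ → Set where
  skip : ∀ {s} → w ⊢ skip , s ⇓ s , 1
  const : ∀ {r x ρ μ cs} →
    w ⊢ const r x , ⟨ ρ , μ , cs ⟩ ⇓ ⟨ ρ [ r ↦ wrap w x ] , μ , cs ⟩ , 1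
  calc : ∀ {r o a b ρ μ cs} →
    w ⊢ calc r o a b , ⟨ ρ , μ , cs ⟩ ⇓ ⟨ ρ [ r ↦ evalOp o w (ρ a) (ρ b) ] , μ , cs ⟩ , 1
  load : ∀ {r a ρ μ cs} →
    w ⊢ load r a , ⟨ ρ , μ , cs ⟩ ⇓ ⟨ ρ [ r ↦ μ (ρ a) ] , μ , cs ⟩ , 1
  store : ∀ {a r ρ μ cs} →
    w ⊢ store a r , ⟨ ρ , μ , cs ⟩ ⇓ ⟨ ρ , μ [ ρ a ↦ ρ r ] , cs ⟩ , 1
  flip : ∀ {r ρ μ b cs} →
    w ⊢ flip r , ⟨ ρ , μ , b ∷ cs ⟩ ⇓ ⟨ ρ [ r ↦ wrap w (bit b) ] , μ , cs ⟩ , 1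
  _⨾_ : ∀ {c d s s′ s″ t u} →
    w ⊢ c , s ⇓ s′ , t → w ⊢ d , s′ ⇓ s″ , u → w ⊢ c ⨾ d , s ⇓ s″ , t + u
  cond-zero : ∀ {r c d s s′ t} → reg s r ≡ 0 →
    w ⊢ d , s ⇓ s′ , t → w ⊢ cond r c d , s ⇓ s′ , suc t
  cond-nonzero : ∀ {r c d s s′ t} → reg s r ≢ 0 →
    w ⊢ c , s ⇓ s′ , t → w ⊢ cond r c d , s ⇓ s′ , suc t
  while-zero : ∀ {r c s} → reg s r ≡ 0 → w ⊢ while r c , s ⇓ s , 1
  while-nonzero : ∀ {r c s s′ s″ t u} → reg s r ≢ 0 →
    w ⊢ c , s ⇓ s′ , t → w ⊢ while r c , s′ ⇓ s″ , u → w ⊢ while r c , s ⇓ s″ , suc (t + u)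

-- O(log n) bits, where the constant c is chosen by the algorithm.
wordSize : (c n : ℕ) → ℕ
wordSize c n = c * suc ⌊log₂ n ⌋

wordAt : List ℕ → ℕ → ℕ
wordAt []       _       = 0
wordAt (x ∷ xs) zero    = x
wordAt (x ∷ xs) (suc i) = wordAt xs i

-- The input occupies an initial segment of the memory; everything else is 0.
initial : (w : ℕ) → List ℕ → List Bool → State
initial w input cs = ⟨ (λ _ → 0) , (λ a → wrap w (wordAt input a)) , cs ⟩

-- P holds with probability at least 2/3 over L fair coins: there are at least
-- (2/3) · 2^L distinct outcomes satisfying it.
WithProbability≥2/3 : (L : ℕ) → (List Bool → Set) → Set
WithProbability≥2/3 L P = ∃[ good ]
  (Unique {A = Vec Bool L} good × All (P ∘ toList) good × 2 * 2 ^ L ≤ 3 * length good)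

------------------------------------------------------------------------
-- Directed graphs on the vertex set Fin n, given by duplicate-free edge lists

Edge : ℕ → Set
Edge n = Fin n × Fin n

_≟ᴱ_ : ∀ {n} → DecidableEquality (Edge n)
_≟ᴱ_ = ≡-dec Fin._≟_ Fin._≟_

encode : (n : ℕ) → List (Edge n) → List ℕ
encode n E = n ∷ length E ∷ concatMap (λ (u , v) → toℕ u ∷ toℕ v ∷ []) E

data Walk {n} (E : List (Edge n)) : ℕ → Fin n → Fin n → Set where
  stop : ∀ {u} → Walk E 0 u u
  step : ∀ {l u v x} → (u , v) ∈ E → Walk E l v x → Walk E (suc l) u x

ℕ∞ : Set
ℕ∞ = ℕ ⁺

-- IsDistance E u v x says that d(u,v) = x; a shortest walk is a shortest path.
data IsDistance {n} (E : List (Edge n)) (u v : Fin n) : ℕ∞ → Set where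
  reachable   : ∀ {l} → Walk E l u v → (∀ {j} → Walk E j u v → l ≤ j) → IsDistance E u v [ l ]
  unreachable : (∀ {l} → ¬ Walk E l u v) → IsDistance E u v ⊤⁺

IsMaximum IsMinimum : (ℕ∞ → Set) → ℕ∞ → Set
IsMaximum P x = P x × (∀ {y} → P y → y ≤⁺ x)
IsMinimum P x = P x × (∀ {y} → P y → x ≤⁺ y)

IsEccentricity : ∀ {n} → List (Edge n) → Fin n → ℕ∞ → Set
IsEccentricity E v = IsMaximum (λ x → ∃[ u ] IsDistance E v u x)

IsDiameter IsRadius : ∀ {n} → List (Edge n) → ℕ∞ → Set
IsDiameter E = IsMaximum (λ x → ∃[ v ] IsEccentricity E v x)
IsRadius   E = IsMinimum (λ x → ∃[ v ] IsEccentricity E v x)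

data Parameter : Set where
  diameter radius eccentricity : Parameter

-- The fixed vertex is vertex 0.  An algorithm that receives an arbitrary fixed
-- vertex during preprocessing is in particular one for vertex 0.
IsValue : ∀ {n} → Parameter → List (Edge (suc n)) → ℕ∞ → Set
IsValue diameter     E = IsDiameter E
IsValue radius       E = IsRadius E
IsValue eccentricity E = IsEccentricity E zero

------------------------------------------------------------------------

IsCycle : ∀ {n} k .{{_ : NonZero k}} → List (Edge n) → (Fin k → Fin n) → Set
IsCycle k E v = Injective _≡_ _≡_ v × (∀ i → (v i , v (suc (toℕ i) mod k)) ∈ E)

-- Register 0 says whether there is a k-cycle; if so, registers 1, …, k list one.
data ReportsCycle {n} k .{{_ : NonZero k}} (E : List (Edge n)) (ρ : ℕ → ℕ) : Set where
  found : ∀ v → ρ 0 ≡ 1 → IsCycle k E v → (∀ i → ρ (suc (toℕ i)) ≡ toℕ (v i)) → ReportsCycle k E ρ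
  none  : ρ 0 ≡ 0 → (∀ v → ¬ IsCycle k E v) → ReportsCycle k E ρ

record Algorithm : Set where
  field
    wordConstant : ℕ
    program      : Program

FindsCycles : (k : ℕ) .{{_ : NonZero k}} → Algorithm → (ℕ → ℕ) → Set
FindsCycles k A T = ∀ n (E : List (Edge n)) → Unique E →
  let open Algorithm A
      w = wordSize wordConstant n
      m = length E
  in WithProbability≥2/3 (T m) λ cs →
       ∃[ s ] ∃[ t ] (w ⊢ program , initial w (encode n E) cs ⇓ s , t
                      × t ≤ T m × ReportsCycle k E (reg s))

-- "m^(2-f(k)-o(1)) time is needed": for no δ > 0 does O(m^(2-f(k)-δ)) time suffice.
KCycleHypothesis : Set
KCycleHypothesis = ∃[ f ] (Continuous f × VanishesAtInfinity f ×
  (∀ j → let k = 3 + j in ∀ δ → fromℕ 0 <ℝ δ →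
    ¬ (∃[ A ] ∃[ T ] (FindsCycles k A T × T ∈O[n^ fromℕ 2 -ℝ f (fromℕ k) -ℝ δ ]))))

------------------------------------------------------------------------

data Request (n : ℕ) : Set where
  insert delete : Edge n → Request n
  query         : Request n

updates queries : ∀ {n} → List (Request n) → ℕ
updates []             = 0
updates (insert _ ∷ σ) = suc (updates σ)
updates (delete _ ∷ σ) = suc (updates σ)
updates (query    ∷ σ) = updates σ
queries []             = 0
queries (insert _ ∷ σ) = queries σ
queries (delete _ ∷ σ) = queries σ
queries (query    ∷ σ) = suc (queries σ)

remove : ∀ {n} → Edge n → List (Edge n) → List (Edge n)
remove e = filter (λ e′ → ¬? (e ≟ᴱ e′))

-- Only absent edges are inserted, only present ones are deleted, and the graph
-- has at most M edges at all times.
data Admissible {n} (M : ℕ) : List (Edge n) → List (Request n) → Set where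
  []     : ∀ {E} → length E ≤ M → Admissible M E []
  insert : ∀ {E e σ} → length E ≤ M → e ∉ E → Admissible M (e ∷ E) σ → Admissible M E (insert e ∷ σ)
  delete : ∀ {E e σ} → length E ≤ M → e ∈ E → Admissible M (remove e E) σ → Admissible M E (delete e ∷ σ)
  query  : ∀ {E σ} → length E ≤ M → Admissible M E σ → Admissible M E (query ∷ σ)

record DynamicAlgorithm : Set where
  field
    wordConstant                         : ℕ
    preprocess onInsert onDelete onQuery : Program

-- The two endpoints are passed in registers 0 and 1.
withArguments : ∀ {n} → Edge n → (w : ℕ) → State → State
withArguments (u , v) w ⟨ ρ , μ , cs ⟩ =
  ⟨ ρ [ 0 ↦ wrap w (toℕ u) ] [ 1 ↦ wrap w (toℕ v) ] , μ , cs ⟩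

-- Answer 1 stands for "finite" and answer 0 for "infinite".
Reports : ℕ → ℕ∞ → Set
Reports a [ _ ] = a ≡ 1
Reports a ⊤⁺    = a ≡ 0

-- Serves w A π s E σ t : from state s, with current graph E, the requests σ are
-- processed in t steps in total and every query in σ is answered correctly.
data Serves {n} (w : ℕ) (A : DynamicAlgorithm) (π : Parameter) :
            State → List (Edge (suc n)) → List (Request (suc n)) → ℕ → Set where
  []     : ∀ {s E} → Serves w A π s E [] 0
  insert : ∀ {s s′ E e σ t u} →
    w ⊢ DynamicAlgorithm.onInsert A , withArguments e w s ⇓ s′ , t →
    Serves w A π s′ (e ∷ E) σ u → Serves w A π s E (insert e ∷ σ) (t + u)
  delete : ∀ {s s′ E e σ t u} →
    w ⊢ DynamicAlgorithm.onDelete A , withArguments e w s ⇓ s′ , t →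
    Serves w A π s′ (remove e E) σ u → Serves w A π s E (delete e ∷ σ) (t + u)
  query  : ∀ {s s′ E σ t u x} →
    w ⊢ DynamicAlgorithm.onQuery A , s ⇓ s′ , t →
    IsValue π E x → Reports (reg s′ 0) x →
    Serves w A π s′ E σ u → Serves w A π s E (query ∷ σ) (t + u)

-- A maintains π on graphs with n ≥ 1 vertices and at most M n edges, with
-- preprocessing time p, amortized update time u and amortized query time q,
-- over sequences of at most ℓ n requests.  The sequence is fixed before the
-- coins are flipped.  A bound ℓ is there because a randomized algorithm that
-- errs with probability n^(-O(1)) per query is only reliable on sequences of
-- polynomial length; a deterministic algorithm satisfies this for every ℓ.
Maintains : DynamicAlgorithm → Parameter → (M ℓ p u q : ℕ → ℕ) → Set
Maintains A π M ℓ p u q = ∀ n′ → let n = suc n′ in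
  ∀ (E : List (Edge n)) (σ : List (Request n)) →
  Unique E → Admissible (M n) E σ → length σ ≤ ℓ n →
  let open DynamicAlgorithm A
      w     = wordSize wordConstant n
      bound = p n + updates σ * u n + queries σ * q n
  in WithProbability≥2/3 bound λ cs →
       ∃[ s ] ∃[ t₁ ] ∃[ t₂ ] (w ⊢ preprocess , initial w (encode n E) cs ⇓ s , t₁
                               × Serves w A π s E σ t₂ × t₁ + t₂ ≤ bound)

{-# OPTIONS --safe #-}
module Submission where

-- Suppose that a dynamic algorithm beats the bounds.  Colour the vertices of a directed
-- graph with m edges, let vertices of colour i lead only to vertices of colour i + 1, and let
-- the edges from the last colour back to the first one end in copies of the vertices of the
-- first colour: a cycle of length k through x, coloured in order, is then a path from x to its
-- copy.  With a source and a target that has edges to all other vertices, inserting the edges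
-- from the source to x and from the copy of x to the target makes the parameter finite exactly
-- when there is such a path (for the diameter, all vertices also get an edge to the source).
-- Hence O(m) updates and queries per colouring decide whether some coloured cycle exists, and
-- it is then found by a search with parent pointers.
--
-- Distinct labels differ in some bit, so k² tests of single bits separate the vertices of a
-- cycle, and polylogarithmically many colourings suffice.  As they are deterministic, the
-- requests are fixed in advance, and the probability of success is that of the dynamic
-- algorithm.  This algorithm is run on words as short as the size of the constructed graph
-- prescribes, although the input may have many more vertices than edges: every result is
-- reduced modulo the smaller power of two, and its memory is moved above the tables.

open import Defs
open import Data.Bool using (Bool; true; false; if_then_else_; _∧_; _∨_; _xor_; T)
open import Data.Bool.Properties using (T-∧; T-∨)
open import Data.Empty using (⊥; ⊥-elim)
open import Data.Fin using (Fin; zero; suc; toℕ; fromℕ<; combine)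
import Data.Fin.Properties as Fin
open import Data.List using (List; []; _∷_; _++_; length; lookup; concatMap; map)
import Data.List.Properties as List
open import Data.List.Membership.Propositional using (_∈_; _∉_)
open import Data.List.Membership.Propositional.Properties using (∈-lookup; ∈-map⁻)
open import Data.List.Relation.Unary.All as All using (All; []; _∷_)
open import Data.List.Relation.Unary.Any as Any using (here; there)
open import Data.List.Relation.Unary.Any.Properties using (lookup-index)
open import Data.List.Relation.Unary.Unique.Propositional using (Unique)
open import Data.List.Relation.Unary.AllPairs using ([]; _∷_)
open import Data.Nat using (ℕ; zero; suc; _+_; _*_; _∸_; _^_; _≤_; _<_; _≡ᵇ_; _<ᵇ_; _≤ᵇ_; _≟_; _<?_; z≤n; s≤s; NonZero; >-nonZero; _⊔_; pred)
open import Data.Nat.DivMod hiding (_div_)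
open import Data.Nat.Divisibility as Div using (divides; m∣m*n)
open import Data.Nat.Logarithm using (⌊log₂_⌋; ⌊log₂[2^n]⌋≡n; ⌊log₂⌋-mono-≤)
open import Data.Nat.Properties
open import Data.Nat.Solver using (module +-*-Solver)
open import Data.Product using (_×_; _,_; ∃-syntax; proj₁; proj₂)
open import Data.Sum using (_⊎_; inj₁; inj₂)
open import Data.Unit using (⊤; tt)
open import Data.Vec using (Vec; toList)
open import Function using (_∘_; case_of_)
open import Relation.Binary.PropositionalEquality using (_≡_; _≢_; refl; sym; trans; cong; cong₂; subst; subst₂; setoid; module ≡-Reasoning)
open import Relation.Nullary using (¬_; yes; no; contradiction)
open import Relation.Nullary.Construct.Add.Supremum using ([_]; ⊤⁺)
open import Relation.Binary.Construct.Add.Supremum.NonStrict _≤_ using (_≤⁺_; _≤⊤⁺; [_])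
open import Function.Bundles using (module Equivalence)
import Data.List as List using (cartesianProductWith)
import Data.List.Relation.Unary.Unique.Propositional.Properties as Unique
import Data.List.Relation.Unary.All.Properties as All using (cartesianProductWith⁺)
import Data.Vec as Vec using ([]; _∷_; _++_)
import Data.Vec.Properties as Vec using (∷-injectiveʳ; ++-injective; toList-++)
import Data.Integer as ℤ
import Data.Integer.Properties as ℤ
open import Data.Rational as ℚ using (ℚ; 0ℚ; ½; mkℚ)
import Data.Rational.Properties as ℚ
open import Data.Rational.Unnormalised as ℚᵘ using (mkℚᵘ; *≡*; *≤*)
import Data.Rational.Unnormalised.Properties as ℚᵘ
import Data.Rational.Solver as ℚ
import Data.Nat as Nat

-- Arithmetic modulo powers of two

-- The amortized bounds limit only the total time over all requests, so the correctness proof of the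
-- host carries the remaining service time as a potential, and every simulated call is paid from it.
-- The guarantee on the dynamic algorithm concerns one word size for each number of vertices and
-- says nothing about longer words; this forces the simulation. Distances are never computed here,
-- so a finite answer yields a path only under a double negation. That is enough, because the search
-- then produces the path itself. The exponents fit as follows. If `ε` exceeds `1 / g`, the work per
-- colouring is `O(m ^ (2 - 1 / g))`. The polylogarithmically many colourings cost at most another
-- factor `O(m ^ (1 / (2 * g)))`, so that a saving of `1 / (2 * g)` is left. A cycle length `k` for
-- which `f(k)` is at most half of this saving, with `δ` as the other half, contradicts the
-- hypothesis. The number of colourings depends on `k`, but `k` is a constant once `ε` is fixed.

wrap-< : ∀ w x → wrap w x < 2 ^ w
wrap-< w x = m%n<n x (2 ^ w) {{m^n≢0 2 w}}

wrap-small : ∀ w {x} → x < 2 ^ w → wrap w x ≡ x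
wrap-small w = m<n⇒m%n≡m {{m^n≢0 2 w}}

2^-∣ : ∀ {w W} → w ≤ W → 2 ^ w Div.∣ 2 ^ W
2^-∣ {w} {W} w≤W = subst (2 ^ w Div.∣_)
  (trans (sym (^-distribˡ-+-* 2 w (W ∸ w))) (cong (2 ^_) (m+[n∸m]≡n w≤W))) (m∣m*n (2 ^ (W ∸ w)))

wrap-wrap : ∀ {w W} → w ≤ W → ∀ x → wrap w (wrap W x) ≡ wrap w x
wrap-wrap {w} {W} w≤W x = m∣n⇒o%n%m≡o%m (2 ^ w) (2 ^ W) x {{m^n≢0 2 w}} {{m^n≢0 2 W}} (2^-∣ w≤W)

bit≤1 : ∀ b → bit b ≤ 1
bit≤1 false = z≤n
bit≤1 true  = s≤s z≤n

-- Splits off the lowest bit, in step with the recursion of `bitwise`.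
wrap-suc : ∀ w b z → b ≤ 1 → wrap (suc w) (b + 2 * z) ≡ b + 2 * wrap w z
wrap-suc w b z b≤1 = begin
  (b + 2 * z) % (2 * 2 ^ w)
    ≡⟨ cong (λ x → (b + 2 * x) % (2 * 2 ^ w)) (m≡m%n+[m/n]*n z (2 ^ w)) ⟩
  (b + 2 * (z % 2 ^ w + z / 2 ^ w * 2 ^ w)) % (2 * 2 ^ w)
    ≡⟨ cong (_% (2 * 2 ^ w)) (solve 4 (λ b r q p → b :+ con 2 :* (r :+ q :* p) := (b :+ con 2 :* r) :+ q :* (con 2 :* p)) refl b (z % 2 ^ w) (z / 2 ^ w) (2 ^ w)) ⟩
  ((b + 2 * (z % 2 ^ w)) + z / 2 ^ w * (2 * 2 ^ w)) % (2 * 2 ^ w)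
    ≡⟨ [m+kn]%n≡m%n (b + 2 * (z % 2 ^ w)) (z / 2 ^ w) (2 * 2 ^ w) ⟩
  (b + 2 * (z % 2 ^ w)) % (2 * 2 ^ w)
    ≡⟨ m<n⇒m%n≡m bound ⟩
  b + 2 * (z % 2 ^ w) ∎
  where
  open ≡-Reasoning
  open +-*-Solver
  instance
    2^-nonZero : NonZero (2 ^ w)
    2^-nonZero = m^n≢0 2 w
    2^-suc-nonZero : NonZero (2 * 2 ^ w)
    2^-suc-nonZero = m^n≢0 2 (suc w)
  bound : b + 2 * (z % 2 ^ w) < 2 * 2 ^ w
  bound = ≤-trans (+-monoˡ-≤ (2 * (z % 2 ^ w)) (s≤s b≤1))
    (≤-trans (≤-reflexive (sym (*-suc 2 (z % 2 ^ w)))) (*-monoʳ-≤ 2 (m%n<n z (2 ^ w))))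

wrap-bitwise : ∀ _∙_ {w W} → w ≤ W → ∀ x y → wrap w (bitwise _∙_ W x y) ≡ bitwise _∙_ w x y
wrap-bitwise _∙_ {zero}  {W}     w≤W       x y = n%1≡0 (bitwise _∙_ W x y)
wrap-bitwise _∙_ {suc w} {suc W} (s≤s w≤W) x y =
  trans (wrap-suc w (bit b) (bitwise _∙_ W (x / 2) (y / 2)) (bit≤1 b))
        (cong (λ z → bit b + 2 * z) (wrap-bitwise _∙_ w≤W (x / 2) (y / 2)))
  where
  b = (x % 2 ≡ᵇ 1) ∙ (y % 2 ≡ᵇ 1)

-- Both machines apply the operation to the same operands, so even `div`, `shr`, `lt` and `eq`,
-- which do not commute with reduction, differ only in the final `wrap`. The bound on `y` serves
-- `sub`: for a larger `y` the truncated subtraction in `x + 2 ^ w ∸ y` could stop at 0.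
wrap-evalOp : ∀ o {w W} → w ≤ W → ∀ x y → y < 2 ^ w → wrap w (evalOp o W x y) ≡ evalOp o w x y
wrap-evalOp add w≤W x y _ = wrap-wrap w≤W (x + y)
wrap-evalOp sub {w} {W} w≤W x y y< = begin
  wrap w (wrap W (x + 2 ^ W ∸ y))  ≡⟨ wrap-wrap w≤W (x + 2 ^ W ∸ y) ⟩
  wrap w (x + 2 ^ W ∸ y)           ≡⟨ cong (wrap w) split ⟩
  wrap w (x + 2 ^ w ∸ y + p * 2 ^ w) ≡⟨ [m+kn]%n≡m%n (x + 2 ^ w ∸ y) p (2 ^ w) {{m^n≢0 2 w}} ⟩
  wrap w (x + 2 ^ w ∸ y) ∎
  where
  open ≡-Reasoning
  q = 2 ^ (W ∸ w)
  p = pred q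
  -- The excess of `2 ^ W` over `2 ^ w` is a multiple of `2 ^ w`, which disappears under `wrap w`.
  big : 2 ^ W ≡ 2 ^ w + p * 2 ^ w
  big = trans (sym (trans (sym (^-distribˡ-+-* 2 w (W ∸ w))) (cong (2 ^_) (m+[n∸m]≡n w≤W))))
    (trans (*-comm (2 ^ w) q) (cong (_* 2 ^ w) (sym (suc-pred q {{m^n≢0 2 (W ∸ w)}}))))
  split : x + 2 ^ W ∸ y ≡ x + 2 ^ w ∸ y + p * 2 ^ w
  split = trans (cong (λ v → x + v ∸ y) big) (trans (cong (_∸ y) (sym (+-assoc x (2 ^ w) (p * 2 ^ w))))
    (+-∸-comm (p * 2 ^ w) (≤-trans (<⇒≤ y<) (m≤n+m (2 ^ w) x))))
wrap-evalOp mul w≤W x y _ = wrap-wrap w≤W (x * y)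
wrap-evalOp div {w} w≤W x zero _ = wrap-small w (m^n>0 2 w)
wrap-evalOp div w≤W x (suc y) _ = wrap-wrap w≤W (x / suc y)
wrap-evalOp rem {w} w≤W x zero _ = wrap-small w (m^n>0 2 w)
wrap-evalOp rem w≤W x (suc y) _ = wrap-wrap w≤W (x % suc y)
wrap-evalOp and w≤W x y _ = wrap-bitwise _∧_ w≤W x y
wrap-evalOp or  w≤W x y _ = wrap-bitwise _∨_ w≤W x y
wrap-evalOp xor w≤W x y _ = wrap-bitwise _xor_ w≤W x y
wrap-evalOp shl w≤W x y _ = wrap-wrap w≤W (x * 2 ^ y)
wrap-evalOp shr w≤W x y _ = wrap-wrap w≤W ((x / 2 ^ y) {{m^n≢0 2 y}})
wrap-evalOp lt  w≤W x y _ = wrap-wrap w≤W (bit (x <ᵇ y))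
wrap-evalOp eq  w≤W x y _ = wrap-wrap w≤W (bit (x ≡ᵇ y))

evalOp-rem : ∀ W x y .{{_ : NonZero y}} → evalOp rem W x y ≡ wrap W (x % y)
evalOp-rem W x (suc y) = refl

evalOp-div : ∀ W x y .{{_ : NonZero y}} → evalOp div W x y ≡ wrap W (x / y)
evalOp-div W x (suc y) = refl

evalOp-rem-2^ : ∀ {w W} → w ≤ W → ∀ x → evalOp rem W x (2 ^ w) ≡ wrap w x
evalOp-rem-2^ {w} {W} w≤W x = trans (evalOp-rem W x (2 ^ w) {{m^n≢0 2 w}})
  (wrap-small W (<-≤-trans (wrap-< w x) (^-monoʳ-≤ 2 w≤W)))

update-same : ∀ (h : ℕ → ℕ) i x → (h [ i ↦ x ]) i ≡ x
update-same h i x with i ≡ᵇ i in p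
... | true  = refl
... | false = ⊥-elim (subst T p (≡⇒≡ᵇ i i refl))

update-other : ∀ (h : ℕ → ℕ) {i j} x → i ≢ j → (h [ i ↦ x ]) j ≡ h j
update-other h {i} {j} x i≢j with i ≡ᵇ j in p
... | true  = contradiction (≡ᵇ⇒≡ i j (subst T (sym p) tt)) i≢j
... | false = refl

-- Simulating a machine with shorter words in the upper part of the memory

-- Registers 0, …, 12 hold constants, 13, 14, 15 the recorded answer; 24, …, 31 are
-- scratch, and the registers from 32 on belong to the simulated machine.

pattern rZero  = 0
pattern rOne   = 1
pattern rTwo   = 2
pattern rM     = 3
pattern rLen   = 4
pattern rTable = 5
pattern rPar   = 6
pattern rBase  = 7
pattern rMod   = 8
pattern rN     = 9
pattern rWidth = 10
pattern rK     = 11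
pattern rZs    = 12
pattern rFound = 13
pattern rFz    = 14
pattern rFx    = 15
pattern rZ     = 16
pattern rO     = 17
pattern rS     = 18
pattern rI     = 19
pattern rJ     = 20
pattern rU     = 21
pattern rV     = 22
pattern rAct   = 23
pattern rQ     = 24
pattern rX     = 25
pattern rE     = 26
pattern rF     = 27
pattern rC     = 28
pattern rD     = 29
pattern rTmp   = 31

guest : Register → Register
guest r = 32 + r

mask : Register → Program
mask r = calc (guest r) rem (guest r) rMod

-- An instruction becomes at most two, whence the factor 2 in `Step`. Loads and stores need no mask,
-- since the part of the memory that they reach holds only guest words. Of the host's own registers
-- only `rTmp` is overwritten.
embed : Program → Program
embed skip           = skip
embed (const r x)    = const (guest r) x ⨾ mask r
embed (calc r o a b) = calc (guest r) o (guest a) (guest b) ⨾ mask r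
embed (load r a)     = calc rTmp add rBase (guest a) ⨾ load (guest r) rTmp
embed (store a r)    = calc rTmp add rBase (guest a) ⨾ store rTmp (guest r)
embed (flip r)       = flip (guest r) ⨾ mask r
embed (c ⨾ d)        = embed c ⨾ embed d
embed (cond r c d)   = cond (guest r) (embed c) (embed d)
embed (while r c)    = while (guest r) (embed c)

module Simulation (w W base : ℕ) (w≤W : w ≤ W) (fits : base + 2 ^ w ≤ 2 ^ W) (extra : List Bool) where

  -- The invariants `reg-<` and `mem-<` ensure that `base` plus a guest address does not overflow,
  -- by `fits`, and that `wrap-evalOp` applies. Memory is compared only below `2 ^ w`, as the guest
  -- can address nothing else.
  record Sim (S s : State) : Set where
    field
      base-reg : reg S rBase ≡ base
      mod-reg  : reg S rMod ≡ 2 ^ w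
      regs     : ∀ r → reg S (guest r) ≡ reg s r
      mems     : ∀ a → a < 2 ^ w → mem S (base + a) ≡ mem s a
      coins≡   : coins S ≡ coins s ++ extra
      reg-<    : ∀ r → reg s r < 2 ^ w
      mem-<    : ∀ a → a < 2 ^ w → mem s a < 2 ^ w

  record Frame (S S′ : State) : Set where
    field
      regs : ∀ r → T (r <ᵇ 31) → reg S′ r ≡ reg S r
      mems : ∀ a → a < base → mem S′ a ≡ mem S a

  frame-refl : ∀ {S} → Frame S S
  frame-refl .Frame.regs _ _ = refl
  frame-refl .Frame.mems _ _ = refl

  frame-trans : ∀ {S S′ S″} → Frame S S′ → Frame S′ S″ → Frame S S″
  frame-trans F G .Frame.regs r p = trans (Frame.regs G r p) (Frame.regs F r p)
  frame-trans F G .Frame.mems a p = trans (Frame.mems G a p) (Frame.mems F a p)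

  own≢guest : ∀ {r} i → T (r <ᵇ 31) → (32 + i ≡ᵇ r) ≡ false
  own≢guest {r} i p with 32 + i ≡ᵇ r in q
  ... | false = refl
  ... | true  = ⊥-elim (<⇒≱ (<ᵇ⇒< r 31 p) (subst (31 ≤_) (≡ᵇ⇒≡ (32 + i) r (subst T (sym q) tt)) (m≤m+n 31 (suc i))))

  own≢tmp : ∀ {r} → T (r <ᵇ 31) → (31 ≡ᵇ r) ≡ false
  own≢tmp {r} p with 31 ≡ᵇ r in q
  ... | false = refl
  ... | true  = ⊥-elim (<⇒≱ (<ᵇ⇒< r 31 p) (≤-reflexive (≡ᵇ⇒≡ 31 r (subst T (sym q) tt))))

  -- y is the unmasked result of the host instruction, overwritten by mask.
  write : ∀ {ρ μ cs s r x y z} → Sim ⟨ ρ , μ , cs ⟩ s → z ≡ x → x < 2 ^ w →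
    let S′ = ⟨ ρ [ guest r ↦ y ] [ guest r ↦ z ] , μ , cs ⟩
    in Sim S′ ⟨ reg s [ r ↦ x ] , mem s , coins s ⟩ × Frame ⟨ ρ , μ , cs ⟩ S′
  write {ρ} {μ} {cs} {s} {r} {x} {y} {z} S refl x< = sim , fr
    where
    sim : Sim ⟨ ρ [ guest r ↦ y ] [ guest r ↦ z ] , μ , cs ⟩ ⟨ reg s [ r ↦ z ] , mem s , coins s ⟩
    sim .Sim.base-reg = Sim.base-reg S
    sim .Sim.mod-reg = Sim.mod-reg S
    sim .Sim.regs i with r ≡ᵇ i
    ... | true  = refl
    ... | false = Sim.regs S i
    sim .Sim.mems = Sim.mems S
    sim .Sim.coins≡ = Sim.coins≡ S
    sim .Sim.reg-< i with r ≡ᵇ i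
    ... | true  = x<
    ... | false = Sim.reg-< S i
    sim .Sim.mem-< = Sim.mem-< S
    fr : Frame ⟨ ρ , μ , cs ⟩ ⟨ ρ [ guest r ↦ y ] [ guest r ↦ z ] , μ , cs ⟩
    fr .Frame.regs i p rewrite own≢guest {i} r p = refl
    fr .Frame.mems _ _ = refl

  recoin : ∀ {ρ μ xs g h ys} zs → Sim ⟨ ρ , μ , xs ⟩ ⟨ g , h , ys ⟩ → Sim ⟨ ρ , μ , zs ++ extra ⟩ ⟨ g , h , zs ⟩
  recoin zs S = record
    { base-reg = Sim.base-reg S ; mod-reg = Sim.mod-reg S ; regs = Sim.regs S ; mems = Sim.mems S
    ; coins≡ = refl ; reg-< = Sim.reg-< S ; mem-< = Sim.mem-< S }

  assign : ∀ {ρ μ cs s x} r → Sim ⟨ ρ , μ , cs ⟩ s → x < 2 ^ w →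
    Sim ⟨ ρ [ guest r ↦ x ] , μ , cs ⟩ ⟨ reg s [ r ↦ x ] , mem s , coins s ⟩
  assign {ρ} {μ} {cs} {s} {x} r S x< = sim
    where
    sim : Sim ⟨ ρ [ guest r ↦ x ] , μ , cs ⟩ ⟨ reg s [ r ↦ x ] , mem s , coins s ⟩
    sim .Sim.base-reg = Sim.base-reg S
    sim .Sim.mod-reg = Sim.mod-reg S
    sim .Sim.regs i with r ≡ᵇ i
    ... | true  = refl
    ... | false = Sim.regs S i
    sim .Sim.mems = Sim.mems S
    sim .Sim.coins≡ = Sim.coins≡ S
    sim .Sim.reg-< i with r ≡ᵇ i
    ... | true  = x<
    ... | false = Sim.reg-< S i
    sim .Sim.mem-< = Sim.mem-< S

  Step : Program → State → State → ℕ → Set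
  Step c S s′ t = ∃[ S′ ] ∃[ t′ ] (W ⊢ embed c , S ⇓ S′ , t′ × t′ ≤ 2 * t × Sim S′ s′ × Frame S S′)

  private
    lookup-same : ∀ (ρ : ℕ → ℕ) r x → (ρ [ guest r ↦ x ]) (guest r) ≡ x
    lookup-same ρ r x = update-same ρ (guest r) x

    masked : ∀ {ρ μ cs s r y} → Sim ⟨ ρ , μ , cs ⟩ s →
      let ρ′ = ρ [ guest r ↦ y ] in evalOp rem W (ρ′ (guest r)) (ρ′ rMod) ≡ wrap w y
    masked {ρ} {r = r} {y = y} S
      rewrite Sim.mod-reg S | lookup-same ρ r y = evalOp-rem-2^ w≤W y

    address : ∀ {ρ μ cs s a} → Sim ⟨ ρ , μ , cs ⟩ s → evalOp add W (ρ rBase) (ρ (guest a)) ≡ base + reg s a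
    address {a = a} S rewrite Sim.base-reg S | Sim.regs S a =
      wrap-small W (<-≤-trans (+-monoʳ-< base (Sim.reg-< S a)) fits)

    2≤2*1 : 2 ≤ 2 * 1
    2≤2*1 = ≤-refl

  simulate : ∀ {c s s′ t} → w ⊢ c , s ⇓ s′ , t → ∀ {S} → Sim S s → Step c S s′ t
  simulate skip {S} sim = S , 1 , skip , s≤s z≤n , sim , frame-refl
  simulate (const {r} {x}) {⟨ ρ , μ , cs ⟩} sim =
    _ , _ , const ⨾ calc , 2≤2*1 ,
    write {r = r} sim (trans (masked {r = r} sim) (wrap-wrap w≤W x)) (wrap-< w x)
  simulate (calc {r} {o} {a} {b} {ρ = g}) {⟨ ρ , μ , cs ⟩} sim =
    -- The guest's result equals a `wrap w`, which bounds it by `2 ^ w`.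
    _ , _ , calc ⨾ calc , 2≤2*1 , write {r = r} sim value (subst (_< 2 ^ w) value′ (wrap-< w _))
    where
    value′ : wrap w (evalOp o W (g a) (g b)) ≡ evalOp o w (g a) (g b)
    value′ = wrap-evalOp o w≤W (g a) (g b) (Sim.reg-< sim b)
    value : _ ≡ evalOp o w (g a) (g b)
    value = trans (masked {r = r} sim) (trans (cong₂ (λ x y → wrap w (evalOp o W x y)) (Sim.regs sim a) (Sim.regs sim b)) value′)
  simulate (load {r} {a} {g} {μ = h}) {⟨ ρ , μ , cs ⟩} sim =
    _ , _ , calc ⨾ load , 2≤2*1 , sim′ , fr
    where
    value : μ (evalOp add W (ρ rBase) (ρ (guest a))) ≡ h (g a)
    value = trans (cong μ (address {a = a} sim)) (Sim.mems sim (g a) (Sim.reg-< sim a))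
    ρ′ = ρ [ rTmp ↦ evalOp add W (ρ rBase) (ρ (guest a)) ]
    ρ″ = ρ′ [ guest r ↦ μ (ρ′ rTmp) ]
    sim′ : Sim ⟨ ρ″ , μ , cs ⟩ ⟨ g [ r ↦ h (g a) ] , h , _ ⟩
    sim′ .Sim.base-reg = Sim.base-reg sim
    sim′ .Sim.mod-reg = Sim.mod-reg sim
    sim′ .Sim.regs i with r ≡ᵇ i
    ... | true  = value
    ... | false = Sim.regs sim i
    sim′ .Sim.mems = Sim.mems sim
    sim′ .Sim.coins≡ = Sim.coins≡ sim
    sim′ .Sim.reg-< i with r ≡ᵇ i
    ... | true  = Sim.mem-< sim (g a) (Sim.reg-< sim a)
    ... | false = Sim.reg-< sim i
    sim′ .Sim.mem-< = Sim.mem-< sim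
    fr : Frame ⟨ ρ , μ , cs ⟩ ⟨ ρ″ , μ , cs ⟩
    fr .Frame.regs i p rewrite own≢guest {i} r p | own≢tmp {i} p = refl
    fr .Frame.mems _ _ = refl
  simulate (store {a} {r} {g} {h}) {⟨ ρ , μ , cs ⟩} sim =
    _ , _ , calc ⨾ store , 2≤2*1 , sim′ , fr
    where
    addr≡ = address {a = a} sim
    ρ′ = ρ [ rTmp ↦ evalOp add W (ρ rBase) (ρ (guest a)) ]
    μ′ = μ [ ρ′ rTmp ↦ ρ′ (guest r) ]
    sim′ : Sim ⟨ ρ′ , μ′ , cs ⟩ ⟨ g , h [ g a ↦ g r ] , _ ⟩
    sim′ .Sim.base-reg = Sim.base-reg sim
    sim′ .Sim.mod-reg = Sim.mod-reg sim
    sim′ .Sim.regs = Sim.regs sim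
    sim′ .Sim.mems i i< rewrite addr≡ with g a ≟ i
    ... | yes refl = trans (update-same μ (base + g a) _) (trans (Sim.regs sim r) (sym (update-same h (g a) (g r))))
    ... | no  ga≢i = trans (update-other μ _ (λ e → ga≢i (+-cancelˡ-≡ base (g a) i e)))
                       (trans (Sim.mems sim i i<) (sym (update-other h (g r) ga≢i)))
    sim′ .Sim.coins≡ = Sim.coins≡ sim
    sim′ .Sim.reg-< = Sim.reg-< sim
    sim′ .Sim.mem-< i i< with g a ≡ᵇ i
    ... | true  = Sim.reg-< sim r
    ... | false = Sim.mem-< sim i i<
    fr : Frame ⟨ ρ , μ , cs ⟩ ⟨ ρ′ , μ′ , cs ⟩
    fr .Frame.regs i p rewrite own≢tmp {i} p = refl
    fr .Frame.mems i i< rewrite addr≡ = update-other μ _ (λ e → <⇒≱ i< (subst (base ≤_) e (m≤m+n base (g a))))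
  simulate (flip {r} {b = b}) {⟨ ρ , μ , cs ⟩} sim with cs | Sim.coins≡ sim
  ... | _ | refl =
    let sim′ , fr = write {r = r} (recoin _ sim) (trans (masked {r = r} sim) (wrap-wrap w≤W (bit b))) (wrap-< w (bit b))
    in _ , _ , flip ⨾ calc , 2≤2*1 , sim′ , record { regs = Frame.regs fr ; mems = Frame.mems fr }
  simulate (_⨾_ {t = t} {u} d e) sim =
    let _ , t₁ , d′ , t₁≤ , sim₁ , fr₁ = simulate d sim
        _ , t₂ , e′ , t₂≤ , sim₂ , fr₂ = simulate e sim₁
    in _ , _ , d′ ⨾ e′ , ≤-trans (+-mono-≤ t₁≤ t₂≤) (≤-reflexive (sym (*-distribˡ-+ 2 t u))) , sim₂ , frame-trans fr₁ fr₂
  simulate (cond-zero {r} {t = t} r≡0 d) sim =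
    let _ , _ , d′ , t≤ , sim₁ , fr = simulate d sim
    in _ , _ , cond-zero (trans (Sim.regs sim r) r≡0) d′ ,
       ≤-trans (s≤s t≤) (≤-trans (n≤1+n _) (≤-reflexive (sym (*-suc 2 t)))) , sim₁ , fr
  simulate (cond-nonzero {r} {t = t} r≢0 d) sim =
    let _ , _ , d′ , t≤ , sim₁ , fr = simulate d sim
    in _ , _ , cond-nonzero (r≢0 ∘ trans (sym (Sim.regs sim r))) d′ ,
       ≤-trans (s≤s t≤) (≤-trans (n≤1+n _) (≤-reflexive (sym (*-suc 2 t)))) , sim₁ , fr
  simulate (while-zero {r} r≡0) {S} sim = S , 1 , while-zero (trans (Sim.regs sim r) r≡0) , s≤s z≤n , sim , frame-refl
  simulate (while-nonzero {r} {t = t} {u} r≢0 d e) sim =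
    let _ , t₁ , d′ , t₁≤ , sim₁ , fr₁ = simulate d sim
        _ , t₂ , e′ , t₂≤ , sim₂ , fr₂ = simulate e sim₁
    in _ , _ , while-nonzero (r≢0 ∘ trans (sym (Sim.regs sim r))) d′ e′ ,
       ≤-trans (s≤s (+-mono-≤ t₁≤ t₂≤))
         (≤-trans (n≤1+n _) (≤-reflexive (sym (trans (*-suc 2 (t + u)) (cong (2 +_) (*-distribˡ-+ 2 t u)))))) ,
       sim₂ , frame-trans fr₁ fr₂

-- A program logic with amortized time

-- A time bound for loop-free code. For embedded programs, which may contain loops, it is merely a
-- constant that lets every budget have the form `size c`; their actual time is paid by the
-- potential.
size : Program → ℕ
size (c ⨾ d)      = size c + size d
size (cond r c d) = suc (size c + size d)
size (while r c)  = suc (size c)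
size _            = 1

infix 4 _≋[_]_

-- Only the host registers from `b` to 31 may differ; the guest's registers start at 32.
record _≋[_]_ (S′ : State) (b : ℕ) (S : State) : Set where
  constructor agree
  field
    regs  : ∀ r → T ((r <ᵇ b) ∨ (31 <ᵇ r)) → reg S′ r ≡ reg S r
    mem≡  : mem S′ ≡ mem S
    coin≡ : coins S′ ≡ coins S

move : Register → Register → Program
move r a = calc r add a rZero

-- A `while` can only test for zero, so one counter runs down. Insertions read the counter that runs
-- up and deletions the one that runs down, which yields the reverse order.
loop : (rUp rDown rBound : Register) → Program → Program
loop rUp rDown rBound c =
  const rUp 0 ⨾ move rDown rBound ⨾
  while rDown (calc rDown sub rDown rOne ⨾ c ⨾ calc rUp add rUp rOne)

-- Two steps initialize the counters and one is the final test; each iteration adds a test and two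
-- counter updates to its body.
loopCost : ℕ → ℕ → ℕ
loopCost L B = 3 + L * (3 + B)

module Logic (W : ℕ) where

  -- φ is a potential: time spent may be charged to its decrease.
  record Run (c : Program) (S : State) (φ B : ℕ) (Q : State → ℕ → Set) : Set where
    constructor ran
    field
      outcome : ∃[ S′ ] ∃[ t ] ∃[ φ′ ] (W ⊢ c , S ⇓ S′ , t × t + φ′ ≤ B + φ × Q S′ φ′)

  weaken : ∀ {c S φ B B′ Q} → B ≤ B′ → Run c S φ B Q → Run c S φ B′ Q
  weaken {φ = φ} B≤ (ran (S′ , t , φ′ , d , t≤ , q)) = ran (S′ , t , φ′ , d , ≤-trans t≤ (+-monoˡ-≤ φ B≤) , q)

  consequence : ∀ {c S φ B} {P Q : State → ℕ → Set} → Run c S φ B P → (∀ {S′ φ′} → P S′ φ′ → Q S′ φ′) → Run c S φ B Q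
  consequence (ran (S′ , t , φ′ , d , t≤ , p)) f = ran (S′ , t , φ′ , d , t≤ , f p)

  -- With potential 0 the time is at most `B` alone, so any potential can be carried past the run
  -- untouched.
  no-charge : ∀ {c S φ B} {Q : State → Set} → Run c S 0 B (λ S′ _ → Q S′) → Run c S φ B (λ S′ φ′ → φ′ ≡ φ × Q S′)
  no-charge {φ = φ} {B} (ran (S′ , t , φ′ , d , t≤ , q)) = ran (S′ , t , φ , d ,
    +-monoˡ-≤ φ (≤-trans (m≤m+n t φ′) (≤-trans t≤ (≤-reflexive (+-identityʳ B)))) , refl , q)

  bind : ∀ {c d S φ B B′} {P Q : State → ℕ → Set} → Run c S φ B P →
         (∀ {S′ φ′} → P S′ φ′ → Run d S′ φ′ B′ Q) → Run (c ⨾ d) S φ (B + B′) Q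
  bind {φ = φ} {B} {B′} (ran (S₁ , t₁ , φ₁ , d₁ , le₁ , p)) f with f p
  ... | ran (S₂ , t₂ , φ₂ , d₂ , le₂ , q) = ran (S₂ , t₁ + t₂ , φ₂ , d₁ ⨾ d₂ , le , q)
    where
    open ≤-Reasoning
    le : t₁ + t₂ + φ₂ ≤ B + B′ + φ
    le = begin
      t₁ + t₂ + φ₂     ≡⟨ +-assoc t₁ t₂ φ₂ ⟩
      t₁ + (t₂ + φ₂)   ≤⟨ +-monoʳ-≤ t₁ le₂ ⟩
      t₁ + (B′ + φ₁)   ≡⟨ solve 3 (λ a b c → a :+ (b :+ c) := b :+ (a :+ c)) refl t₁ B′ φ₁ ⟩
      B′ + (t₁ + φ₁)   ≤⟨ +-monoʳ-≤ B′ le₁ ⟩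
      B′ + (B + φ)     ≡⟨ solve 3 (λ a b c → a :+ (b :+ c) := b :+ a :+ c) refl B′ B φ ⟩
      B + B′ + φ ∎
      where open +-*-Solver

  instruction : ∀ {c S S₁ φ} {Q : State → ℕ → Set} → W ⊢ c , S ⇓ S₁ , 1 → Q S₁ φ → Run c S φ 1 Q
  instruction d q = ran (_ , 1 , _ , d , ≤-refl , q)

  infixr 1 _▹_

  _▹_ : ∀ {c d S S₁ φ B Q} → W ⊢ c , S ⇓ S₁ , 1 → Run d S₁ φ B Q → Run (c ⨾ d) S φ (suc B) Q
  e ▹ ran (S₂ , t , φ′ , d , le , q) = ran (S₂ , suc t , φ′ , e ⨾ d , s≤s le , q)

  infixl 5 _≔_

  _≔_ : State → ℕ × ℕ → State
  S ≔ (r , x) = ⟨ reg S [ r ↦ x ] , mem S , coins S ⟩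

  by-calc : ∀ {r o a b S x y z} → reg S a ≡ x → reg S b ≡ y → evalOp o W x y ≡ z →
            W ⊢ calc r o a b , S ⇓ S ≔ (r , z) , 1
  by-calc refl refl refl = calc

  by-const : ∀ {r x S} → x < 2 ^ W → W ⊢ const r x , S ⇓ S ≔ (r , x) , 1
  by-const {r} {x} {S} x< = subst (λ v → W ⊢ const r x , S ⇓ S ≔ (r , v) , 1) (wrap-small W x<) const

  by-load : ∀ {r a S x y} → reg S a ≡ x → mem S x ≡ y → W ⊢ load r a , S ⇓ S ≔ (r , y) , 1
  by-load refl refl = load

  by-store : ∀ {a r S x y} → reg S a ≡ x → reg S r ≡ y → W ⊢ store a r , S ⇓ ⟨ reg S , mem S [ x ↦ y ] , coins S ⟩ , 1
  by-store refl refl = store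

  by-add : ∀ {r a b S x y} → reg S a ≡ x → reg S b ≡ y → x + y < 2 ^ W → W ⊢ calc r add a b , S ⇓ S ≔ (r , x + y) , 1
  by-add p q b = by-calc p q (wrap-small W b)

  by-sub : ∀ {r a b S x y} → reg S a ≡ x → reg S b ≡ y → y ≤ x → x < 2 ^ W → W ⊢ calc r sub a b , S ⇓ S ≔ (r , x ∸ y) , 1
  by-sub {x = x} {y} p q y≤x x< = by-calc p q (trans (cong (wrap W) split)
    (trans ([m+kn]%n≡m%n (x ∸ y) 1 (2 ^ W) {{m^n≢0 2 W}}) (wrap-small W (≤-<-trans (m∸n≤m x y) x<))))
    where
    split : x + 2 ^ W ∸ y ≡ x ∸ y + 1 * 2 ^ W
    split = trans (+-∸-comm (2 ^ W) y≤x) (cong (x ∸ y +_) (sym (*-identityˡ (2 ^ W))))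

  by-mul : ∀ {r a b S x y} → reg S a ≡ x → reg S b ≡ y → x * y < 2 ^ W → W ⊢ calc r mul a b , S ⇓ S ≔ (r , x * y) , 1
  by-mul p q b = by-calc p q (wrap-small W b)

  by-div : ∀ {r a b S x y} .{{_ : NonZero y}} → reg S a ≡ x → reg S b ≡ y → x < 2 ^ W →
           W ⊢ calc r div a b , S ⇓ S ≔ (r , x / y) , 1
  by-div {x = x} {y} p q b = by-calc p q (trans (evalOp-div W x y) (wrap-small W (≤-<-trans (m/n≤m x y) b)))

  by-rem : ∀ {r a b S x y} .{{_ : NonZero y}} → reg S a ≡ x → reg S b ≡ y → x < 2 ^ W →
           W ⊢ calc r rem a b , S ⇓ S ≔ (r , x % y) , 1
  by-rem {x = x} {y} p q b = by-calc p q (trans (evalOp-rem W x y) (wrap-small W (≤-<-trans (m%n≤m x y) b)))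

  by-shr : ∀ {r a b S x y} → reg S a ≡ x → reg S b ≡ y → x < 2 ^ W →
           W ⊢ calc r shr a b , S ⇓ S ≔ (r , (x / 2 ^ y) {{m^n≢0 2 y}}) , 1
  by-shr {x = x} {y} p q b = by-calc p q (wrap-small W (≤-<-trans (m/n≤m x (2 ^ y) {{m^n≢0 2 y}}) b))

  by-bit : ∀ {b} → 2 ≤ 2 ^ W → wrap W (bit b) ≡ bit b
  by-bit {b} 2≤ = wrap-small W (<-≤-trans (s≤s (bit≤1 b)) 2≤)

  by-eq : ∀ {r a b S x y} → reg S a ≡ x → reg S b ≡ y → 2 ≤ 2 ^ W → W ⊢ calc r eq a b , S ⇓ S ≔ (r , bit (x ≡ᵇ y)) , 1
  by-eq p q 2≤ = by-calc p q (by-bit 2≤)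

  by-lt : ∀ {r a b S x y} → reg S a ≡ x → reg S b ≡ y → 2 ≤ 2 ^ W → W ⊢ calc r lt a b , S ⇓ S ≔ (r , bit (x <ᵇ y)) , 1
  by-lt p q 2≤ = by-calc p q (by-bit 2≤)

  by-move : ∀ {r a S x} → reg S a ≡ x → reg S rZero ≡ 0 → x < 2 ^ W → W ⊢ move r a , S ⇓ S ≔ (r , x) , 1
  by-move {x = x} p q b = by-calc p q (trans (cong (wrap W) (+-identityʳ x)) (wrap-small W b))

  branch : ∀ {r c d S φ B B′ Q} → (reg S r ≢ 0 → Run c S φ B Q) → (reg S r ≡ 0 → Run d S φ B′ Q) →
           Run (cond r c d) S φ (suc (B + B′)) Q
  branch {r} {S = S} {φ} {B} {B′} f g with reg S r ≟ 0
  ... | yes p = let ran (S′ , t , φ′ , e , le , q) = g p in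
    ran (S′ , suc t , φ′ , cond-zero p e , s≤s (≤-trans le (+-monoˡ-≤ φ (m≤n+m B′ B))) , q)
  ... | no p  = let ran (S′ , t , φ′ , e , le , q) = f p in
    ran (S′ , suc t , φ′ , cond-nonzero p e , s≤s (≤-trans le (+-monoˡ-≤ φ (m≤m+n B B′))) , q)

  ≋-refl : ∀ {b S} → S ≋[ b ] S
  ≋-refl = agree (λ _ _ → refl) refl refl

  ≋-trans : ∀ {b S S′ S″} → S″ ≋[ b ] S′ → S′ ≋[ b ] S → S″ ≋[ b ] S
  ≋-trans (agree p q r) (agree p′ q′ r′) = agree (λ i h → trans (p i h) (p′ i h)) (trans q q′) (trans r r′)

  ≋-weaken : ∀ {b c S S′} → c ≤ b → S′ ≋[ b ] S → S′ ≋[ c ] S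
  ≋-weaken {b} {c} c≤b (agree p q s) = agree (λ i h → p i (Equivalence.from (T-∨ {i <ᵇ b}) (wider i h))) q s
    where
    wider : ∀ i → T ((i <ᵇ c) ∨ (31 <ᵇ i)) → T (i <ᵇ b) ⊎ T (31 <ᵇ i)
    wider i h with Equivalence.to (T-∨ {i <ᵇ c}) h
    ... | inj₁ i<c = inj₁ (<⇒<ᵇ (<-≤-trans (<ᵇ⇒< i c i<c) c≤b))
    ... | inj₂ 31< = inj₂ 31<

  -- For concrete registers the side condition computes to the unit type and is filled in by
  -- unification.
  ≋-≔ : ∀ {b S S′ x} r {_ : T ((b ≤ᵇ r) ∧ (r <ᵇ 32))} → S′ ≋[ b ] S → (S′ ≔ (r , x)) ≋[ b ] S
  ≋-≔ {b} {S} {S′} {x} r {h} (agree p q s) = agree (λ i h′ → trans (update-other (reg S′) x (distinct i h′)) (p i h′)) q s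
    where
    distinct : ∀ i → T ((i <ᵇ b) ∨ (31 <ᵇ i)) → r ≢ i
    distinct i h′ refl with Equivalence.to T-∧ h | Equivalence.to (T-∨ {i <ᵇ b}) h′
    ... | b≤r , _ | inj₁ r<b = <⇒≱ (<ᵇ⇒< r b r<b) (≤ᵇ⇒≤ b r b≤r)
    ... | _ , r<  | inj₂ 31< = <⇒≱ (<ᵇ⇒< r 32 r<) (<ᵇ⇒< 31 r 31<)

  -- The distinctness of registers is phrased as Boolean computations: `refl` proves them for
  -- concrete registers, and rewriting with them evaluates the updates.
  module Loop {rUp rDown rBound : Register} {c : Program} {L : ℕ}
              (Up≢Down : (rUp ≡ᵇ rDown) ≡ false) (Down≢Up : (rDown ≡ᵇ rUp) ≡ false)
              (Up≢0 : (rUp ≡ᵇ 0) ≡ false) (Up≢1 : (rUp ≡ᵇ 1) ≡ false) (Down≢1 : (rDown ≡ᵇ 1) ≡ false)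
              (Up≢Bound : (rUp ≡ᵇ rBound) ≡ false) (L< : L < 2 ^ W) where

    -- In iteration i the register rUp holds i and rDown holds L − 1 − i.
    loop-rule : ∀ {B} (I : ℕ → ℕ → State → ℕ → Set) →
      (∀ i j S φ → i + suc j ≡ L → reg S rUp ≡ i → I i (suc j) S φ →
        Run c (S ≔ (rDown , j)) φ B λ S′ φ′ →
          reg S′ rUp ≡ i × reg S′ rDown ≡ j × reg S′ rOne ≡ 1 × I (suc i) j (S′ ≔ (rUp , suc i)) φ′) →
      ∀ {S φ} → reg S rZero ≡ 0 → reg S rOne ≡ 1 → reg S rBound ≡ L → I 0 L (S ≔ (rUp , 0) ≔ (rDown , L)) φ →
      Run (loop rUp rDown rBound c) S φ (loopCost L B) (I L 0)
    loop-rule {B} I each {S} z o b inv =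
      by-const (≤-trans (s≤s z≤n) L<) ▹
      by-move bound′ zero′ L< ▹
      iterate L 0 (S ≔ (rUp , 0) ≔ (rDown , L)) _ refl up′ (update-same (reg (S ≔ (rUp , 0))) rDown L) one′ inv
      where
      S₁ = S ≔ (rUp , 0)
      bound′ : reg S₁ rBound ≡ L
      bound′ rewrite Up≢Bound = b
      zero′ : reg S₁ rZero ≡ 0
      zero′ rewrite Up≢0 = z
      up′ : reg (S₁ ≔ (rDown , L)) rUp ≡ 0
      up′ rewrite Down≢Up = update-same (reg S) rUp 0
      one′ : reg (S₁ ≔ (rDown , L)) rOne ≡ 1
      one′ rewrite Down≢1 | Up≢1 = o

      body : Program
      body = calc rDown sub rDown rOne ⨾ c ⨾ calc rUp add rUp rOne

      iterate : ∀ j i S φ → i + j ≡ L → reg S rUp ≡ i → reg S rDown ≡ j → reg S rOne ≡ 1 → I i j S φ →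
                Run (while rDown body) S φ (suc (j * (3 + B))) (I L 0)
      iterate zero i S φ e up down one inv =
        ran (S , 1 , φ , while-zero down , ≤-refl , subst (λ x → I x 0 S φ) (trans (sym (+-identityʳ i)) e) inv)
      iterate (suc j) i S φ e up down one inv with each i j S φ e up inv
      ... | ran (S₁ , t₁ , φ₁ , d₁ , le₁ , up₁ , down₁ , one₁ , inv₁)
        with iterate j (suc i) (S₁ ≔ (rUp , suc i)) φ₁ (trans (sym (+-suc i j)) e)
               (update-same (reg S₁) rUp (suc i)) (trans (down-keeps) down₁) (trans one-keeps one₁) inv₁
        where
        down-keeps : reg (S₁ ≔ (rUp , suc i)) rDown ≡ reg S₁ rDown
        down-keeps rewrite Up≢Down = refl
        one-keeps : reg (S₁ ≔ (rUp , suc i)) rOne ≡ reg S₁ rOne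
        one-keeps rewrite Up≢1 = refl
      ... | ran (S₂ , t₂ , φ₂ , d₂ , le₂ , q) = ran (
        S₂ , suc (1 + (t₁ + 1) + t₂) , φ₂ ,
        while-nonzero (λ z → 0≢1+n (trans (sym z) down)) (dec ⨾ d₁ ⨾ inc) d₂ , le , q)
        where
        dec : W ⊢ calc rDown sub rDown rOne , S ⇓ S ≔ (rDown , j) , 1
        dec = by-sub down one (s≤s z≤n) (≤-<-trans (≤-trans (m≤n+m (suc j) i) (≤-reflexive e)) L<)
        inc : W ⊢ calc rUp add rUp rOne , S₁ ⇓ S₁ ≔ (rUp , suc i) , 1
        inc = subst (λ x → W ⊢ calc rUp add rUp rOne , S₁ ⇓ S₁ ≔ (rUp , x) , 1) (+-comm i 1)
          (by-add up₁ one₁ (≤-<-trans (≤-trans (+-monoʳ-≤ i (s≤s z≤n)) (≤-reflexive e)) L<))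
        open ≤-Reasoning
        open +-*-Solver
        le : suc (1 + (t₁ + 1) + t₂) + φ₂ ≤ suc (suc j * (3 + B)) + φ
        le = begin
          suc (1 + (t₁ + 1) + t₂) + φ₂
            ≡⟨ solve 3 (λ t u p → con 1 :+ (con 1 :+ (t :+ con 1) :+ u) :+ p := con 3 :+ t :+ (u :+ p)) refl t₁ t₂ φ₂ ⟩
          3 + t₁ + (t₂ + φ₂)
            ≤⟨ +-monoʳ-≤ (3 + t₁) le₂ ⟩
          3 + t₁ + (suc (j * (3 + B)) + φ₁)
            ≡⟨ solve 3 (λ t u p → con 3 :+ t :+ (con 1 :+ u :+ p) := con 4 :+ u :+ (t :+ p)) refl t₁ (j * (3 + B)) φ₁ ⟩
          4 + j * (3 + B) + (t₁ + φ₁)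
            ≤⟨ +-monoʳ-≤ (4 + j * (3 + B)) le₁ ⟩
          4 + j * (3 + B) + (B + φ)
            ≡⟨ solve 3 (λ u b p → con 4 :+ u :+ (b :+ p) := con 1 :+ (con 3 :+ b :+ u) :+ p) refl (j * (3 + B)) B φ ⟩
          suc (suc j * (3 + B)) + φ ∎

-- Colourings

-- The test e asks for the bit of x at position ⌊e/2⌋, complemented if e is odd.
test : ℕ → ℕ → ℕ
test e x = ((x / 2 ^ (e / 2)) {{m^n≢0 2 (e / 2)}} + e) % 2

passesCode : ℕ → Program
passesCode zero    = skip
passesCode (suc j) =
  calc rE rem rQ rWidth ⨾ calc rQ div rQ rWidth ⨾
  calc rD shr rE rOne ⨾ calc rD shr rX rD ⨾ calc rD add rD rE ⨾ calc rD rem rD rTwo ⨾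
  calc rF mul rF rD ⨾ passesCode j

layerCode : (k i : ℕ) → Program
layerCode k zero    = const rC 0
layerCode k (suc i) = const rF 1 ⨾ passesCode k ⨾ cond rF (const rC (suc i)) (layerCode k i)

colourCode : ℕ → Program
colourCode k = move rQ rZ ⨾ layerCode k k

module Colouring (Wd : ℕ) .{{_ : NonZero Wd}} (k : ℕ) where

  -- Vertex x is in layer suc i of colouring z if it passes k tests, which are
  -- given by k consecutive digits of z in base Wd.
  passes : ℕ → ℕ → ℕ → ℕ → ℕ
  passes zero    q x f = f
  passes (suc j) q x f = passes j (q / Wd) x (f * test (q % Wd) x)

  skipDigits : ℕ → ℕ → ℕ
  skipDigits zero    q = q
  skipDigits (suc j) q = skipDigits j (q / Wd)

  -- Layers are tried from the highest down and the first success decides. The value 0 means that no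
  -- layer accepts the vertex.
  layer : ℕ → ℕ → ℕ → ℕ
  layer zero    q x = 0
  layer (suc i) q x with passes k q x 1
  ... | zero  = layer i (skipDigits k q) x
  ... | suc _ = suc i

  colour : ℕ → ℕ → ℕ
  colour = layer k

  layer≤ : ∀ i q x → layer i q x ≤ i
  layer≤ zero    q x = z≤n
  layer≤ (suc i) q x with passes k q x 1
  ... | zero  = m≤n⇒m≤1+n (layer≤ i (skipDigits k q) x)
  ... | suc _ = ≤-refl

  test-≤1 : ∀ e x → test e x ≤ 1
  test-≤1 e x = ≤-pred (m%n<n ((x / 2 ^ (e / 2)) {{m^n≢0 2 (e / 2)}} + e) 2)

  module _ (W : ℕ) (2≤ : 2 ≤ 2 ^ W) (k< : k < 2 ^ W) where
    open Logic W

    record Ready (S : State) (q x : ℕ) : Set where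
      field
        one   : reg S rOne ≡ 1
        two   : reg S rTwo ≡ 2
        width : reg S rWidth ≡ Wd
        arg   : reg S rX ≡ x
        code  : reg S rQ ≡ q
        q<    : q < 2 ^ W
        x<    : x + Wd < 2 ^ W

    passes-run : ∀ j {S φ q x f} → Ready S q x → reg S rF ≡ f → f ≤ 1 →
      Run (passesCode j) S φ (size (passesCode j)) λ S′ φ′ → φ′ ≡ φ × S′ ≋[ 24 ] S ×
        Ready S′ (skipDigits j q) x × reg S′ rF ≡ passes j q x f
    passes-run zero R fl f≤1 = instruction skip (refl , ≋-refl , R , fl)
    passes-run (suc j) {S} {φ} {q} {x} {f} R fl f≤1 =
      by-rem (Ready.code R) (Ready.width R) (Ready.q< R) ▹
      by-div (Ready.code R) (Ready.width R) (Ready.q< R) ▹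
      by-shr refl (Ready.one R) e< ▹
      by-shr (Ready.arg R) refl (≤-<-trans (m≤m+n x Wd) (Ready.x< R)) ▹
      by-add refl refl sum< ▹
      by-rem refl (Ready.two R) sum< ▹
      by-mul fl refl (≤-<-trans flag≤1 2≤) ▹
      consequence (passes-run j {S = S₂} R′ refl flag≤1)
        λ (p , S≋ , R″ , g) → p , ≋-trans S≋ S₂≋ , R″ , g
      where
      e = q % Wd
      S₂ : State
      S₂ = S ≔ (rE , q % Wd) ≔ (rQ , q / Wd) ≔ (rD , e / 2) ≔ (rD , (x / 2 ^ (e / 2)) {{m^n≢0 2 (e / 2)}})
             ≔ (rD , (x / 2 ^ (e / 2)) {{m^n≢0 2 (e / 2)}} + e) ≔ (rD , test e x) ≔ (rF , f * test e x)
      S₂≋ : S₂ ≋[ 24 ] S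
      S₂≋ = ≋-≔ rF (≋-≔ rD (≋-≔ rD (≋-≔ rD (≋-≔ rD (≋-≔ rQ (≋-≔ rE (≋-refl {S = S})))))))
      e< = <-trans (m%n<n q Wd) (≤-<-trans (m≤n+m Wd x) (Ready.x< R))
      sum< : (x / 2 ^ (e / 2)) {{m^n≢0 2 (e / 2)}} + e < 2 ^ W
      sum< = ≤-<-trans (+-mono-≤ (m/n≤m x (2 ^ (e / 2)) {{m^n≢0 2 (e / 2)}}) (<⇒≤ (m%n<n q Wd))) (Ready.x< R)
      flag≤1 : f * test e x ≤ 1
      flag≤1 = *-mono-≤ f≤1 (test-≤1 e x)
      R′ : Ready S₂ (q / Wd) x
      R′ = record { one = Ready.one R ; two = Ready.two R ; width = Ready.width R ; arg = Ready.arg R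
                  ; code = refl ; q< = ≤-<-trans (m/n≤m q Wd) (Ready.q< R) ; x< = Ready.x< R }

    layer-run : ∀ i {S φ q x} → i ≤ k → Ready S q x →
      Run (layerCode k i) S φ (size (layerCode k i)) λ S′ φ′ → φ′ ≡ φ × S′ ≋[ 24 ] S × reg S′ rC ≡ layer i q x
    layer-run zero {S} i≤k R = instruction (by-const (≤-trans (s≤s z≤n) 2≤)) (refl , ≋-≔ rC (≋-refl {S = S}) , refl)
    layer-run (suc i) {S} {φ} {q} {x} i≤k R =
      by-const 2≤ ▹ bind (passes-run k {S = S ≔ (rF , 1)} R₀ refl ≤-refl) λ { {S′} (refl , S′≋ , R′ , g) → branches S′ (≋-trans S′≋ (≋-≔ rF (≋-refl {S = S}))) R′ g }
      where
      R₀ : Ready (S ≔ (rF , 1)) q x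
      R₀ = record { one = Ready.one R ; two = Ready.two R ; width = Ready.width R ; arg = Ready.arg R
                  ; code = Ready.code R ; q< = Ready.q< R ; x< = Ready.x< R }
      branches : ∀ S′ → S′ ≋[ 24 ] S → Ready S′ (skipDigits k q) x → reg S′ rF ≡ passes k q x 1 →
        Run (cond rF (const rC (suc i)) (layerCode k i)) S′ φ (size (cond rF (const rC (suc i)) (layerCode k i)))
          λ S″ φ′ → φ′ ≡ φ × S″ ≋[ 24 ] S × reg S″ rC ≡ layer (suc i) q x
      branches S′ S′≋ R′ g with passes k q x 1
      ... | zero  = branch (contradiction g) λ _ →
        consequence (layer-run i (<⇒≤ i≤k) R′) λ (p , S≋ , c) → p , ≋-trans S≋ S′≋ , c
      ... | suc _ = branch
        (λ _ → instruction (by-const (≤-<-trans i≤k k<)) (refl , ≋-≔ rC S′≋ , refl))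
        λ p → contradiction (trans (sym g) p) λ ()

    colour-run : ∀ {S φ z x} → reg S rZero ≡ 0 → reg S rOne ≡ 1 → reg S rTwo ≡ 2 → reg S rWidth ≡ Wd →
      reg S rZ ≡ z → reg S rX ≡ x → z < 2 ^ W → x + Wd < 2 ^ W →
      Run (colourCode k) S φ (size (colourCode k)) λ S′ φ′ → φ′ ≡ φ × S′ ≋[ 24 ] S × reg S′ rC ≡ colour z x
    colour-run {S} {z = z} zero′ one′ two′ width′ z′ x′ z< x< =
      by-move z′ zero′ z< ▹ consequence (layer-run k {S = S ≔ (rQ , z)} ≤-refl R)
        λ (p , S≋ , c) → p , ≋-trans S≋ (≋-≔ rQ (≋-refl {S = S})) , c
      where
      R : Ready (S ≔ (rQ , z)) z _
      R = record { one = one′ ; two = two′ ; width = width′ ; arg = x′ ; code = refl ; q< = z< ; x< = x< }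

separating-bit : ∀ D {x y} → x < 2 ^ D → y < 2 ^ D → x ≢ y →
  ∃[ p ] (p < D × (x / 2 ^ p) {{m^n≢0 2 p}} % 2 ≢ (y / 2 ^ p) {{m^n≢0 2 p}} % 2)
separating-bit zero {x} {y} x< y< x≢y = contradiction (trans (n<1⇒n≡0 x<) (sym (n<1⇒n≡0 y<))) x≢y
separating-bit (suc D) {x} {y} x< y< x≢y with x % 2 ≟ y % 2
... | no  p = 0 , s≤s z≤n , λ e → p (trans (cong (_% 2) (sym (n/1≡n x))) (trans e (cong (_% 2) (n/1≡n y))))
... | yes p with separating-bit D (half x<) (half y<) halves≢
  where
  half : ∀ {x} → x < 2 * 2 ^ D → x / 2 < 2 ^ D
  half {x} x< = m<n*o⇒m/o<n (subst (x <_) (*-comm 2 (2 ^ D)) x<)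
  halves≢ : x / 2 ≢ y / 2
  halves≢ e = x≢y (trans (m≡m%n+[m/n]*n x 2) (trans (cong₂ (λ a b → a + b * 2) p e) (sym (m≡m%n+[m/n]*n y 2))))
... | b , b< , d = suc b , s≤s b< , λ e → d (trans (cong (_% 2) (shift x)) (trans e (cong (_% 2) (sym (shift y)))))
  where
  shift : ∀ x → (x / 2 / 2 ^ b) {{m^n≢0 2 b}} ≡ (x / 2 ^ suc b) {{m^n≢0 2 (suc b)}}
  shift x = m/n/o≡m/[n*o] x 2 (2 ^ b) {{_}} {{m^n≢0 2 b}} {{m^n≢0 2 (suc b)}}

test-at : ∀ e {p} x → e / 2 ≡ p → test e x ≡ ((x / 2 ^ p) {{m^n≢0 2 p}} + e) % 2
test-at e x refl = refl

test-even : ∀ p x → test (p * 2) x ≡ (x / 2 ^ p) {{m^n≢0 2 p}} % 2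
test-even p x = trans (test-at (p * 2) x (m*n/n≡m p 2)) ([m+kn]%n≡m%n ((x / 2 ^ p) {{m^n≢0 2 p}}) p 2)

test-odd : ∀ p x → test (1 + p * 2) x ≡ (1 + (x / 2 ^ p) {{m^n≢0 2 p}} % 2) % 2
test-odd p x = trans (test-at (1 + p * 2) x (trans (+-distrib-/-∣ʳ 1 {p * 2} {2} (divides p refl)) (m*n/n≡m p 2)))
  (trans (cong (_% 2) (+-suc b (p * 2)))
    (trans ([m+kn]%n≡m%n (suc b) p 2) (%-distribˡ-+ 1 b 2)))
  where
  b = (x / 2 ^ p) {{m^n≢0 2 p}}

bit-cases : ∀ x → x % 2 ≡ 0 ⊎ x % 2 ≡ 1
bit-cases x with x % 2 | m%n<n x 2
... | 0 | _ = inj₁ refl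
... | 1 | _ = inj₂ refl
... | suc (suc _) | s≤s (s≤s ())

-- Take a bit where the two numbers differ and complement it if `x` has a 0 there. The case `x ≡ y`
-- is included because one of the `k` digits of a layer is reserved for the accepted vertex itself
-- and must hold a test that it passes.
separating-test : ∀ D {x y} → x < 2 ^ suc D → y < 2 ^ suc D →
  ∃[ e ] (e < suc D + suc D × test e x ≡ 1 × (x ≢ y → test e y ≡ 0))
separating-test D {x} {y} x< y< = case x ≟ y of λ where
    (no x≢y)  → let p , p< , d = separating-bit (suc D) x< y< x≢y in choose p p< λ _ → d
    (yes x≡y) → choose 0 (s≤s z≤n) λ x≢y → contradiction x≡y x≢y
  where
  b : ℕ → ℕ → ℕ
  b p x = (x / 2 ^ p) {{m^n≢0 2 p}}
  choose : ∀ p → p < suc D → (x ≢ y → b p x % 2 ≢ b p y % 2) →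
    ∃[ e ] (e < suc D + suc D × test e x ≡ 1 × (x ≢ y → test e y ≡ 0))
  choose p p< d with bit-cases (b p x) | bit-cases (b p y)
  ... | inj₂ h | inj₁ g = p * 2 , even< , trans (test-even p x) h , λ _ → trans (test-even p y) g
    where
    even< : p * 2 < suc D + suc D
    even< = subst₂ _<_ (*-comm 2 p) (cong (suc D +_) (+-identityʳ (suc D))) (*-monoʳ-< 2 p<)
  ... | inj₂ h | inj₂ g = p * 2 , even< , trans (test-even p x) h , λ ne → contradiction (trans h (sym g)) (d ne)
    where
    even< : p * 2 < suc D + suc D
    even< = subst₂ _<_ (*-comm 2 p) (cong (suc D +_) (+-identityʳ (suc D))) (*-monoʳ-< 2 p<)
  ... | inj₁ h | r = 1 + p * 2 , odd< , trans (test-odd p x) (cong (λ v → (1 + v) % 2) h) , λ ne → other r (d ne)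
    where
    odd< : 1 + p * 2 < suc D + suc D
    odd< = ≤-trans (*-monoˡ-≤ 2 p<) (≤-reflexive (trans (*-comm (suc D) 2) (cong (suc D +_) (+-identityʳ (suc D)))))
    other : b p y % 2 ≡ 0 ⊎ b p y % 2 ≡ 1 → b p x % 2 ≢ b p y % 2 → test (1 + p * 2) y ≡ 0
    other (inj₁ g) ne = contradiction (trans h (sym g)) ne
    other (inj₂ g) ne = trans (test-odd p y) (cong (λ v → (1 + v) % 2) g)

module Separation (D : ℕ) (k : ℕ) (a : ℕ → ℕ) (a< : ∀ i → i < k → a i < 2 ^ suc D)
                  (distinct : ∀ i j → i < k → j < k → a i ≡ a j → i ≡ j) where

  Wd = suc D + suc D
  open Colouring Wd k

  passes-0 : ∀ j q x → passes j q x 0 ≡ 0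
  passes-0 zero    q x = refl
  passes-0 (suc j) q x = passes-0 j (q / Wd) x

  private
    rem-digit : ∀ {e} q → e < Wd → (e + q * Wd) % Wd ≡ e
    rem-digit {e} q e< = trans ([m+kn]%n≡m%n e q Wd) (m<n⇒m%n≡m e<)
    div-digit : ∀ {e} q → e < Wd → (e + q * Wd) / Wd ≡ q
    div-digit {e} q e< = trans (+-distrib-/-∣ʳ e {q * Wd} (divides q refl))
      (trans (cong (_+ q * Wd / Wd) (m<n⇒m/n≡0 e<)) (m*n/n≡m q Wd))

  -- Digit number `t` is a test that `a i` passes and `a t` fails; the digits are put below those of
  -- `q′`, which encode the remaining layers.
  digits : ∀ i → i < k → ∀ j → j ≤ k → ∀ q′ B → q′ < B →
    ∃[ q ] (q < Wd ^ j * B × skipDigits j q ≡ q′ × passes j q (a i) 1 ≡ 1 ×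
      (∀ t → t < j → t ≢ i → ∀ f → passes j q (a t) f ≡ 0))
  digits i i< zero j≤ q′ B q′< = q′ , subst (q′ <_) (sym (+-identityʳ B)) q′< , refl , refl , λ _ ()
  digits i i< (suc j) j≤ q′ B q′<
    with digits i i< j (<⇒≤ j≤) q′ B q′< | separating-test D (a< i i<) (a< j j≤)
  ... | q , q< , skip≡ , pass , fail | e , e< , yes≡ , no≡ =
    e + q * Wd , bound , trans (cong (skipDigits j) (div-digit q e<)) skip≡ , pass′ , fail′
    where
    open ≤-Reasoning
    bound : e + q * Wd < Wd ^ suc j * B
    bound = begin-strict
      e + q * Wd          <⟨ +-monoˡ-< (q * Wd) e< ⟩
      suc q * Wd          ≤⟨ *-monoˡ-≤ Wd q< ⟩
      Wd ^ j * B * Wd     ≡⟨ solve 3 (λ x b w → x :* b :* w := w :* x :* b) refl (Wd ^ j) B Wd ⟩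
      Wd ^ suc j * B ∎
      where open +-*-Solver
    pass′ : passes (suc j) (e + q * Wd) (a i) 1 ≡ 1
    pass′ rewrite div-digit q e< | rem-digit q e< | yes≡ = pass
    fail′ : ∀ t → t < suc j → t ≢ i → ∀ f → passes (suc j) (e + q * Wd) (a t) f ≡ 0
    fail′ t t< t≢i f rewrite div-digit q e< | rem-digit q e< with t ≟ j
    ... | no  t≢j = fail t (≤∧≢⇒< (≤-pred t<) t≢j) t≢i _
    -- The new digit rejects `a j`, and once the product of the tests is 0 it stays 0.
    ... | yes refl rewrite no≡ (λ e → t≢i (sym (distinct i j i< j≤ e))) | *-zeroʳ f = passes-0 j q (a j)

  -- Each layer takes `k` digits, so `k` layers give `Wd ^ (k * k)` colourings.
  layers : ∀ i → i ≤ k → ∃[ q ] (q < (Wd ^ k) ^ i × (∀ t → t < i → layer i q (a t) ≡ suc t))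
  layers zero    i≤ = 0 , s≤s z≤n , λ _ ()
  layers (suc i) i≤ with layers i (<⇒≤ i≤)
  ... | q′ , q′< , good with digits i i≤ k ≤-refl q′ ((Wd ^ k) ^ i) q′<
  ... | q , q< , skip≡ , pass , fail = q , q< , good′
    where
    good′ : ∀ t → t < suc i → layer (suc i) q (a t) ≡ suc t
    good′ t t< with t ≟ i
    ... | yes refl rewrite pass = refl
    -- A vertex `a t` with `t < i` fails the tests of layer `suc i` and falls through to the layers
    -- below, which are correct by induction.
    ... | no  t≢i rewrite fail t (<-≤-trans (≤∧≢⇒< (≤-pred t<) t≢i) (<⇒≤ i≤)) t≢i 1 | skip≡ =
      good t (≤∧≢⇒< (≤-pred t<) t≢i)

  separating-colouring : ∃[ z ] (z < (Wd ^ k) ^ k × (∀ t → t < k → colour z (a t) ≡ suc t))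
  separating-colouring = layers k ≤-refl

-- Finiteness of the parameters as reachability

Reach : ∀ {n} → List (Edge n) → Fin n → Fin n → Set
Reach E u v = ∃[ l ] Walk E l u v

reach-trans : ∀ {n} {E : List (Edge n)} {u v x} → Reach E u v → Reach E v x → Reach E u x
reach-trans (_ , stop)     r = r
reach-trans (_ , step e w) r = _ , step e (proj₂ (reach-trans (_ , w) r))

reach-edge : ∀ {n} {E : List (Edge n)} {u v} → (u , v) ∈ E → Reach E u v
reach-edge e = 1 , step e stop

¬¬-map : ∀ {A B : Set} → (A → B) → ¬ ¬ A → ¬ ¬ B
¬¬-map f a k = a (k ∘ f)

-- Distances exist only under a double negation, as reachability is not decided here. Over finitely
-- many vertices the double negation can be moved outside, and in the end only negations are derived
-- from it.
¬¬-finite : ∀ {n} {P : Fin n → Set} → (∀ i → ¬ ¬ P i) → ¬ ¬ (∀ i → P i)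
¬¬-finite {zero}  p k = k λ ()
¬¬-finite {suc n} p k = p zero λ p₀ → ¬¬-finite (p ∘ suc) λ ps → k λ where
  zero    → p₀
  (suc i) → ps i

largest : ∀ {n} (f : Fin (suc n) → ℕ) → ∃[ i ] (∀ j → f j ≤ f i)
largest {zero}  f = zero , λ { zero → ≤-refl }
largest {suc n} f with largest (f ∘ suc)
... | i , max with ≤-total (f zero) (f (suc i))
... | inj₁ le = suc i , λ { zero → le ; (suc j) → max j }
... | inj₂ ge = zero , λ { zero → ≤-refl ; (suc j) → ≤-trans (max j) ge }

module _ {n} {E : List (Edge n)} where

  eccentricity-⊤ : ∀ {v u} → ¬ Reach E v u → IsEccentricity E v ⊤⁺
  eccentricity-⊤ nr = (_ , unreachable (λ w → nr (_ , w))) , λ _ → _ ≤⊤⁺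

  -- If no distance existed, no walk could be shortest, so each walk would have a shorter one:
  -- descent on the length.
  shortest : ∀ l {v u} → Walk E l v u → ¬ ¬ (∃[ d ] IsDistance E v u [ d ])
  shortest = <-rec _ λ l below {v} {u} w k →
    k (l , reachable w λ {j} w′ → ≮⇒≥ λ j<l → below j<l w′ k)
    where open import Data.Nat.Induction using (<-rec)

  distance-unique : ∀ {v u d x} → IsDistance E v u [ d ] → IsDistance E v u x → x ≡ [ d ]
  distance-unique (reachable w m) (reachable w′ m′) = cong [_] (≤-antisym (m′ w) (m w′))
  distance-unique (reachable w m) (unreachable nw)  = contradiction w nw

finite-eccentricity : ∀ {n} {E : List (Edge (suc n))} {v} → (∀ u → Reach E v u) → ¬ ¬ (∃[ l ] IsEccentricity E v [ l ])
finite-eccentricity {E = E} {v} all = ¬¬-map maximum (¬¬-finite λ u → shortest _ (proj₂ (all u)))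
  where
  maximum : (∀ u → ∃[ d ] IsDistance E v u [ d ]) → ∃[ l ] IsEccentricity E v [ l ]
  maximum ds with largest (proj₁ ∘ ds)
  ... | i , max = proj₁ (ds i) , (i , proj₂ (ds i)) , λ { {y} (u , dist) → subst (_≤⁺ _) (sym (distance-unique (proj₂ (ds u)) dist)) [ max u ] }

-- For the radius, `no-source` gives every vertex except the source infinite eccentricity, so that
-- the radius is that of the source. For the diameter, `to-source` lets every vertex reach whatever
-- the source reaches.
record Terminals (π : Parameter) {n} (E : List (Edge (suc n))) (target : Fin (suc n)) : Set where
  field
    from-target : ∀ u → u ≢ zero → (target , u) ∈ E
    to-source   : π ≡ diameter → ∀ u → (u , zero) ∈ E
    no-source   : π ≢ diameter → ∀ u → (u , zero) ∉ E

module _ {π n} {E : List (Edge (suc n))} {target : Fin (suc n)} (G : Terminals π E target) where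
  open Terminals G

  source-reaches : Reach E zero target → ∀ u → Reach E zero u
  source-reaches r zero    = _ , stop
  source-reaches r (suc u) = reach-trans r (reach-edge (from-target (suc u) λ ()))

  not-into-source : π ≢ diameter → ∀ {v} → v ≢ zero → ¬ Reach E v zero
  not-into-source ne v≢ (_ , stop) = v≢ refl
  not-into-source ne v≢ (_ , step {v = zero} e w)  = no-source ne _ e
  not-into-source ne v≢ (_ , step {v = suc _} e w) = not-into-source ne (λ ()) (_ , w)

-- If the target is unreachable, the source has an infinite distance, which a finite maximum does
-- not bound. The radius might be attained at another vertex, but none of them reaches the source.
finite-value : ∀ π {n} {E : List (Edge (suc n))} {target l} → Terminals π E target →
  IsValue π E [ l ] → ¬ ¬ Reach E zero target
finite-value eccentricity G (_ , max) nr with max (_ , unreachable λ w → nr (_ , w))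
... | ()
finite-value diameter G (_ , max) nr with max (_ , eccentricity-⊤ nr)
... | ()
finite-value radius G ((zero , _ , max) , _) nr with max (_ , unreachable λ w → nr (_ , w))
... | ()
finite-value radius G ((suc v , _ , max) , _) nr
  with max (zero , unreachable λ w → not-into-source G (λ ()) (λ ()) (_ , w))
... | ()

-- Through the target the source reaches everything. For the radius this gives a finite eccentricity
-- below the minimum; it exists only under a double negation, which is harmless as the goal is a
-- negation.
infinite-value : ∀ π {n} {E : List (Edge (suc n))} {target} → Terminals π E target →
  IsValue π E ⊤⁺ → ¬ Reach E zero target
infinite-value eccentricity G ((u , unreachable nw) , _) r = nw (proj₂ (source-reaches G r u))
infinite-value diameter G ((v , (u , unreachable nw) , _) , _) r =
  nw (proj₂ (reach-trans (reach-edge (Terminals.to-source G refl v)) (source-reaches G r u)))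
infinite-value radius G (_ , min) r = finite-eccentricity (source-reaches G r) λ (l , ecc) →
  case min (zero , ecc) of λ ()

-- The request sequence

-- Edges are deleted in the reverse order of insertion, so every deletion restores the previous list
-- literally and no reasoning up to permutation arises.
remove-head : ∀ {n} {e : Edge n} {E} → e ∉ E → remove e (e ∷ E) ≡ E
remove-head {e = e} {E} e∉E = trans
  (List.filter-reject (λ e′ → ¬? (e ≟ᴱ e′)) (λ ne → ne refl))
  (List.filter-all (λ e′ → ¬? (e ≟ᴱ e′)) (All.tabulate λ {e′} e′∈E e≡e′ → e∉E (subst (_∈ E) (sym e≡e′) e′∈E)))
  where open import Relation.Nullary.Decidable using (¬?)

-- Requests are put in front of a continuation, so that a derivation of `Serves` is consumed from
-- its head in step with the program.
Emit : ℕ → Set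
Emit n = List (Request n) → List (Request n)

module _ {n : ℕ} where

  up : (ℕ → Emit n) → ℕ → ℕ → Emit n
  up f i zero    r = r
  up f i (suc j) r = f i (up f (suc i) j r)

  down : (ℕ → Emit n) → ℕ → Emit n
  down f zero    r = r
  down f (suc j) r = f j (down f j r)

  emitIf : ℕ → Request n → Emit n
  emitIf zero    e r = r
  emitIf (suc _) e r = e ∷ r

  admissible-up : ∀ {M} (f : ℕ → Emit n) (G : ℕ → List (Edge n)) L →
    (∀ i r → i < L → Admissible M (G (suc i)) r → Admissible M (G i) (f i r)) →
    ∀ i j r → i + j ≡ L → Admissible M (G L) r → Admissible M (G i) (up f i j r)
  admissible-up f G L each i zero    r e adm = subst (λ x → Admissible _ (G x) r) (trans (sym e) (+-identityʳ i)) adm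
  admissible-up f G L each i (suc j) r e adm =
    each i _ (≤-trans (m≤m+n (suc i) j) (≤-reflexive e′)) (admissible-up f G L each (suc i) j r e′ adm)
    where
    e′ : suc i + j ≡ L
    e′ = trans (sym (+-suc i j)) e

  admissible-down : ∀ {M} (f : ℕ → Emit n) (G : ℕ → List (Edge n)) L →
    (∀ j r → j < L → Admissible M (G j) r → Admissible M (G (suc j)) (f j r)) →
    ∀ r → Admissible M (G 0) r → Admissible M (G L) (down f L r)
  admissible-down f G zero    each r adm = adm
  admissible-down f G (suc L) each r adm =
    each L _ ≤-refl (admissible-down f G L (λ j r j< → each j r (m<n⇒m<1+n j<)) r adm)

  count-up : (c : List (Request n) → ℕ) (f : ℕ → Emit n) (B : ℕ) → (∀ i r → c (f i r) ≤ B + c r) →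
    ∀ i j r → c (up f i j r) ≤ j * B + c r
  count-up c f B each i zero    r = ≤-refl
  count-up c f B each i (suc j) r = ≤-trans (each i _)
    (≤-trans (+-monoʳ-≤ B (count-up c f B each (suc i) j r)) (≤-reflexive (sym (+-assoc B (j * B) (c r)))))

  count-down : (c : List (Request n) → ℕ) (f : ℕ → Emit n) (B : ℕ) → (∀ i r → c (f i r) ≤ B + c r) →
    ∀ j r → c (down f j r) ≤ j * B + c r
  count-down c f B each zero    r = ≤-refl
  count-down c f B each (suc j) r = ≤-trans (each j _)
    (≤-trans (+-monoʳ-≤ B (count-down c f B each j r)) (≤-reflexive (sym (+-assoc B (j * B) (c r)))))

  count-up-0 : (c : List (Request n) → ℕ) (f : ℕ → Emit n) → (∀ i r → c (f i r) ≤ c r) →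
    ∀ i j r → c (up f i j r) ≤ c r
  count-up-0 c f each i j r = subst (λ x → c (up f i j r) ≤ x + c r) (*-zeroʳ j) (count-up c f 0 each i j r)

  count-down-0 : (c : List (Request n) → ℕ) (f : ℕ → Emit n) → (∀ i r → c (f i r) ≤ c r) →
    ∀ j r → c (down f j r) ≤ c r
  count-down-0 c f each j r = subst (λ x → c (down f j r) ≤ x + c r) (*-zeroʳ j) (count-down c f 0 each j r)

toℕ-mod : ∀ {n x} → x < suc n → toℕ (x mod suc n) ≡ x
toℕ-mod {n} {x} x< = trans (Fin.toℕ-fromℕ< (m%n<n x (suc n))) (m<n⇒m%n≡m x<)

mod-injective : ∀ {n x y} → x < suc n → y < suc n → x mod suc n ≡ y mod suc n → x ≡ y
mod-injective x< y< e = trans (sym (toℕ-mod x<)) (trans (cong toℕ e) (toℕ-mod y<))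

mod-toℕ : ∀ {n} (u : Fin (suc n)) → toℕ u mod suc n ≡ u
mod-toℕ u = Fin.toℕ-injective (toℕ-mod (Fin.toℕ<n u))

-- Paths along active edges

module Paths (m : ℕ) (src : ℕ → ℕ) (dst act : ℕ → ℕ → ℕ) where

  -- Paths grow at their end, which matches both relaxation and the pointers from a vertex to its
  -- predecessor.
  data Path (z x : ℕ) : ℕ → Set where
    start  : Path z x x
    extend : ∀ {i} → Path z x (src i) → i < m → act z i ≢ 0 → Path z x (dst z i)

  steps : ∀ {z x y} → Path z x y → ℕ
  steps start          = 0
  steps (extend p _ _) = suc (steps p)

  -- The vertex after `i` steps; beyond the end the default is `x`.
  at : ∀ {z x y} → Path z x y → ℕ → ℕ
  at {x = x} start i = x
  at {y = y} (extend p _ _) i = if i ≡ᵇ suc (steps p) then y else at p i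

  at-steps : ∀ {z x y} (p : Path z x y) → at p (steps p) ≡ y
  at-steps start = refl
  at-steps (extend p _ _) with suc (steps p) ≡ᵇ suc (steps p) in e
  ... | true  = refl
  ... | false = ⊥-elim (subst T e (≡⇒≡ᵇ (steps p) (steps p) refl))

  at-extend : ∀ {z x i j} (p : Path z x (src i)) {i< : i < m} {a : act z i ≢ 0} → j ≤ steps p → at (extend p i< a) j ≡ at p j
  at-extend {j = j} p j≤ with j ≡ᵇ suc (steps p) in e
  ... | false = refl
  ... | true  = contradiction (≡ᵇ⇒≡ j (suc (steps p)) (subst T (sym e) tt)) (<⇒≢ (s≤s j≤))

  at-0 : ∀ {z x y} (p : Path z x y) → at p 0 ≡ x
  at-0 start          = refl
  at-0 (extend p _ _) = at-0 p

  at-edge : ∀ {z x y} (p : Path z x y) i → i < steps p →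
    ∃[ e ] (e < m × act z e ≢ 0 × at p i ≡ src e × at p (suc i) ≡ dst z e)
  at-edge (extend {e} p e< a) i i< with i ≟ steps p
  ... | yes refl = e , e< , a , trans (at-extend {i = e} p {e<} {a} ≤-refl) (at-steps p) , at-steps (extend p e< a)
  ... | no ne =
    let i<′ = ≤∧≢⇒< (≤-pred i<) ne
        e′ , e′< , a′ , s , d = at-edge p i i<′
    in e′ , e′< , a′ , trans (at-extend {i = e} p {e<} {a} (<⇒≤ i<′)) s , trans (at-extend {i = e} p {e<} {a} i<′) d

-- The vertices are the source 0, the target 1, the labels 2, …, len + 1, and for
-- each label x its copy x + len.
module Sequence (π : Parameter) (n′ m len : ℕ) (room : 4 + (len + len) ≤ suc n′)
                (src : ℕ → ℕ) (dst act : ℕ → ℕ → ℕ)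
                (src-range : ∀ i → i < m → 2 ≤ src i × src i < 2 + len)
                (dst-range : ∀ z i → i < m → 2 ≤ dst z i × dst z i < 2 + (len + len))
                (edge-injective : ∀ z i j → i < m → j < m → src i ≡ src j → dst z i ≡ dst z j → i ≡ j) where

  open Paths m src dst act public

  N : ℕ
  N = suc n′

  vertex : ℕ → Fin N
  vertex x = x mod N

  edge : ℕ → ℕ → Edge N
  edge z i = vertex (src i) , vertex (dst z i)

  entry exit : ℕ → Edge N
  entry x = vertex 0 , vertex x
  exit  x = vertex (x + len) , vertex 1

  fromTarget toSource : ℕ → Emit N
  fromTarget i r = insert (vertex 1 , vertex (suc i)) ∷ r
  toSource   i r = insert (vertex i , vertex 0) ∷ r

  sourceEdges : Parameter → ℕ
  sourceEdges diameter = N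
  sourceEdges _        = 0

  static : Emit N
  static r = up fromTarget 0 n′ (up toSource 0 (sourceEdges π) r)

  insertEdge deleteEdge : ℕ → ℕ → Emit N
  insertEdge z i = emitIf (act z i) (insert (edge z i))
  deleteEdge z i = emitIf (act z i) (delete (edge z i))

  -- The shift by 2 turns the counter into a label.
  phase : ℕ → Emit N
  phase j r = insert (entry (j + 2)) ∷ insert (exit (j + 2)) ∷ query ∷ delete (exit (j + 2)) ∷ delete (entry (j + 2)) ∷ r

  block : ℕ → Emit N
  block z r = up (insertEdge z) 0 m (down phase len (down (deleteEdge z) m r))

  requests : ℕ → List (Request N)
  requests Z = static (down block Z [])

  targetGraph : ℕ → List (Edge N)
  targetGraph zero    = []
  targetGraph (suc i) = (vertex 1 , vertex (suc i)) ∷ targetGraph i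

  staticGraph : ℕ → List (Edge N)
  staticGraph zero    = targetGraph n′
  staticGraph (suc i) = (vertex i , vertex 0) ∷ staticGraph i

  addIf : ℕ → Edge N → List (Edge N) → List (Edge N)
  addIf zero    e E = E
  addIf (suc _) e E = e ∷ E

  base : List (Edge N)
  base = staticGraph (sourceEdges π)

  active : ℕ → ℕ → List (Edge N)
  active z zero    = base
  active z (suc i) = addIf (act z i) (edge z i) (active z i)

  queryGraph : ℕ → ℕ → List (Edge N)
  queryGraph z x = exit x ∷ entry x ∷ active z m

  sourceEdges≤ : ∀ π → sourceEdges π ≤ N
  sourceEdges≤ diameter     = ≤-refl
  sourceEdges≤ radius       = z≤n
  sourceEdges≤ eccentricity = z≤n

  0<N : 0 < N
  0<N = s≤s z≤n

  1<N : 1 < N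
  1<N = ≤-trans (s≤s (s≤s z≤n)) room

  copy<N : ∀ {x} → x < 2 + (len + len) → x < N
  copy<N x< = ≤-trans (≤-trans x< (m≤n+m (2 + (len + len)) 2)) room

  label<N : ∀ {x} → x < 2 + len → x < N
  label<N x< = copy<N (≤-trans x< (+-monoʳ-≤ 2 (m≤m+n len len)))

  label-copy< : ∀ {x} → x < 2 + len → x + len < 2 + (len + len)
  label-copy< x< = ≤-trans (+-monoˡ-≤ len x<) ≤-refl

  vertex-0 : vertex 0 ≡ zero
  vertex-0 = Fin.toℕ-injective (toℕ-mod 0<N)

  ∈-target : ∀ {u v} i → (u , v) ∈ targetGraph i → u ≡ vertex 1 × ∃[ y ] (y < i × v ≡ vertex (suc y))
  ∈-target (suc i) (here refl) = refl , i , ≤-refl , refl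
  ∈-target (suc i) (there h) = let p , y , y< , q = ∈-target i h in p , y , m<n⇒m<1+n y< , q

  target-∈ : ∀ {y} i → y < i → (vertex 1 , vertex (suc y)) ∈ targetGraph i
  target-∈ {y} (suc i) y< with y ≟ i
  ... | yes refl = here refl
  ... | no  y≢i  = there (target-∈ i (≤∧≢⇒< (≤-pred y<) y≢i))

  ∈-static : ∀ {u v} i → (u , v) ∈ staticGraph i →
    (u ≡ vertex 1 × ∃[ y ] (y < n′ × v ≡ vertex (suc y))) ⊎ (v ≡ vertex 0 × ∃[ y ] (y < i × u ≡ vertex y))
  ∈-static zero    h = inj₁ (∈-target n′ h)
  ∈-static (suc i) (here refl) = inj₂ (refl , i , ≤-refl , refl)
  ∈-static (suc i) (there h) with ∈-static i h
  ... | inj₁ p = inj₁ p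
  ... | inj₂ (p , y , y< , q) = inj₂ (p , y , m<n⇒m<1+n y< , q)

  target⊆static : ∀ {e} i → e ∈ targetGraph n′ → e ∈ staticGraph i
  target⊆static zero    h = h
  target⊆static (suc i) h = there (target⊆static i h)

  static-∈ : ∀ {y} i → y < i → (vertex y , vertex 0) ∈ staticGraph i
  static-∈ {y} (suc i) y< with y ≟ i
  ... | yes refl = here refl
  ... | no  y≢i  = there (static-∈ i (≤∧≢⇒< (≤-pred y<) y≢i))

  ∈-active : ∀ {e} z i → e ∈ active z i → e ∈ base ⊎ ∃[ j ] (j < i × act z j ≢ 0 × e ≡ edge z j)
  ∈-active z zero    h = inj₁ h
  ∈-active z (suc i) h with act z i in a
  ∈-active z (suc i) h | zero with ∈-active z i h
  ... | inj₁ p = inj₁ p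
  ... | inj₂ (j , j< , p) = inj₂ (j , m<n⇒m<1+n j< , p)
  ∈-active z (suc i) (here p) | suc b = inj₂ (i , ≤-refl , (λ q → 0≢1+n (trans (sym q) a)) , p)
  ∈-active z (suc i) (there h) | suc _ with ∈-active z i h
  ... | inj₁ p = inj₁ p
  ... | inj₂ (j , j< , p) = inj₂ (j , m<n⇒m<1+n j< , p)

  active-∈ : ∀ {j} z i → j < i → act z j ≢ 0 → edge z j ∈ active z i
  active-∈ {j} z (suc i) j< a with j ≟ i | act z i in b
  ... | yes refl | zero  = contradiction b a
  ... | yes refl | suc _ = here refl
  ... | no  j≢i  | zero  = active-∈ z i (≤∧≢⇒< (≤-pred j<) j≢i) a
  ... | no  j≢i  | suc _ = there (active-∈ z i (≤∧≢⇒< (≤-pred j<) j≢i) a)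

  base⊆active : ∀ {e} z i → e ∈ base → e ∈ active z i
  base⊆active z zero    h = h
  base⊆active z (suc i) h with act z i
  ... | zero  = base⊆active z i h
  ... | suc _ = there (base⊆active z i h)

  ∈-base : ∀ {u v} → (u , v) ∈ base → u ≡ vertex 1 ⊎ v ≡ vertex 0
  ∈-base h with ∈-static (sourceEdges π) h
  ... | inj₁ (p , _) = inj₁ p
  ... | inj₂ (p , _) = inj₂ p

  ≥2⇒≢ : ∀ {x y} → x < 2 → 2 ≤ y → y < N → vertex y ≢ vertex x
  ≥2⇒≢ x< 2≤y y< e = <⇒≱ x< (subst (2 ≤_) (mod-injective y< (<-≤-trans x< 1<N) e) 2≤y)

  target∉ : ∀ {i} → i < n′ → (vertex 1 , vertex (suc i)) ∉ targetGraph i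
  target∉ {i} i< h with ∈-target i h
  ... | _ , y , y< , e = <⇒≢ y< (sym (suc-injective (mod-injective (s≤s i<) (s≤s (<-trans y< i<)) e)))

  source∉ : ∀ {i} → i < N → (vertex i , vertex 0) ∉ staticGraph i
  source∉ {i} i< h with ∈-static i h
  ... | inj₁ (_ , y , y< , e) = 0≢1+n (mod-injective 0<N (s≤s y<) e)
  ... | inj₂ (_ , y , y< , e) = <⇒≢ y< (sym (mod-injective i< (<-trans y< i<) e))

  edge∉ : ∀ z {i} → i < m → edge z i ∉ active z i
  edge∉ z {i} i< h with src-range i i< | dst-range z i i< | ∈-active z i h
  ... | 2≤s , s< | 2≤d , d< | inj₁ b with ∈-base b
  ...   | inj₁ e = ≥2⇒≢ (s≤s (s≤s z≤n)) 2≤s (label<N s<) e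
  ...   | inj₂ e = ≥2⇒≢ (s≤s z≤n) 2≤d (copy<N d<) e
  edge∉ z {i} i< h | 2≤s , s< | 2≤d , d< | inj₂ (j , j< , _ , e) =
    <⇒≢ j< (sym (edge-injective z i j i< j<m
      (mod-injective (label<N s<) (label<N (proj₂ (src-range j j<m))) (cong proj₁ e))
      (mod-injective (copy<N d<) (copy<N (proj₂ (dst-range z j j<m))) (cong proj₂ e))))
    where
    j<m = <-trans j< i<

  module _ {x : ℕ} (2≤x : 2 ≤ x) (x< : x < 2 + len) where

    private
      2≤x+len : 2 ≤ x + len
      2≤x+len = ≤-trans 2≤x (m≤m+n x len)

    entry∉ : ∀ z → entry x ∉ active z m
    entry∉ z h with ∈-active z m h
    ... | inj₂ (j , j< , _ , e) = ≥2⇒≢ (s≤s z≤n) (proj₁ (src-range j j<)) (label<N (proj₂ (src-range j j<))) (sym (cong proj₁ e))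
    ... | inj₁ b with ∈-base b
    ...   | inj₁ e = 0≢1+n (mod-injective 0<N 1<N e)
    ...   | inj₂ e = ≥2⇒≢ (s≤s z≤n) 2≤x (label<N x<) e

    exit∉ : ∀ z → exit x ∉ entry x ∷ active z m
    exit∉ z (here e) = ≥2⇒≢ (s≤s z≤n) 2≤x+len (copy<N (label-copy< x<)) (cong proj₁ e)
    exit∉ z (there h) with ∈-active z m h
    ... | inj₂ (j , j< , _ , e) =
      ≥2⇒≢ (s≤s (s≤s z≤n)) (proj₁ (dst-range z j j<)) (copy<N (proj₂ (dst-range z j j<))) (sym (cong proj₂ e))
    ... | inj₁ b with ∈-base b
    ...   | inj₁ e = ≥2⇒≢ (s≤s (s≤s z≤n)) 2≤x+len (copy<N (label-copy< x<)) e
    ...   | inj₂ e = 0≢1+n (sym (mod-injective 1<N 0<N e))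

    terminals : ∀ z → Terminals π (queryGraph z x) (vertex 1)
    terminals z .Terminals.from-target zero    u≢ = contradiction refl u≢
    terminals z .Terminals.from-target (suc u) u≢ = there (there (base⊆active z m (target⊆static (sourceEdges π)
      (subst (λ v → (vertex 1 , v) ∈ targetGraph n′) (mod-toℕ (suc u)) (target-∈ n′ (Fin.toℕ<n u))))))
    terminals z .Terminals.to-source refl u = there (there (base⊆active z m
      (subst₂ (λ u v → (u , v) ∈ base) (mod-toℕ u) vertex-0 (static-∈ N (Fin.toℕ<n u)))))
    terminals z .Terminals.no-source π≢ u (here e) = 0≢1+n (mod-injective 0<N 1<N (trans vertex-0 (cong proj₂ e)))
    terminals z .Terminals.no-source π≢ u (there (here e)) = ≥2⇒≢ (s≤s z≤n) 2≤x (label<N x<) (sym (trans vertex-0 (cong proj₂ e)))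
    terminals z .Terminals.no-source π≢ u (there (there h)) with ∈-active z m h
    ... | inj₂ (j , j< , _ , e) = ≥2⇒≢ (s≤s z≤n) (proj₁ (dst-range z j j<)) (copy<N (proj₂ (dst-range z j j<)))
      (sym (trans vertex-0 (cong proj₂ e)))
    ... | inj₁ b with ∈-static (sourceEdges π) b
    ...   | inj₁ (_ , y , y< , e) = 0≢1+n (mod-injective 0<N (s≤s y<) (trans vertex-0 e))
    ...   | inj₂ (_ , y , y< , _) = n≮0 (<-≤-trans y< (≤-reflexive (no-sources π π≢)))
      where
      no-sources : ∀ π → π ≢ diameter → sourceEdges π ≡ 0
      no-sources diameter     π≢ = contradiction refl π≢
      no-sources radius       π≢ = refl
      no-sources eccentricity π≢ = refl

  module _ {z x : ℕ} (2≤x : 2 ≤ x) (x< : x < 2 + len) where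

    path-range : ∀ {y} → Path z x y → 2 ≤ y × y < N
    path-range start = 2≤x , label<N x<
    path-range (extend {i} _ i< _) = proj₁ (dst-range z i i<) , copy<N (proj₂ (dst-range z i i<))

    path⇒reach : Path z x (x + len) → Reach (queryGraph z x) (vertex 0) (vertex 1)
    path⇒reach p = reach-trans (reach-edge (there (here refl))) (reach-trans (along p) (reach-edge (here refl)))
      where
      along : ∀ {y} → Path z x y → Reach (queryGraph z x) (vertex x) (vertex y)
      along start = _ , stop
      along (extend p i< a) = reach-trans (along p) (reach-edge (there (there (active-∈ z m i< a))))

    -- Along the walk, the current vertex is the source or the end of a `Path` from `x`. Edges into
    -- the source only restart the walk, `entry x` starts a new path, and edges that leave the
    -- target do not occur before it is reached; so the target is entered by `exit x`, at the end of
    -- the desired path.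
    reach⇒path : Reach (queryGraph z x) (vertex 0) (vertex 1) → Path z x (x + len)
    reach⇒path (_ , w) = follow w (inj₁ refl) refl
      where
      x+len<N : x + len < N
      x+len<N = copy<N (label-copy< x<)
      follow : ∀ {l u y} → Walk (queryGraph z x) l u (vertex 1) → y ≡ 0 ⊎ Path z x y → u ≡ vertex y → Path z x (x + len)
      follow stop (inj₁ refl) e = contradiction (mod-injective 1<N 0<N e) λ ()
      follow stop (inj₂ p) e = let 2≤ , y< = path-range p in contradiction (sym e) (≥2⇒≢ (s≤s (s≤s z≤n)) 2≤ y<)
      follow (step (here refl) w) (inj₁ refl) e = contradiction e (≥2⇒≢ (s≤s z≤n) (≤-trans 2≤x (m≤m+n x len)) x+len<N)
      follow (step (here refl) w) (inj₂ p) e = subst (Path z x) (mod-injective (proj₂ (path-range p)) x+len<N (sym e)) p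
      follow (step (there (here refl)) w) _ e = follow w (inj₂ start) refl
      follow (step (there (there h)) w) y e with ∈-active z m h
      ... | inj₁ b with ∈-base b
      ...   | inj₂ q = follow w (inj₁ refl) q
      follow (step (there (there h)) w) (inj₁ refl) e | inj₁ b | inj₁ q = contradiction (mod-injective 0<N 1<N (trans (sym e) q)) λ ()
      follow (step (there (there h)) w) (inj₂ p) e | inj₁ b | inj₁ q =
        let 2≤ , y< = path-range p in contradiction (trans (sym e) q) (≥2⇒≢ (s≤s (s≤s z≤n)) 2≤ y<)
      follow (step (there (there h)) w) (inj₁ refl) e | inj₂ (j , j< , a , refl) =
        contradiction e (≥2⇒≢ (s≤s z≤n) (proj₁ (src-range j j<)) (label<N (proj₂ (src-range j j<))))
      follow (step (there (there h)) w) (inj₂ p) e | inj₂ (j , j< , a , refl) =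
        follow w (inj₂ (extend (subst (Path z x)
          (mod-injective (proj₂ (path-range p)) (label<N (proj₂ (src-range j j<))) (sym e)) p) j< a)) refl

    query-finite : ∀ {l} → IsValue π (queryGraph z x) [ l ] → ¬ ¬ Path z x (x + len)
    query-finite v = ¬¬-map (λ r → reach⇒path (subst (λ s → Reach (queryGraph z x) s (vertex 1)) (sym vertex-0) r))
      (finite-value π (terminals 2≤x x< z) v)

    query-infinite : IsValue π (queryGraph z x) ⊤⁺ → ¬ Path z x (x + len)
    query-infinite v p = infinite-value π (terminals 2≤x x< z) v
      (subst (λ s → Reach (queryGraph z x) s (vertex 1)) vertex-0 (path⇒reach p))

  length-target : ∀ i → length (targetGraph i) ≡ i
  length-target zero    = refl
  length-target (suc i) = cong suc (length-target i)

  length-static : ∀ i → length (staticGraph i) ≡ i + n′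
  length-static zero    = length-target n′
  length-static (suc i) = cong suc (length-static i)

  length-active : ∀ z i → length (active z i) ≤ i + (N + N)
  length-active z zero = ≤-trans (≤-reflexive (length-static (sourceEdges π))) (+-mono-≤ (sourceEdges≤ π) (n≤1+n n′))
  length-active z (suc i) with act z i
  ... | zero  = m≤n⇒m≤1+n (length-active z i)
  ... | suc _ = s≤s (length-active z i)

  module _ (m≤len : m ≤ len) where

    private
      -- At most `N` edges leave the target, at most `N` are the extra edges into the source, and
      -- the active edges with entry and exit number at most `N`; so `4 * N` is ample.
      edges-< : ∀ {i} → i ≤ m → 2 + (i + (N + N)) ≤ 4 * N
      edges-< {i} i≤ = begin
        2 + (i + (N + N))  ≤⟨ +-monoˡ-≤ (N + N) (+-monoʳ-≤ 2 (≤-trans i≤ (≤-trans m≤len (m≤m+n len len)))) ⟩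
        2 + (len + len) + (N + N) ≤⟨ +-monoˡ-≤ (N + N) (≤-trans (m≤n+m (2 + (len + len)) 2) room) ⟩
        N + (N + N) ≤⟨ m≤n+m (N + (N + N)) N ⟩
        N + (N + (N + N)) ≡⟨ solve 1 (λ x → x :+ (x :+ (x :+ x)) := con 4 :* x) refl N ⟩
        4 * N ∎
        where open ≤-Reasoning
              open +-*-Solver

      static≤ : ∀ (E : List (Edge N)) {i} → length E ≡ i → i ≤ N + N → length E ≤ 4 * N
      static≤ E refl i≤ = ≤-trans i≤ (≤-trans (m≤n+m (N + N) 2) (edges-< z≤n))

      active≤ : ∀ z {i} → i ≤ m → length (active z i) ≤ 4 * N
      active≤ z {i} i≤ = ≤-trans (length-active z i) (≤-trans (m≤n+m (i + (N + N)) 2) (edges-< i≤))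

      n′≤ : n′ ≤ N
      n′≤ = n≤1+n n′

    admissible-insertEdge : ∀ z i r → i < m → Admissible (4 * N) (active z (suc i)) r →
      Admissible (4 * N) (active z i) (insertEdge z i r)
    admissible-insertEdge z i r i< adm with act z i
    ... | zero  = adm
    ... | suc _ = insert (active≤ z (<⇒≤ i<)) (edge∉ z i<) adm

    admissible-deleteEdge : ∀ z i r → i < m → Admissible (4 * N) (active z i) r →
      Admissible (4 * N) (active z (suc i)) (deleteEdge z i r)
    admissible-deleteEdge z i r i< adm with active≤ z i<
    ... | le with act z i
    ... | zero  = adm
    ... | suc _ = delete le (here refl) (subst (λ E → Admissible (4 * N) E r) (sym (remove-head (edge∉ z i<))) adm)

    admissible-phase : ∀ z j r → j < len → Admissible (4 * N) (active z m) r → Admissible (4 * N) (active z m) (phase j r)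
    admissible-phase z j r j< adm =
      insert (active≤ z ≤-refl) (entry∉ 2≤x x< z)
        (insert one-more (exit∉ 2≤x x< z)
          (query two-more (delete two-more (here refl)
            (subst (λ E → Admissible (4 * N) E (delete (entry (j + 2)) ∷ r)) (sym (remove-head (exit∉ 2≤x x< z)))
              (delete one-more (here refl) (subst (λ E → Admissible (4 * N) E r) (sym (remove-head (entry∉ 2≤x x< z))) adm))))))
      where
      2≤x : 2 ≤ j + 2
      2≤x = m≤n+m 2 j
      x< : j + 2 < 2 + len
      x< = subst (_< 2 + len) (+-comm 2 j) (+-monoʳ-< 2 j<)
      two-more : 2 + length (active z m) ≤ 4 * N
      two-more = ≤-trans (+-monoʳ-≤ 2 (length-active z m)) (edges-< ≤-refl)
      one-more : 1 + length (active z m) ≤ 4 * N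
      one-more = ≤-trans (n≤1+n _) two-more

    admissible-block : ∀ z r → Admissible (4 * N) base r → Admissible (4 * N) base (block z r)
    admissible-block z r adm =
      admissible-up (insertEdge z) (active z) m (admissible-insertEdge z) 0 m _ refl
        (admissible-down phase (λ _ → active z m) len (admissible-phase z) _
          (admissible-down (deleteEdge z) (active z) m (admissible-deleteEdge z) r adm))

    admissible-requests : ∀ Z → Admissible (4 * N) [] (requests Z)
    admissible-requests Z =
      admissible-up fromTarget targetGraph n′
        (λ i r i< → insert (static≤ (targetGraph i) (length-target i) (≤-trans (<⇒≤ i<) (≤-trans n′≤ (m≤m+n N N)))) (target∉ i<)) 0 n′ _ refl
        (admissible-up toSource staticGraph (sourceEdges π)
          (λ i r i< → let i<N = <-≤-trans i< (sourceEdges≤ π) in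
            insert (static≤ (staticGraph i) (length-static i) (+-mono-≤ (<⇒≤ i<N) n′≤)) (source∉ i<N)) 0 (sourceEdges π) _ refl
          (admissible-down block (λ _ → base) Z (λ z r _ → admissible-block z r) []
            ([] (static≤ base (length-static (sourceEdges π)) (+-mono-≤ (sourceEdges≤ π) n′≤)))))

  updates-emitIf : ∀ a {e : Request N} r → updates (e ∷ []) ≤ 1 → updates (emitIf a e r) ≤ 1 + updates r
  updates-emitIf zero    r _ = n≤1+n _
  updates-emitIf (suc _) {insert _} r _ = ≤-refl
  updates-emitIf (suc _) {delete _} r _ = ≤-refl
  updates-emitIf (suc _) {query}    r _ = n≤1+n _

  updates-requests : ∀ Z → updates (requests Z) ≤ n′ * 1 + (N * 1 + (Z * (m * 1 + (len * 4 + m * 1)) + 0))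
  updates-requests Z =
    ≤-trans (count-up updates fromTarget 1 (λ _ _ → ≤-refl) 0 n′ _) (+-monoʳ-≤ (n′ * 1)
      (≤-trans (count-up updates toSource 1 (λ _ _ → ≤-refl) 0 (sourceEdges π) _)
        (+-mono-≤ (*-monoˡ-≤ 1 (sourceEdges≤ π)) (count-down updates block _ each Z []))))
    where
    each : ∀ z r → updates (block z r) ≤ m * 1 + (len * 4 + m * 1) + updates r
    each z r = ≤-trans (count-up updates (insertEdge z) 1 (λ i r → updates-emitIf (act z i) r ≤-refl) 0 m _)
      (≤-trans (+-monoʳ-≤ (m * 1) (≤-trans (count-down updates phase 4 (λ _ _ → ≤-refl) len _)
        (+-monoʳ-≤ (len * 4) (count-down updates (deleteEdge z) 1 (λ i r → updates-emitIf (act z i) r ≤-refl) m r))))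
      (≤-reflexive (solve 4 (λ a b c d → a :+ (b :+ (c :+ d)) := a :+ (b :+ c) :+ d) refl (m * 1) (len * 4) (m * 1) (updates r))))
      where open +-*-Solver

  queries-emitIf : ∀ a {e : Request N} r → queries (e ∷ []) ≡ 0 → queries (emitIf a e r) ≤ queries r
  queries-emitIf zero    r _ = ≤-refl
  queries-emitIf (suc _) {insert _} r _ = ≤-refl
  queries-emitIf (suc _) {delete _} r _ = ≤-refl

  queries-requests : ∀ Z → queries (requests Z) ≤ Z * len
  queries-requests Z =
    ≤-trans (count-up-0 queries fromTarget (λ _ _ → ≤-refl) 0 n′ _)
      (≤-trans (count-up-0 queries toSource (λ _ _ → ≤-refl) 0 (sourceEdges π) _)
        (≤-trans (count-down queries block len each Z []) (≤-reflexive (+-identityʳ (Z * len)))))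
    where
    each : ∀ z r → queries (block z r) ≤ len + queries r
    each z r =
      ≤-trans (count-up-0 queries (insertEdge z) (λ i r → queries-emitIf (act z i) r refl) 0 m _)
        (≤-trans (count-down queries phase 1 (λ _ _ → ≤-refl) len _)
          (+-mono-≤ (≤-reflexive (*-identityʳ len))
            (count-down-0 queries (deleteEdge z) (λ i r → queries-emitIf (act z i) r refl) m r)))

length≡updates+queries : ∀ {n} (σ : List (Request n)) → length σ ≡ updates σ + queries σ
length≡updates+queries []             = refl
length≡updates+queries (insert _ ∷ σ) = cong suc (length≡updates+queries σ)
length≡updates+queries (delete _ ∷ σ) = cong suc (length≡updates+queries σ)
length≡updates+queries (query ∷ σ)    = trans (cong suc (length≡updates+queries σ)) (sym (+-suc (updates σ) (queries σ)))

-- The host program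

-- The truth value in `rE`, whether the target has colour 1, is multiplied by `k` and by `len` in
-- place of a branch.
edgeCode : ℕ → Register → Program
edgeCode k r =
  calc rE add r r ⨾ calc rE add rE rTwo ⨾ load rU rE ⨾ calc rE add rE rOne ⨾ load rV rE ⨾
  calc rU add rTable rU ⨾ load rU rU ⨾ calc rV add rTable rV ⨾ load rV rV ⨾
  move rX rU ⨾ colourCode k ⨾ move rAct rC ⨾ move rX rV ⨾ colourCode k ⨾
  calc rE eq rC rOne ⨾ calc rD mul rE rK ⨾ calc rC add rC rD ⨾ calc rD mul rE rLen ⨾ calc rV add rV rD ⨾
  calc rAct add rAct rOne ⨾ calc rAct eq rAct rC

constants : (m Tb P base cap N Wd k Z : ℕ) → ℕ → ℕ
constants m Tb P base cap N Wd k Z =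
  wordAt (0 ∷ 1 ∷ 2 ∷ m ∷ m + m ∷ Tb ∷ P ∷ base ∷ cap ∷ N ∷ Wd ∷ k ∷ Z ∷ [])

module Edges (W m Tb P base cap N Wd k Z : ℕ) .{{Wd≢0 : NonZero Wd}} (low : ℕ → ℕ) where
  open Colouring Wd k
  open Logic W

  len : ℕ
  len = m + m

  -- The label of a vertex `v` is a position of the input at which `v` occurs, looked up in cell
  -- `Tb + v`. Hence labels stay below `2 + len` however large `n` is, and reading the input at a
  -- label returns the vertex, as `table-label` says.
  src tgt : ℕ → ℕ
  src i = low (Tb + low (i + i + 2))
  tgt i = low (Tb + low (i + i + 2 + 1))

  -- Edges into colour 1 are redirected to the copy of their target, which counts as colour `1 + k`.
  -- An edge is active if the colour rises by one; with a vertex of colour 0 at either end it never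
  -- is.
  wraps dst act : ℕ → ℕ → ℕ
  wraps z i = bit (colour z (tgt i) ≡ᵇ 1)
  dst z i = tgt i + wraps z i * len
  act z i = bit (colour z (src i) + 1 ≡ᵇ colour z (tgt i) + wraps z i * k)

  record Table : Set where
    field
      input≤      : 2 + len ≤ P
      table-range : ∀ p → 2 ≤ p → p < 2 + len → Tb + low p < P × 2 ≤ low (Tb + low p) × low (Tb + low p) < 2 + len
      table-label : ∀ p → 2 ≤ p → p < 2 + len → low (low (Tb + low p)) ≡ low p

    src-pos tgt-pos : ℕ → ℕ
    src-pos i = i + i + 2
    tgt-pos i = i + i + 2 + 1

    src-pos-range : ∀ i → i < m → 2 ≤ src-pos i × src-pos i < 2 + len
    src-pos-range i i< = m≤n+m 2 (i + i) , subst (_< 2 + len) (+-comm 2 (i + i)) (+-monoʳ-< 2 (+-mono-< i< i<))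

    tgt-pos-range : ∀ i → i < m → 2 ≤ tgt-pos i × tgt-pos i < 2 + len
    tgt-pos-range i i< = ≤-trans (m≤n+m 2 (i + i)) (m≤m+n (i + i + 2) 1) ,
      ≤-trans (≤-reflexive (solve 1 (λ i → con 1 :+ (i :+ i :+ con 2 :+ con 1) := con 2 :+ ((con 1 :+ i) :+ (con 1 :+ i))) refl i))
        (+-monoʳ-≤ 2 (+-mono-≤ i< i<))
      where open +-*-Solver

    src-range : ∀ i → i < m → 2 ≤ src i × src i < 2 + len
    src-range i i< = let 2≤ , below = src-pos-range i i< in proj₂ (table-range _ 2≤ below)

    tgt-range : ∀ i → i < m → 2 ≤ tgt i × tgt i < 2 + len
    tgt-range i i< = let 2≤ , below = tgt-pos-range i i< in proj₂ (table-range _ 2≤ below)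

    wraps≤1 : ∀ z i → wraps z i ≤ 1
    wraps≤1 z i = bit≤1 (colour z (tgt i) ≡ᵇ 1)

    wrap-len : ∀ z i → wraps z i * len ≤ len
    wrap-len z i = ≤-trans (*-monoˡ-≤ len (wraps≤1 z i)) (≤-reflexive (*-identityˡ len))

    wrap-k : ∀ z i → wraps z i * k ≤ k
    wrap-k z i = ≤-trans (*-monoˡ-≤ k (wraps≤1 z i)) (≤-reflexive (*-identityˡ k))

    dst-range : ∀ z i → i < m → 2 ≤ dst z i × dst z i < 2 + (len + len)
    dst-range z i i< = let 2≤ , below = tgt-range i i< in
      ≤-trans 2≤ (m≤m+n (tgt i) _) , +-mono-<-≤ below (wrap-len z i)

  record Own (S : State) : Set where
    constructor owning
    field
      own : ∀ r → T (r <ᵇ 13) → reg S r ≡ constants m Tb P base cap N Wd k Z r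

  open Own public

  own-≋ : ∀ {b S S′} → 13 ≤ b → S′ ≋[ b ] S → Own S → Own S′
  own-≋ {b} 13≤b S≋ (owning o) = owning λ r h →
    trans (_≋[_]_.regs S≋ r (Equivalence.from (T-∨ {r <ᵇ b}) (inj₁ (<⇒<ᵇ (<-≤-trans (<ᵇ⇒< r 13 h) 13≤b))))) (o r h)

  module _ (tab : Table) (P≤ : P ≤ 2 ^ W) (room : 2 + (len + len) + Wd < 2 ^ W) (k-room : k + k + 2 < 2 ^ W) (Z≤ : Z ≤ 2 ^ W) where
    open Table tab

    private
      2≤ : 2 ≤ 2 ^ W
      2≤ = ≤-trans (m≤n+m 2 (k + k)) (<⇒≤ k-room)

      label-room : ∀ {x} → x < 2 + (len + len) → x + Wd < 2 ^ W
      label-room x< = <-trans (+-monoˡ-< Wd x<) room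

      label< : ∀ {x} → x < 2 + len → x < 2 + (len + len)
      label< x< = ≤-trans x< (+-monoʳ-≤ 2 (m≤m+n len len))

      small : ∀ {x} → x < 2 + (len + len) → x < 2 ^ W
      small {x} x< = ≤-<-trans (m≤m+n x Wd) (label-room x<)

    edge-run : ∀ {r S φ z i} → Own S → (∀ a → a < P → mem S a ≡ low a) → reg S rZ ≡ z → reg S r ≡ i → i < m → z < Z →
      Run (edgeCode k r) S φ (size (edgeCode k r)) λ S′ φ′ →
        φ′ ≡ φ × S′ ≋[ 21 ] S × reg S′ rU ≡ src i × reg S′ rV ≡ dst z i × reg S′ rAct ≡ act z i
    edge-run {r} {S} {φ} {z} {i} o low≡ z≡ i≡ i< z< =
      by-add i≡ i≡ (small (label< (≤-<-trans (m≤m+n (i + i) 2) (proj₂ sp)))) ▹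
      by-add refl (own o 2 _) (small (label< (proj₂ sp))) ▹
      by-load refl (low≡ _ (at-P (proj₁ sp) (proj₂ sp))) ▹
      by-add refl (own o 1 _) (small (label< (proj₂ tp))) ▹
      by-load refl (low≡ _ (at-P (proj₁ tp) (proj₂ tp))) ▹
      by-add (own o 5 _) refl (<-≤-trans src-T P≤) ▹
      by-load refl (low≡ _ src-T) ▹
      by-add (own o 5 _) refl (<-≤-trans tgt-T P≤) ▹
      by-load refl (low≡ _ tgt-T) ▹
      by-move refl (own o 0 _) (small (label< (proj₂ sr))) ▹
      bind (colour-run W 2≤ k< {S = S₁} (own o 0 _) (own o 1 _) (own o 2 _) (own o 10 _) z≡ refl (<-≤-trans z< Z≤) (label-room (label< (proj₂ sr)))) λ { {S₂} (refl , S₂≋ , c₁) → second S₂ (≋-trans (≋-weaken (m≤m+n 21 3) S₂≋) S₁≋) (_≋[_]_.regs S₂≋ rU _) (_≋[_]_.regs S₂≋ rV _) c₁ }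
      where
      k< : k < 2 ^ W
      k< = ≤-<-trans (≤-trans (m≤m+n k k) (m≤m+n (k + k) 2)) k-room
      sp = src-pos-range i i<
      tp = tgt-pos-range i i<
      sr = src-range i i<
      tr = tgt-range i i<
      src-T : Tb + low (src-pos i) < P
      src-T = proj₁ (table-range (src-pos i) (proj₁ sp) (proj₂ sp))
      tgt-T : Tb + low (tgt-pos i) < P
      tgt-T = proj₁ (table-range (tgt-pos i) (proj₁ tp) (proj₂ tp))
      at-P : ∀ {p} → 2 ≤ p → p < 2 + len → p < P
      at-P _ p< = <-≤-trans p< input≤
      S₁ : State
      S₁ = S ≔ (rE , i + i) ≔ (rE , src-pos i) ≔ (rU , low (src-pos i)) ≔ (rE , tgt-pos i) ≔ (rV , low (tgt-pos i))
             ≔ (rU , Tb + low (src-pos i)) ≔ (rU , src i) ≔ (rV , Tb + low (tgt-pos i)) ≔ (rV , tgt i) ≔ (rX , src i)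
      S₁≋ : S₁ ≋[ 21 ] S
      S₁≋ = ≋-≔ rX (≋-≔ rV (≋-≔ rV (≋-≔ rU (≋-≔ rU (≋-≔ rV (≋-≔ rE (≋-≔ rU (≋-≔ rE (≋-≔ rE (≋-refl {S = S}))))))))))
      Post : State → ℕ → Set
      Post S′ φ′ = φ′ ≡ φ × S′ ≋[ 21 ] S × reg S′ rU ≡ src i × reg S′ rV ≡ dst z i × reg S′ rAct ≡ act z i
      lastCode rest : Program
      lastCode = calc rE eq rC rOne ⨾ calc rD mul rE rK ⨾ calc rC add rC rD ⨾ calc rD mul rE rLen ⨾ calc rV add rV rD ⨾
        calc rAct add rAct rOne ⨾ calc rAct eq rAct rC
      rest = move rAct rC ⨾ move rX rV ⨾ colourCode k ⨾ lastCode
      colour≤ : ∀ x → colour z x ≤ k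
      colour≤ = layer≤ k z
      c+1< : colour z (src i) + 1 < 2 ^ W
      c+1< = ≤-<-trans (+-mono-≤ (≤-trans (colour≤ (src i)) (m≤m+n k k)) (s≤s z≤n)) (≤-trans (≤-reflexive (sym (+-suc (k + k) 1))) (<⇒≤ k-room))
      final : ∀ S₃ → S₃ ≋[ 21 ] S → reg S₃ rU ≡ src i → reg S₃ rV ≡ tgt i → reg S₃ rAct ≡ colour z (src i) →
        reg S₃ rC ≡ colour z (tgt i) → Run lastCode S₃ φ (size lastCode) Post
      final S₃ S₃≋ u v a c =
        by-eq c (own o₃ 1 _) 2≤ ▹
        by-mul refl (own o₃ 11 _) (≤-<-trans (wrap-k z i) k<) ▹
        by-add c refl (≤-<-trans (+-mono-≤ (colour≤ (tgt i)) (wrap-k z i)) (≤-<-trans (m≤m+n (k + k) 2) k-room)) ▹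
        by-mul refl (own o₃ 4 _) (≤-<-trans (wrap-len z i) (small (label< (m≤n+m (suc len) 1)))) ▹
        by-add v refl (small (proj₂ (dst-range z i i<))) ▹
        by-add a (own o₃ 1 _) c+1< ▹
        instruction (by-eq refl refl 2≤)
          ( refl
          , ≋-≔ rAct (≋-≔ rAct (≋-≔ rV (≋-≔ rD (≋-≔ rC (≋-≔ rD (≋-≔ rE S₃≋))))))
          , u , refl , refl )
        where
        o₃ = own-≋ (m≤m+n 13 8) S₃≋ o
      second : ∀ S₂ → S₂ ≋[ 21 ] S → reg S₂ rU ≡ src i → reg S₂ rV ≡ tgt i → reg S₂ rC ≡ colour z (src i) →
        Run rest S₂ φ (size rest) Post
      second S₂ S₂≋ u v c =
        by-move c (own o₂ 0 _) (≤-<-trans (colour≤ (src i)) k<) ▹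
        by-move v (own o₂ 0 _) (small (label< (proj₂ tr))) ▹
        bind (colour-run W 2≤ k< {S = S₂ ≔ (rAct , colour z (src i)) ≔ (rX , tgt i)} (own o₂ 0 _) (own o₂ 1 _) (own o₂ 2 _) (own o₂ 10 _)
               (trans (_≋[_]_.regs S₂≋ rZ _) z≡) refl (<-≤-trans z< Z≤) (label-room (label< (proj₂ tr)))) λ { {S₃} (refl , S₃≋ , c₃) → final S₃
            (≋-trans (≋-weaken (m≤m+n 21 3) S₃≋) (≋-≔ rX (≋-≔ rAct S₂≋)))
            (trans (_≋[_]_.regs S₃≋ rU _) u) (trans (_≋[_]_.regs S₃≋ rV _) v) (_≋[_]_.regs S₃≋ rAct _) c₃ }
        where
        o₂ = own-≋ (m≤m+n 13 8) S₂≋ o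

-- The programs that issue the requests

module HostCode (A : DynamicAlgorithm) (π : Parameter) (k : ℕ) where

  open DynamicAlgorithm A

  call : Program → Program
  call c = calc (guest 0) rem rU rMod ⨾ calc (guest 1) rem rV rMod ⨾ embed c

  callIf : Program → Program
  callIf c = cond rAct (call c) skip

  fromTargetCode toSourceCode : Program
  fromTargetCode = const rU 1 ⨾ calc rV add rI rOne ⨾ call onInsert
  toSourceCode   = move rU rI ⨾ const rV 0 ⨾ call onInsert

  toSourceLoop : Parameter → Program
  toSourceLoop diameter = loop rI rJ rN toSourceCode
  toSourceLoop _        = skip

  staticCode : Program
  staticCode = calc rS sub rN rOne ⨾ loop rI rJ rS fromTargetCode ⨾ toSourceLoop π

  entryCode exitCode recordCode phaseCode : Program
  entryCode  = calc rV add rJ rTwo ⨾ const rU 0 ⨾ skip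
  exitCode   = calc rU add rV rLen ⨾ const rV 1 ⨾ skip
  recordCode = move rFz rZ ⨾ calc rFx add rJ rTwo ⨾ const rFound 1
  phaseCode  =
    entryCode ⨾ call onInsert ⨾ exitCode ⨾ call onInsert ⨾
    embed onQuery ⨾ cond (guest 0) recordCode skip ⨾
    call onDelete ⨾ entryCode ⨾ call onDelete

  insertCode deleteCode blockCode : Program
  insertCode = edgeCode k rI ⨾ callIf onInsert
  deleteCode = edgeCode k rJ ⨾ callIf onDelete
  blockCode  = loop rI rJ rM insertCode ⨾ loop rI rJ rLen phaseCode ⨾ loop rI rJ rM deleteCode

  mainCode : Program
  mainCode = staticCode ⨾ loop rO rZ rZs blockCode

  blockCost : ℕ → ℕ
  blockCost m = loopCost m (size insertCode) + (loopCost (m + m) (size phaseCode) + loopCost m (size deleteCode))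

  mainCost : (n′ m Z : ℕ) → ℕ
  mainCost n′ m Z = (1 + (loopCost n′ (size fromTargetCode) + loopCost (suc n′) (size toSourceCode))) + loopCost Z (blockCost m)

-- Correctness of the programs that issue the requests

module Main (A : DynamicAlgorithm) (π : Parameter) (W w m Tb P base n′ Wd k Z : ℕ) .{{Wd≢0 : NonZero Wd}}
            (low : ℕ → ℕ) where

  open DynamicAlgorithm A
  open HostCode A π k
  open Logic W
  open Edges W m Tb P base (2 ^ w) (suc n′) Wd k Z low

  record Facts : Set where
    field
      tab            : Table
      w≤W            : w ≤ W
      fits           : base + 2 ^ w ≤ 2 ^ W
      P≤base         : P ≤ base
      vertex-room    : 4 + (len + len) ≤ suc n′
      N<             : suc n′ < 2 ^ W
      label-room     : 2 + (len + len) + Wd < 2 ^ W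
      k-room         : k + k + 2 < 2 ^ W
      Z<             : Z < 2 ^ W
      edge-injective : ∀ z i j → i < m → j < m → src i ≡ src j → dst z i ≡ dst z j → i ≡ j

  module _ (F : Facts) (extra : List Bool) where

    open Facts F
    open Table tab
    open Simulation w W base w≤W fits extra
    open Sequence π n′ m len vertex-room src dst act src-range dst-range edge-injective
      hiding (N) renaming (base to baseGraph)

    -- The derivation `serves` describes the requests still to come. The potential is twice its
    -- time, the price of simulating all of them; single calls have no bound of their own.
    record Inv (S : State) (φ : ℕ) (E : List (Edge (suc n′))) (σ : List (Request (suc n′))) : Set where
      field
        own′   : Own S
        low≡   : ∀ a → a < base → mem S a ≡ low a
        guestˢ : State
        time   : ℕ
        sim    : Sim S guestˢ
        serves : Serves w A π guestˢ E σ time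
        pot    : φ ≡ 2 * time

    Same : State → State → Set
    Same S S′ = ∀ r → T (r <ᵇ 31) → reg S′ r ≡ reg S r

    inv-≋ : ∀ {S S′ φ E σ} → S′ ≋[ 13 ] S → Inv S φ E σ → Inv S′ φ E σ
    inv-≋ {S} {S′} S≋@(agree rs ms cs) I = record
      { own′ = own-≋ ≤-refl S≋ (Inv.own′ I)
      ; low≡ = λ a a< → trans (cong (λ f → f a) ms) (Inv.low≡ I a a<)
      ; guestˢ = Inv.guestˢ I ; time = Inv.time I ; serves = Inv.serves I ; pot = Inv.pot I
      ; sim = record
        { base-reg = trans (rs rBase _) (Sim.base-reg s) ; mod-reg = trans (rs rMod _) (Sim.mod-reg s)
        ; regs = λ r → trans (rs (guest r) _) (Sim.regs s r)
        ; mems = λ a a< → trans (cong (λ f → f (base + a)) ms) (Sim.mems s a a<)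
        ; coins≡ = trans cs (Sim.coins≡ s) ; reg-< = Sim.reg-< s ; mem-< = Sim.mem-< s } }
      where
      s = Inv.sim I

    own-frame : ∀ {S S′} → Frame S S′ → Own S → Own S′
    own-frame f (owning o) = owning λ r h → trans (Frame.regs f r (<⇒<ᵇ (<-≤-trans (<ᵇ⇒< r 13 h) (m≤m+n 13 18)))) (o r h)

    low-frame : ∀ {S S′} → Frame S S′ → (∀ a → a < base → mem S a ≡ low a) → ∀ a → a < base → mem S′ a ≡ low a
    low-frame f l a a< = trans (Frame.mems f a a<) (l a a<)

    -- The potential drops by `2 * t` and pays for the whole simulated run; the budget
    -- `size (embed c)` is pure slack.
    guest-run : ∀ {c s s′ t u S φ} → w ⊢ c , s ⇓ s′ , t → Sim S s → φ ≡ 2 * (t + u) →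
      Run (embed c) S φ (size (embed c)) λ S′ φ′ → φ′ ≡ 2 * u × Sim S′ s′ × Frame S S′
    guest-run {c} {t = t} {u} d sim refl with simulate d sim
    ... | S′ , t′ , d′ , t′≤ , sim′ , f = ran (S′ , t′ , 2 * u , d′ , bound , refl , sim′ , f)
      where
      bound : t′ + 2 * u ≤ size (embed c) + 2 * (t + u)
      bound = ≤-trans (+-monoˡ-≤ (2 * u) t′≤) (≤-trans (≤-reflexive (sym (*-distribˡ-+ 2 t u))) (m≤n+m (2 * (t + u)) (size (embed c))))

    call-run : ∀ {c S s s′ t t′ φ} {u v : Fin (suc n′)} → Sim S s → reg S rU ≡ toℕ u → reg S rV ≡ toℕ v →
      w ⊢ c , withArguments (u , v) w s ⇓ s′ , t → φ ≡ 2 * (t + t′) →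
      Run (call c) S φ (size (call c)) λ S′ φ′ → φ′ ≡ 2 * t′ × Sim S′ s′ × Frame S S′
    call-run {c} {S} {u = u} {v} sim u≡ v≡ d refl =
      by-calc u≡ (Sim.mod-reg sim) (evalOp-rem-2^ w≤W (toℕ u)) ▹
      by-calc v≡ (Sim.mod-reg sim) (evalOp-rem-2^ w≤W (toℕ v)) ▹
      consequence (guest-run d (assign 1 (assign 0 sim (wrap-< w (toℕ u))) (wrap-< w (toℕ v))) refl)
        λ (p , sim′ , f) → p , sim′ , frame-trans args f
      where
      args : Frame S (S ≔ (guest 0 , wrap w (toℕ u)) ≔ (guest 1 , wrap w (toℕ v)))
      args .Frame.regs r h rewrite own≢guest {r} 1 h | own≢guest {r} 0 h = refl
      args .Frame.mems _ _ = refl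

    insert-run : ∀ {S φ E σ u v} → Inv S φ E (insert (u , v) ∷ σ) → reg S rU ≡ toℕ u → reg S rV ≡ toℕ v →
      Run (call onInsert) S φ (size (call onInsert)) λ S′ φ′ → Inv S′ φ′ ((u , v) ∷ E) σ × Same S S′
    insert-run record { own′ = o ; low≡ = l ; sim = sim ; serves = insert d sv ; pot = pot } u≡ v≡ =
      consequence (call-run sim u≡ v≡ d pot) λ (p , sim′ , f) →
        record { own′ = own-frame f o ; low≡ = low-frame f l ; sim = sim′ ; serves = sv ; pot = p } , Frame.regs f

    delete-run : ∀ {S φ E σ u v} → (u , v) ∉ E → Inv S φ ((u , v) ∷ E) (delete (u , v) ∷ σ) →
      reg S rU ≡ toℕ u → reg S rV ≡ toℕ v →
      Run (call onDelete) S φ (size (call onDelete)) λ S′ φ′ → Inv S′ φ′ E σ × Same S S′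
    delete-run e∉ record { own′ = o ; low≡ = l ; sim = sim ; serves = delete d sv ; pot = pot } u≡ v≡ =
      consequence (call-run sim u≡ v≡ d pot) λ (p , sim′ , f) →
        record { own′ = own-frame f o ; low≡ = low-frame f l ; sim = sim′
               ; serves = subst (λ E → Serves w A π _ E _ _) (remove-head e∉) sv ; pot = p } , Frame.regs f

    query-run : ∀ {S φ E σ} → Inv S φ E (query ∷ σ) →
      Run (embed onQuery) S φ (size (embed onQuery)) λ S′ φ′ →
        Inv S′ φ′ E σ × Same S S′ × ∃[ x ] (IsValue π E x × Reports (reg S′ (guest 0)) x)
    query-run record { own′ = o ; low≡ = l ; sim = sim ; serves = query {x = x} d val rep sv ; pot = pot } =
      consequence (guest-run d sim pot) λ (p , sim′ , f) →
        record { own′ = own-frame f o ; low≡ = low-frame f l ; sim = sim′ ; serves = sv ; pot = p } , Frame.regs f ,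
        x , val , subst (λ a → Reports a x) (sym (Sim.regs sim′ 0)) rep

    InRange : ℕ → ℕ → Set
    InRange z x = z < Z × 2 ≤ x × x < 2 + len

    -- Pairs of a colouring and a label in `Seen` have been queried. A success is known only under a
    -- double negation, by `query-finite`, whereas failures are negations anyway.
    Record : (ℕ → ℕ → Set) → State → Set
    Record Seen S =
      (reg S rFound ≡ 0 × (∀ z x → InRange z x → Seen z x → ¬ Path z x (x + len))) ⊎
      (reg S rFound ≡ 1 × InRange (reg S rFz) (reg S rFx) × ¬ ¬ Path (reg S rFz) (reg S rFx) (reg S rFx + len))

    record-same : ∀ {Seen S S′} → reg S′ rFound ≡ reg S rFound → reg S′ rFz ≡ reg S rFz → reg S′ rFx ≡ reg S rFx →
      Record Seen S → Record Seen S′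
    record-same f z x (inj₁ (p , q)) = inj₁ (trans f p , q)
    record-same {S = S} {S′} f z x (inj₂ (p , q)) = inj₂ (trans f p ,
      subst₂ (λ z x → InRange z x × ¬ ¬ Path z x (x + len)) (sym z) (sym x) q)

    -- Colourings and labels are both handled in descending order, so the pairs done are the later
    -- ones, lexicographically.
    SeenPhase : (z y : ℕ) → ℕ → ℕ → Set
    SeenPhase z y z′ x = z < z′ ⊎ z′ ≡ z × y + 2 ≤ x

    -- The field `loops` protects registers 16 to 20, which hold the loop counters, the colouring
    -- and a loop bound, from the body of a loop.
    record Stage (S₀ S : State) (φ : ℕ) (E : List (Edge (suc n′))) (σ : List (Request (suc n′))) (Seen : ℕ → ℕ → Set) : Set where
      constructor stage
      field
        inv   : Inv S φ E σ
        loops : ∀ r → T ((15 <ᵇ r) ∧ (r <ᵇ 21)) → reg S r ≡ reg S₀ r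
        rec   : Record Seen S

    stage-≋ : ∀ {S₀ S S′ φ E σ Seen} → S′ ≋[ 21 ] S → Stage S₀ S φ E σ Seen → Stage S₀ S′ φ E σ Seen
    stage-≋ {S = S} {S′} S≋ (stage I L R) = stage
      (inv-≋ (≋-weaken (m≤m+n 13 8) S≋) I)
      (λ r h → trans (rs r (Equivalence.from (T-∨ {r <ᵇ 21}) (inj₁ (proj₂ (Equivalence.to (T-∧ {15 <ᵇ r}) h))))) (L r h))
      (record-same {S = S} {S′} (rs rFound _) (rs rFz _) (rs rFx _) R)
      where
      rs = _≋[_]_.regs S≋

    stage-same : ∀ {S₀ S S′ φ φ′ E E′ σ σ′ Seen} → Inv S′ φ′ E′ σ′ → Same S S′ → Stage S₀ S φ E σ Seen → Stage S₀ S′ φ′ E′ σ′ Seen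
    stage-same {S = S} {S′} I′ eq≡ (stage I L R) = stage I′
      (λ r h → trans (eq≡ r (<⇒<ᵇ (<-≤-trans (<ᵇ⇒< r 21 (proj₂ (Equivalence.to (T-∧ {15 <ᵇ r}) h))) (m≤m+n 21 10)))) (L r h))
      (record-same {S = S} {S′} (eq≡ rFound _) (eq≡ rFz _) (eq≡ rFx _) R)

    toℕ-vertex : ∀ {x} → x < suc n′ → x ≡ toℕ (vertex x)
    toℕ-vertex x< = sym (toℕ-mod x<)

    own-of : ∀ {S φ E σ} → Inv S φ E σ → ∀ r → T (r <ᵇ 13) → reg S r ≡ constants m Tb P base (2 ^ w) (suc n′) Wd k Z r
    own-of I = Own.own (Inv.own′ I)

    entry-run : ∀ {S φ j} → Own S → reg S rJ ≡ j → j < len → Run entryCode S φ (size entryCode) λ S′ φ′ →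
      φ′ ≡ φ × S′ ≋[ 21 ] S × reg S′ rU ≡ toℕ (vertex 0) × reg S′ rV ≡ j + 2
    entry-run {S} (owning o) j≡ j< =
      by-add j≡ (o 2 _) (<-trans (label<N (subst (_< 2 + len) (+-comm 2 _) (+-monoʳ-< 2 j<))) N<) ▹
      by-const (<-trans 0<N N<) ▹
      instruction skip (refl , ≋-≔ rU (≋-≔ rV (≋-refl {S = S})) , toℕ-vertex 0<N , refl)

    exit-run : ∀ {S φ x} → Own S → reg S rV ≡ x → x < 2 + len → Run exitCode S φ (size exitCode) λ S′ φ′ →
      φ′ ≡ φ × S′ ≋[ 21 ] S × reg S′ rU ≡ x + len × reg S′ rV ≡ toℕ (vertex 1)
    exit-run {S} (owning o) x≡ x< =
      by-add x≡ (o 4 _) (<-trans (copy<N (label-copy< x<)) N<) ▹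
      by-const (<-trans 1<N N<) ▹
      instruction skip (refl , ≋-≔ rV (≋-≔ rU (≋-refl {S = S})) , refl , toℕ-vertex 1<N)

    module Phase {S₀ : State} {z j : ℕ} (j< : j < len) (z< : z < Z) (z≡ : reg S₀ rZ ≡ z) (j≡ : reg S₀ rJ ≡ j) where

      x : ℕ
      x = j + 2

      2≤x : 2 ≤ x
      2≤x = m≤n+m 2 j

      x< : x < 2 + len
      x< = subst (_< 2 + len) (+-comm 2 j) (+-monoʳ-< 2 j<)

      later : ∀ {z′ x′} → SeenPhase z j z′ x′ → SeenPhase z (suc j) z′ x′ ⊎ (z′ ≡ z × x′ ≡ x)
      later (inj₁ p) = inj₁ (inj₁ p)
      later {x′ = x′} (inj₂ (p , q)) with x ≟ x′
      ... | yes e = inj₂ (p , sym e)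
      ... | no ne = inj₁ (inj₂ (p , ≤∧≢⇒< q ne))

      record-run : ∀ {S φ E σ v} → Stage S₀ S φ E σ (SeenPhase z (suc j)) → IsValue π (queryGraph z x) v → Reports (reg S (guest 0)) v →
        Run (cond (guest 0) recordCode skip) S φ (size (cond (guest 0) recordCode skip)) λ S′ φ′ →
          Stage S₀ S′ φ′ E σ (SeenPhase z j) × reg S′ rU ≡ reg S rU × reg S′ rV ≡ reg S rV
      record-run {S} {v = [ l ]} (stage I L R) val rep = branch
        (λ _ → by-move z≡′ (own-of I 0 _) (<-trans z< Z<) ▹
               by-add j≡′ (own-of I 2 _) (<-trans (label<N x<) N<) ▹
               instruction (by-const (<-trans 1<N N<))
                 (stage (inv-≋ (≋-≔ rFound (≋-≔ rFx (≋-≔ rFz (≋-refl {S = S})))) I) loops′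
                   (inj₂ (refl , (z< , 2≤x , x<) , query-finite 2≤x x< val)) , refl , refl))
        (λ p → contradiction (trans (sym rep) p) λ ())
        where
        z≡′ : reg S rZ ≡ z
        z≡′ = trans (L rZ _) z≡
        j≡′ : reg S rJ ≡ j
        j≡′ = trans (L rJ _) j≡
        loops′ : ∀ r → T ((15 <ᵇ r) ∧ (r <ᵇ 21)) → reg (S ≔ (rFz , z) ≔ (rFx , x) ≔ (rFound , 1)) r ≡ reg S₀ r
        loops′ r h = trans (trans (update-other (reg (S ≔ (rFz , z) ≔ (rFx , x))) 1 (ne {rFound} _))
          (trans (update-other (reg (S ≔ (rFz , z))) x (ne {rFx} _)) (update-other (reg S) z (ne {rFz} _)))) (L r h)
          where
          ne : ∀ {q} → T (q <ᵇ 16) → q ≢ r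
          ne {q} q< refl = <⇒≱ (<ᵇ⇒< q 16 q<) (<ᵇ⇒< 15 q (proj₁ (Equivalence.to T-∧ h)))
      record-run {S} {v = ⊤⁺} (stage I L R) val rep = branch {B = size recordCode}
        (contradiction rep)
        (λ _ → instruction skip (stage I L (extended R) , refl , refl))
        where
        extended : Record (SeenPhase z (suc j)) S → Record (SeenPhase z j) S
        extended (inj₂ p) = inj₂ p
        extended (inj₁ (p , q)) = inj₁ (p , λ z′ x′ range seen → case later seen of λ where
          (inj₁ seen′)        → q z′ x′ range seen′
          (inj₂ (refl , refl)) → query-infinite 2≤x x< val)

      phase-run : ∀ {φ r} → Stage S₀ S₀ φ (active z m) (phase j r) (SeenPhase z (suc j)) →
        Run phaseCode S₀ φ (size phaseCode) λ S′ φ′ → Stage S₀ S′ φ′ (active z m) r (SeenPhase z j)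
      phase-run st₀ =
        bind (entry-run (Inv.own′ (Stage.inv st₀)) j≡ j<) λ where
          (refl , S≋₁ , u₁ , v₁) → let st₁ = stage-≋ S≋₁ st₀ in
            bind (insert-run (Stage.inv st₁) u₁ (trans v₁ (toℕ-vertex (label<N x<)))) λ where
              (I₂ , same₂) → let st₂ = stage-same I₂ same₂ st₁ in
                bind (exit-run (Inv.own′ I₂) (trans (same₂ rV _) v₁) x<) λ where
                  (refl , S≋₃ , u₃ , v₃) → let st₃ = stage-≋ S≋₃ st₂ in
                    bind (insert-run (Stage.inv st₃) (trans u₃ copy) v₃) λ where
                      (I₄ , same₄) → let st₄ = stage-same I₄ same₄ st₃ in
                        bind (query-run I₄) λ where
                          (I₅ , same₅ , _ , val , rep) →
                            bind (record-run (stage-same I₅ same₅ st₄) val rep) λ where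
                              (st₆ , u₆ , v₆) →
                                -- The registers `rU` and `rV` still hold the ends of the exit edge:
                                -- neither the calls nor the recording of the answer changes them.
                                bind (delete-run (exit∉ 2≤x x< z) (Stage.inv st₆)
                                       (trans u₆ (trans (same₅ rU _) (trans (same₄ rU _) (trans u₃ copy))))
                                       (trans v₆ (trans (same₅ rV _) (trans (same₄ rV _) v₃)))) λ where
                                  (I₇ , same₇) → let st₇ = stage-same I₇ same₇ st₆ in
                                    bind (entry-run (Inv.own′ I₇) (trans (Stage.loops st₇ rJ _) j≡) j<) λ where
                                      (refl , S≋₈ , u₈ , v₈) → let st₈ = stage-≋ S≋₈ st₇ in
                                        consequence (delete-run (entry∉ 2≤x x< z) (Stage.inv st₈) u₈ (trans v₈ (toℕ-vertex (label<N x<)))) λ where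
                                          (I₉ , same₉) → stage-same I₉ same₉ st₈
        where
        copy : x + len ≡ toℕ (vertex (x + len))
        copy = toℕ-vertex (copy<N (label-copy< x<))

    callIf-insert : ∀ a {S₀ S φ E r Seen u v} → reg S rAct ≡ a → reg S rU ≡ toℕ u → reg S rV ≡ toℕ v →
      Stage S₀ S φ E (emitIf a (insert (u , v)) r) Seen →
      Run (callIf onInsert) S φ (size (callIf onInsert)) λ S′ φ′ → Stage S₀ S′ φ′ (addIf a (u , v) E) r Seen
    callIf-insert zero    a≡ u≡ v≡ st = branch {B = size (call onInsert)} (contradiction a≡) λ _ → instruction skip st
    callIf-insert (suc a) a≡ u≡ v≡ st = branch
      (λ _ → consequence (insert-run (Stage.inv st) u≡ v≡) λ (I , same) → stage-same I same st)
      (λ p → contradiction (trans (sym a≡) p) λ ())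

    callIf-delete : ∀ a {S₀ S φ E r Seen u v} → (u , v) ∉ E → reg S rAct ≡ a → reg S rU ≡ toℕ u → reg S rV ≡ toℕ v →
      Stage S₀ S φ (addIf a (u , v) E) (emitIf a (delete (u , v)) r) Seen →
      Run (callIf onDelete) S φ (size (callIf onDelete)) λ S′ φ′ → Stage S₀ S′ φ′ E r Seen
    callIf-delete zero    e∉ a≡ u≡ v≡ st = branch {B = size (call onDelete)} (contradiction a≡) λ _ → instruction skip st
    callIf-delete (suc a) e∉ a≡ u≡ v≡ st = branch
      (λ _ → consequence (delete-run e∉ (Stage.inv st) u≡ v≡) λ (I , same) → stage-same I same st)
      (λ p → contradiction (trans (sym a≡) p) λ ())

    record Ctx (z o : ℕ) (S : State) (φ : ℕ) (E : List (Edge (suc n′))) (σ : List (Request (suc n′))) (Seen : ℕ → ℕ → Set) : Set where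
      constructor ctx
      field
        inv : Inv S φ E σ
        z≡  : reg S rZ ≡ z
        o≡  : reg S rO ≡ o
        rec : Record Seen S

    ctx-≋ : ∀ {z o S S′ φ E σ Seen} → S′ ≋[ 18 ] S → Ctx z o S φ E σ Seen → Ctx z o S′ φ E σ Seen
    ctx-≋ {S = S} {S′} S≋@(agree rs _ _) (ctx I z o R) =
      ctx (inv-≋ (≋-weaken (m≤m+n 13 5) S≋) I) (trans (rs rZ _) z) (trans (rs rO _) o)
        (record-same {S = S} {S′} (rs rFound _) (rs rFz _) (rs rFx _) R)

    stage-start : ∀ {z o S φ E σ Seen} → Ctx z o S φ E σ Seen → Stage S S φ E σ Seen
    stage-start (ctx I _ _ R) = stage I (λ _ _ → refl) R

    inner-loop : ∀ {z o c L rB} → (rI ≡ᵇ rB) ≡ false → L < 2 ^ W →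
      (E : ℕ → ℕ → List (Edge (suc n′))) (σ : ℕ → ℕ → List (Request (suc n′))) (Seen : ℕ → ℕ → ℕ → ℕ → Set) →
      (∀ i j S φ → i + suc j ≡ L → reg S rI ≡ i → reg S rJ ≡ j → Ctx z o S φ (E i (suc j)) (σ i (suc j)) (Seen i (suc j)) →
        Run c S φ (size c) λ S′ φ′ → Stage S S′ φ′ (E (suc i) j) (σ (suc i) j) (Seen (suc i) j)) →
      ∀ {S φ} → reg S rB ≡ L → Ctx z o S φ (E 0 L) (σ 0 L) (Seen 0 L) →
      Run (loop rI rJ rB c) S φ (loopCost L (size c)) λ S′ φ′ → Ctx z o S′ φ′ (E L 0) (σ L 0) (Seen L 0)
    inner-loop {z} {o} {c} {L} I≢B L< E σ Seen each {S} b C =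
      Loop.loop-rule refl refl refl refl refl I≢B L< (λ i j S φ → Ctx z o S φ (E i j) (σ i j) (Seen i j))
        (λ i j S φ e up C → consequence
          (each i j (S ≔ (rJ , j)) φ e up refl (ctx-≋ (≋-≔ rJ (≋-refl {S = S})) C))
          λ {S′} (stage I L R) → trans (L rI _) up , L rJ _ , own-of I 1 _ ,
            ctx-≋ (≋-≔ rI (≋-refl {S = S′})) (ctx I (trans (L rZ _) (Ctx.z≡ C)) (trans (L rO _) (Ctx.o≡ C)) R))
        (own-of (Ctx.inv C) 0 _) (own-of (Ctx.inv C) 1 _) b
        (ctx-≋ (≋-≔ rJ (≋-≔ rI (≋-refl {S = S}))) C)

    len< : len < 2 ^ W
    len< = <-trans (label<N (m≤n+m (suc len) 1)) N<

    m< : m < 2 ^ W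
    m< = ≤-<-trans (m≤m+n m m) len<

    module _ {z o : ℕ} (z< : z < Z) where

      edges-run : ∀ {r S φ E σ Seen i} → i < m → reg S r ≡ i → Ctx z o S φ E σ Seen →
        Run (edgeCode k r) S φ (size (edgeCode k r)) λ S′ φ′ → Stage S S′ φ′ E σ Seen ×
          reg S′ rU ≡ toℕ (vertex (src i)) × reg S′ rV ≡ toℕ (vertex (dst z i)) × reg S′ rAct ≡ act z i
      edges-run i< i≡ C@(ctx I z≡ _ _) = consequence
        (edge-run tab (≤-trans P≤base (≤-trans (m≤m+n base _) fits)) label-room k-room (<⇒≤ Z<)
          (Inv.own′ I) (λ a a< → Inv.low≡ I a (<-≤-trans a< P≤base)) z≡ i≡ i< z<)
        λ { (refl , S≋ , u , v , a) → stage-≋ S≋ (stage-start C) ,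
              trans u (toℕ-vertex (label<N (proj₂ (src-range _ i<)))) ,
              trans v (toℕ-vertex (copy<N (proj₂ (dst-range z _ i<)))) , a }

      insert-loop : ∀ {S φ r Seen} → Ctx z o S φ baseGraph (up (insertEdge z) 0 m r) Seen →
        Run (loop rI rJ rM insertCode) S φ (loopCost m (size insertCode)) λ S′ φ′ → Ctx z o S′ φ′ (active z m) r Seen
      insert-loop {r = r} {Seen} C = inner-loop refl m<
        (λ i j → active z i) (λ i j → up (insertEdge z) i j r) (λ _ _ → Seen)
        (λ i j S φ e i≡ j≡ C → bind (edges-run (≤-trans (m≤m+n (suc i) j) (≤-reflexive (trans (sym (+-suc i j)) e))) i≡ C)
          λ (st , u , v , a) → callIf-insert (act z i) a u v st)
        (own-of (Ctx.inv C) 3 _) C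

      delete-loop : ∀ {S φ r Seen} → Ctx z o S φ (active z m) (down (deleteEdge z) m r) Seen →
        Run (loop rI rJ rM deleteCode) S φ (loopCost m (size deleteCode)) λ S′ φ′ → Ctx z o S′ φ′ baseGraph r Seen
      delete-loop {r = r} {Seen} C = inner-loop refl m<
        (λ i j → active z j) (λ i j → down (deleteEdge z) j r) (λ _ _ → Seen)
        (λ i j S φ e i≡ j≡ C → let j< = ≤-trans (m≤n+m (suc j) i) (≤-reflexive e) in
          bind (edges-run j< j≡ C) λ (st , u , v , a) → callIf-delete (act z j) (edge∉ z j<) a u v st)
        (own-of (Ctx.inv C) 3 _) C

      phase-loop : ∀ {S φ r} → Ctx z o S φ (active z m) (down phase len r) (SeenPhase z len) →
        Run (loop rI rJ rLen phaseCode) S φ (loopCost len (size phaseCode)) λ S′ φ′ → Ctx z o S′ φ′ (active z m) r (SeenPhase z 0)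
      phase-loop {r = r} C = inner-loop refl len<
        (λ i j → active z m) (λ i j → down phase j r) (λ i j → SeenPhase z j)
        (λ i j S φ e i≡ j≡ C →
          Phase.phase-run (≤-trans (m≤n+m (suc j) i) (≤-reflexive e)) z< (Ctx.z≡ C) j≡ (stage-start C))
        (own-of (Ctx.inv C) 4 _) C

      block-run : ∀ {S φ r} → Ctx z o S φ baseGraph (block z r) (λ z′ _ → suc z ≤ z′) →
        Run blockCode S φ (blockCost m) λ S′ φ′ → Ctx z o S′ φ′ baseGraph r (λ z′ _ → z ≤ z′)
      block-run C =
        bind (insert-loop (ctx-seen none-yet C)) λ C₁ → bind (phase-loop C₁) λ C₂ →
          consequence (delete-loop C₂) (ctx-seen all-now)
        where
        ctx-seen : ∀ {S φ E σ} {Seen Seen′ : ℕ → ℕ → Set} → (∀ {z′ x} → InRange z′ x → Seen′ z′ x → Seen z′ x) →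
          Ctx z o S φ E σ Seen → Ctx z o S φ E σ Seen′
        ctx-seen f (ctx I p q (inj₁ (r , s))) = ctx I p q (inj₁ (r , λ z′ x range seen → s z′ x range (f range seen)))
        ctx-seen f (ctx I p q (inj₂ r)) = ctx I p q (inj₂ r)
        none-yet : ∀ {z′ x} → InRange z′ x → SeenPhase z len z′ x → suc z ≤ z′
        none-yet _ (inj₁ p) = p
        none-yet (_ , _ , x<) (inj₂ (_ , q)) = contradiction (≤-trans (≤-reflexive (+-comm 2 len)) q) (<⇒≱ x<)
        all-now : ∀ {z′ x} → InRange z′ x → z ≤ z′ → SeenPhase z 0 z′ x
        all-now {z′} (_ , 2≤x , _) z≤ with z ≟ z′
        ... | yes e = inj₂ (sym e , 2≤x)
        ... | no ne = inj₁ (≤∧≢⇒< z≤ ne)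

    Everything Nothing : ℕ → ℕ → Set
    Everything _ _ = ⊤
    Nothing    _ _ = ⊥

    colouring-loop : ∀ {S φ} → Inv S φ baseGraph (down block Z []) → Record Nothing S →
      Run (loop rO rZ rZs blockCode) S φ (loopCost Z (blockCost m)) λ S′ φ′ → Inv S′ φ′ baseGraph [] × Record Everything S′
    colouring-loop {S} I R = consequence
      (Loop.loop-rule refl refl refl refl refl refl Z<
        (λ i j S φ → Inv S φ baseGraph (down block j []) × Record (λ z′ _ → j ≤ z′) S)
        (λ i j S φ e up (I , R) → consequence
          (block-run (≤-trans (m≤n+m (suc j) i) (≤-reflexive e)) {S ≔ (rZ , j)}
            (ctx (inv-≋ (≋-≔ rZ (≋-refl {S = S})) I) refl refl (record-same {S = S} {S ≔ (rZ , j)} refl refl refl R)))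
          λ {S′} (ctx I z o R) → trans o up , z , own-of I 1 _ ,
            inv-≋ (≋-≔ rO (≋-refl {S = S′})) I , record-same {S = S′} {S′ ≔ (rO , suc i)} refl refl refl R)
        (own-of I 0 _) (own-of I 1 _) (own-of I 12 _)
        (inv-≋ (≋-≔ rZ (≋-≔ rO (≋-refl {S = S}))) I , entering R))
      λ {S′} (I , R) → I , leaving {S′} R
      where
      entering : Record Nothing S → Record (λ z′ _ → Z ≤ z′) (S ≔ (rO , 0) ≔ (rZ , Z))
      entering (inj₁ (p , q)) = inj₁ (p , λ z x (z< , _) Z≤z → contradiction Z≤z (<⇒≱ z<))
      entering (inj₂ p) = inj₂ p
      leaving : ∀ {S} → Record (λ z′ _ → 0 ≤ z′) S → Record Everything S
      leaving (inj₁ (p , q)) = inj₁ (p , λ z x range _ → q z x range z≤n)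
      leaving (inj₂ p) = inj₂ p

    static-run : ∀ {S φ} → Inv S φ [] (requests Z) → Record Nothing S →
      Run staticCode S φ (1 + (loopCost n′ (size fromTargetCode) + loopCost (suc n′) (size toSourceCode))) λ S′ φ′ →
        Inv S′ φ′ baseGraph (down block Z []) × Record Nothing S′
    static-run {S} I R =
      by-sub (own-of I 9 _) (own-of I 1 _) (s≤s z≤n) N< ▹
      bind (inner-loop {rB = rS} refl (<-trans (n<1+n n′) N<)
             (λ i j → targetGraph i) (λ i j → up fromTarget i j (up toSource 0 (sourceEdges π) (down block Z []))) (λ _ _ → Nothing) fromTarget-run refl
             (ctx (inv-≋ (≋-≔ rS (≋-refl {S = S})) I) refl refl (record-same {S = S} {S ≔ (rS , n′)} refl refl refl R)))
        (toSource-loop π refl)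
      where
      fromTarget-run : ∀ {z o r} i j S φ → i + suc j ≡ n′ → reg S rI ≡ i → reg S rJ ≡ j →
        Ctx z o S φ (targetGraph i) (up fromTarget i (suc j) r) Nothing →
        Run fromTargetCode S φ (size fromTargetCode) λ S′ φ′ →
          Stage S S′ φ′ (targetGraph (suc i)) (up fromTarget (suc i) j r) Nothing
      fromTarget-run i j S φ e i≡ j≡ C =
        let i< = s≤s (≤-trans (m≤m+n (suc i) j) (≤-reflexive (trans (sym (+-suc i j)) e)))
            st = stage-≋ (≋-≔ rV (≋-≔ rU (≋-refl {S = S}))) (stage-start C) in
        by-const (<-trans 1<N N<) ▹
        by-add i≡ (own-of (Ctx.inv C) 1 _) (<-trans (subst (_< suc n′) (+-comm 1 i) i<) N<) ▹
        consequence (insert-run (Stage.inv st) (toℕ-vertex 1<N) (trans (+-comm i 1) (toℕ-vertex i<)))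
          λ (I , same) → stage-same I same st

      toSource-run : ∀ {z o r} i j S φ → i + suc j ≡ suc n′ → reg S rI ≡ i → reg S rJ ≡ j →
        Ctx z o S φ (staticGraph i) (up toSource i (suc j) r) Nothing →
        Run toSourceCode S φ (size toSourceCode) λ S′ φ′ →
          Stage S S′ φ′ (staticGraph (suc i)) (up toSource (suc i) j r) Nothing
      toSource-run i j S φ e i≡ j≡ C =
        let i< = ≤-trans (m≤m+n (suc i) j) (≤-reflexive (trans (sym (+-suc i j)) e))
            st = stage-≋ (≋-≔ rV (≋-≔ rU (≋-refl {S = S}))) (stage-start C) in
        by-move i≡ (own-of (Ctx.inv C) 0 _) (<-trans i< N<) ▹
        by-const (<-trans 0<N N<) ▹
        consequence (insert-run (Stage.inv st) (toℕ-vertex i<) (toℕ-vertex 0<N))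
          λ (I , same) → stage-same I same st

      toSource-loop : ∀ π′ {z o S φ} → π′ ≡ π →
        Ctx z o S φ (targetGraph n′) (up toSource 0 (sourceEdges π′) (down block Z [])) Nothing →
        Run (toSourceLoop π′) S φ (loopCost (suc n′) (size toSourceCode)) λ S′ φ′ →
          Inv S′ φ′ (staticGraph (sourceEdges π′)) (down block Z []) × Record Nothing S′
      toSource-loop diameter _ C = consequence
        (inner-loop refl N< (λ i j → staticGraph i) (λ i j → up toSource i j (down block Z [])) (λ _ _ → Nothing) toSource-run
          (own-of (Ctx.inv C) 9 _) C)
        λ (ctx I _ _ R) → I , R
      toSource-loop radius       _ (ctx I _ _ R) = weaken (s≤s z≤n) (instruction skip (I , R))
      toSource-loop eccentricity _ (ctx I _ _ R) = weaken (s≤s z≤n) (instruction skip (I , R))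

    main-run : ∀ {S φ} → Inv S φ [] (requests Z) → reg S rFound ≡ 0 →
      Run mainCode S φ (mainCost n′ m Z) λ S′ φ′ → Inv S′ φ′ baseGraph [] × Record Everything S′
    main-run I f = bind (static-run I (inj₁ (f , λ _ _ _ ()))) λ (I , R) → colouring-loop I R

-- Finding a path of length k with parent pointers

-- One relaxation of Bellman and Ford. A parent is stored as its label plus one, so that 0 means
-- unreached.
relaxCode : ℕ → Program
relaxCode k = edgeCode k rI ⨾ cond rAct
  (calc rE add rPar rU ⨾ load rE rE ⨾ cond rE (calc rE add rU rOne ⨾ calc rD add rPar rV ⨾ store rD rE) skip) skip

searchCode : ℕ → Program
searchCode k = move rZ rFz ⨾ calc rE add rPar rFx ⨾ store rE rOne ⨾ loop rO rS rK (loop rI rJ rM (relaxCode k))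

-- The cycle is first collected in the guest's registers, which are no longer needed, because the
-- output registers overlap the constants that the trace still uses.
traceCode : ℕ → Program
traceCode zero    = skip
traceCode (suc j) =
  calc rE add rPar rU ⨾ load rU rE ⨾ calc rU sub rU rOne ⨾ load (guest (suc j)) rU ⨾ traceCode j

-- The ascending order matters for large `k`: register `guest (suc j)` lies above everything written
-- before it is read.
outputCode : ℕ → Program
outputCode zero    = skip
outputCode (suc j) = outputCode j ⨾ const (suc j) 0 ⨾ calc (suc j) add (suc j) (guest (suc j))

finishCode : ℕ → Program
finishCode k = cond rFound
  (searchCode k ⨾ calc rU add rFx rLen ⨾ traceCode k ⨾ outputCode k ⨾ const 0 1)
  (const 0 0)

searchCost finishCost : (k m : ℕ) → ℕ
searchCost k m = 3 + loopCost k (loopCost m (size (relaxCode k)))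
finishCost k m = suc (searchCost k m + (1 + (size (traceCode k) + (size (outputCode k) + 1))) + 1)

update-≢0 : ∀ {h : ℕ → ℕ} {i v a} → v ≢ 0 → h a ≢ 0 → (h [ i ↦ v ]) a ≢ 0
update-≢0 {i = i} {a = a} v≢ h≢ with i ≡ᵇ a
... | true  = v≢
... | false = h≢

bit-≢0 : ∀ {x y} → bit (x ≡ᵇ y) ≢ 0 → x ≡ y
bit-≢0 {x} {y} b with x ≡ᵇ y in e
... | true  = ≡ᵇ⇒≡ x y (subst T (sym e) tt)
... | false = contradiction refl b

bit-≡1 : ∀ {x y} → x ≡ y → bit (x ≡ᵇ y) ≡ 1
bit-≡1 {x} refl with x ≡ᵇ x in e
... | true  = refl
... | false = ⊥-elim (subst T e (≡⇒≡ᵇ x x refl))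

module Search (W m Tb P base cap N Wd k Z : ℕ) .{{Wd≢0 : NonZero Wd}} (low : ℕ → ℕ) where
  open Logic W
  open Colouring Wd k
  open Edges W m Tb P base cap N Wd k Z low
  open Paths m src dst act

  -- A level that rises by exactly one along every active edge. Hence all paths from `x` to its copy
  -- have `k` edges, their vertices are distinct, and parent pointers cannot form a loop although
  -- later relaxations overwrite them.
  lev : ℕ → ℕ → ℕ
  lev z y with y <? 2 + len
  ... | yes _ = colour z y
  ... | no  _ = colour z (y ∸ len) + k

  lev-label : ∀ z {y} → y < 2 + len → lev z y ≡ colour z y
  lev-label z {y} y< with y <? 2 + len
  ... | yes _ = refl
  ... | no ¬p = contradiction y< ¬p

  lev-copy : ∀ z {y} → 2 ≤ y → lev z (y + len) ≡ colour z y + k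
  lev-copy z {y} 2≤y with y + len <? 2 + len
  ... | yes p = contradiction (+-monoˡ-≤ len 2≤y) (<⇒≱ p)
  ... | no _  = cong (λ x → colour z x + k) (m+n∸n≡m y len)

  module Levels (tab : Table) where
    open Table tab

    wraps-cases : ∀ z i → (wraps z i ≡ 1 × colour z (tgt i) ≡ 1) ⊎ wraps z i ≡ 0
    wraps-cases z i with colour z (tgt i) ≡ᵇ 1 in e
    ... | true  = inj₁ (refl , ≡ᵇ⇒≡ (colour z (tgt i)) 1 (subst T (sym e) tt))
    ... | false = inj₂ refl

    lev-edge : ∀ {z i} → i < m → act z i ≢ 0 → lev z (dst z i) ≡ suc (lev z (src i))
    lev-edge {z} {i} i< a = trans (lev-dst (wraps-cases z i))
      (trans (sym (bit-≢0 {colour z (src i) + 1} a))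
        (trans (+-comm (colour z (src i)) 1) (cong suc (sym (lev-label z (proj₂ (src-range i i<)))))))
      where
      lev-dst : (wraps z i ≡ 1 × colour z (tgt i) ≡ 1) ⊎ wraps z i ≡ 0 → lev z (dst z i) ≡ colour z (tgt i) + wraps z i * k
      lev-dst (inj₁ (p , _)) rewrite p | *-identityˡ len | *-identityˡ k = lev-copy z (proj₁ (tgt-range i i<))
      lev-dst (inj₂ p) rewrite p | +-identityʳ (tgt i) | +-identityʳ (colour z (tgt i)) = lev-label z (proj₂ (tgt-range i i<))

    lev-path : ∀ {z x y} (p : Path z x y) → lev z y ≡ lev z x + steps p
    lev-path start = sym (+-identityʳ _)
    lev-path {z} {x} (extend p i< a) = trans (lev-edge i< a) (trans (cong suc (lev-path p)) (sym (+-suc (lev z x) (steps p))))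

    lev-at : ∀ {z x y} (p : Path z x y) i → i ≤ steps p → lev z (at p i) ≡ lev z x + i
    lev-at {z} p zero    i≤ = trans (cong (lev z) (at-0 p)) (sym (+-identityʳ _))
    lev-at {z} {x} p (suc i) i≤ = let e , e< , a , s , d = at-edge p i i≤ in
      trans (cong (lev z) d) (trans (lev-edge e< a) (trans (cong (suc ∘ lev z) (sym s))
        (trans (cong suc (lev-at p i (<⇒≤ i≤))) (sym (+-suc (lev z x) i)))))

  module _ (tab : Table) (parents : P + (2 + (len + len)) ≤ base) (base≤ : base ≤ 2 ^ W)
           (label-room : 2 + (len + len) + Wd < 2 ^ W) (k-room : k + k + 2 < 2 ^ W) (Z< : Z < 2 ^ W)
           (low-0 : ∀ y → y < 2 + (len + len) → low (P + y) ≡ 0) where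
    open Table tab
    open Levels tab

    P≤ : P ≤ 2 ^ W
    P≤ = ≤-trans (m≤m+n P _) (≤-trans parents base≤)

    module _ {z x : ℕ} (z< : z < Z) (2≤x : 2 ≤ x) (x< : x < 2 + len) where

      steps-k : (p : Path z x (x + len)) → steps p ≡ k
      steps-k p = +-cancelˡ-≡ (lev z x) (steps p) k
        (trans (sym (lev-path p)) (trans (lev-copy z 2≤x) (cong (_+ k) (sym (lev-label z x<)))))

      Y : ℕ
      Y = 2 + (len + len)

      P+y< : ∀ {y} → y < Y → P + y < base
      P+y< y< = <-≤-trans (+-monoʳ-< P y<) parents

      label<Y : ∀ {y} → y < 2 + len → y < Y
      label<Y y< = ≤-trans y< (+-monoʳ-≤ 2 (m≤m+n len len))

      y<2^ : ∀ {y} → y < Y → y < 2 ^ W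
      y<2^ {y} y< = <-≤-trans (≤-<-trans (m≤n+m y P) (P+y< y<)) base≤

      -- The trace relies on `back` to step from a marked cell to a marked parent. At `x` there may
      -- be no parent: its cell is set to 1 initially, merely as a mark.
      record Marks (μ : ℕ → ℕ) : Set where
        field
          low≡ : ∀ a → a < P → μ a ≡ low a
          back : ∀ y → y < Y → μ (P + y) ≢ 0 → Path z x y × (y ≡ x ⊎
            ∃[ i ] (i < m × act z i ≢ 0 × y ≡ dst z i × μ (P + y) ≡ src i + 1 × μ (P + src i) ≢ 0))

      -- What `p` full rounds guarantee; `Partial` is the progress of the next round after `i`
      -- edges.
      Complete : ℕ → (ℕ → ℕ) → Set
      Complete p μ = ∀ {y} (q : Path z x y) → steps q ≤ p → μ (P + y) ≢ 0

      Partial : ℕ → ℕ → (ℕ → ℕ) → Set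
      Partial p i μ = ∀ j → j < i → act z j ≢ 0 → (q : Path z x (src j)) → steps q ≤ p → μ (P + dst z j) ≢ 0

      record Searching (p i : ℕ) (o s : ℕ) (S : State) : Set where
        constructor searching
        field
          own′     : Own S
          z≡       : reg S rZ ≡ z
          x≡       : reg S rFx ≡ x
          o≡       : reg S rO ≡ o
          s≡       : reg S rS ≡ s
          marks    : Marks (mem S)
          complete : Complete p (mem S)
          partial  : Partial p i (mem S)

      searching-≋ : ∀ {p i o s S S′} → S′ ≋[ 19 ] S → Searching p i o s S → Searching p i o s S′
      searching-≋ S≋@(agree rs refl _) (searching O z x o s M C Q) =
        searching (own-≋ (m≤m+n 13 6) S≋ O) (trans (rs rZ _) z) (trans (rs rFx _) x) (trans (rs rO _) o) (trans (rs rS _) s) M C Q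

      relax-run : ∀ {p i o s S φ} → i < m → reg S rI ≡ i → Searching p i o s S →
        Run (relaxCode k) S φ (size (relaxCode k)) λ S′ φ′ →
          (reg S′ rI ≡ reg S rI × reg S′ rJ ≡ reg S rJ) × Searching p (suc i) o s S′
      relax-run {p} {i} {o} {s} {S} i< i≡ st =
        bind (edge-run tab P≤ label-room k-room (<⇒≤ Z<) (Searching.own′ st) (Marks.low≡ (Searching.marks st)) (Searching.z≡ st) i≡ i< z<)
          λ { {S₁} (refl , S≋ , u , v , a) → relax S₁ S≋ (searching-≋ (≋-weaken (m≤m+n 19 2) S≋) st) u v a }
        where
        sr = src-range i i<
        dr = dst-range z i i<
        skipped : ∀ {S₁} → Searching p i o s S₁ → (act z i ≢ 0 → (q : Path z x (src i)) → steps q ≤ p → mem S₁ (P + dst z i) ≢ 0) →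
          Searching p (suc i) o s S₁
        skipped {S₁} (searching O z x o s M C Q) f = searching O z x o s M C partial′
          where
          partial′ : Partial p (suc i) (mem S₁)
          partial′ j j< with j ≟ i
          ... | yes refl = f
          ... | no  j≢i  = Q j (≤∧≢⇒< (≤-pred j<) j≢i)
        stored : ∀ {S₁} r d → Searching p i o s S₁ → act z i ≢ 0 → mem S₁ (P + src i) ≢ 0 →
          Searching p (suc i) o s ⟨ reg S₁ [ rE ↦ r ] [ rD ↦ d ] , mem S₁ [ P + dst z i ↦ src i + 1 ] , coins S₁ ⟩
        stored {S₁} r d (searching O z≡ x≡ o≡ s≡ M C Q) a marked =
          searching (owning (own (own-≋ ≤-refl (≋-≔ rD (≋-≔ rE (≋-refl {S = S₁}))) O))) z≡ x≡ o≡ s≡ marks′ (λ q le → mono (C q le)) partial′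
          where
          μ μ′ : ℕ → ℕ
          μ = mem S₁
          μ′ = μ [ P + dst z i ↦ src i + 1 ]
          new≢0 : src i + 1 ≢ 0
          new≢0 e = 0≢1+n (sym (trans (+-comm 1 (src i)) e))
          mono : ∀ {b} → μ b ≢ 0 → μ′ b ≢ 0
          mono = update-≢0 {μ} {P + dst z i} new≢0
          marks′ : Marks μ′
          marks′ .Marks.low≡ b b< = trans (update-other μ _ (λ e → <⇒≱ b< (subst (P ≤_) e (m≤m+n P (dst z i))))) (Marks.low≡ M b b<)
          marks′ .Marks.back y y< m≢ with y ≟ dst z i
          ... | yes refl = extend (proj₁ (Marks.back M (src i) (label<Y (proj₂ sr)) marked)) i< a ,
                 inj₂ (i , i< , a , refl , update-same μ (P + dst z i) (src i + 1) , mono marked)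
          ... | no y≢ with update-other μ {P + dst z i} {P + y} (src i + 1) (λ e → y≢ (sym (+-cancelˡ-≡ P _ _ e)))
          ...   | same with Marks.back M y y< (λ e → m≢ (trans same e))
          ...     | q , inj₁ e = q , inj₁ e
          ...     | q , inj₂ (j , j< , a′ , e , val , marked′) = q , inj₂ (j , j< , a′ , e , trans same val , mono marked′)
          partial′ : Partial p (suc i) μ′
          partial′ j j< a′ q le with j ≟ i
          ... | yes refl = λ e → new≢0 (trans (sym (update-same μ (P + dst z i) (src i + 1))) e)
          ... | no  j≢i  = mono (Q j (≤∧≢⇒< (≤-pred j<) j≢i) a′ q le)
        relax : ∀ S₁ → S₁ ≋[ 21 ] S → Searching p i o s S₁ → reg S₁ rU ≡ src i → reg S₁ rV ≡ dst z i → reg S₁ rAct ≡ act z i → ∀ {φ} →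
          Run (cond rAct (calc rE add rPar rU ⨾ load rE rE ⨾ cond rE (calc rE add rU rOne ⨾ calc rD add rPar rV ⨾ store rD rE) skip) skip) S₁ φ 9
            λ S′ φ′ → (reg S′ rI ≡ reg S rI × reg S′ rJ ≡ reg S rJ) × Searching p (suc i) o s S′
        relax S₁ S≋ st₁ u v a = branch
          (λ a≢0 →
            by-add (own O 6 _) u (<-≤-trans (P+y< (label<Y (proj₂ sr))) base≤) ▹
            by-load refl refl ▹
            branch
              (λ marked →
                by-add u (own O 1 _) (≤-<-trans (≤-reflexive (+-comm (src i) 1))
                  (≤-<-trans (proj₂ sr) (≤-<-trans (≤-trans (+-monoʳ-≤ 2 (m≤m+n len len)) (m≤m+n _ Wd)) label-room))) ▹
                by-add (own O 6 _) v (<-≤-trans (P+y< (proj₂ dr)) base≤) ▹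
                instruction (by-store refl refl)
                  (kept , stored _ _ (searching-≋ (≋-≔ rE (≋-≔ rE (≋-refl {S = S₁}))) st₁) (λ e → a≢0 (trans a e)) marked))
              (λ unmarked → instruction skip
                (kept , searching-≋ (≋-≔ rE (≋-≔ rE (≋-refl {S = S₁})))
                  -- An unmarked source is not the end of a path of at most `p` edges, so this round
                  -- owes nothing for the edge.
                  (skipped st₁ λ _ q le → contradiction unmarked (Searching.complete st₁ q le)))))
          (λ a≡0 → instruction skip (kept , skipped st₁ λ a≢0 → contradiction (trans (sym a) a≡0) a≢0))
          where
          O = Searching.own′ st₁
          kept : reg S₁ rI ≡ reg S rI × reg S₁ rJ ≡ reg S rJ
          kept = _≋[_]_.regs S≋ rI _ , _≋[_]_.regs S≋ rJ _

      next-pass : ∀ {p o s S} → Searching p m o s S → Searching (suc p) 0 o s S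
      next-pass {p} {S = S} (searching O z≡ x≡ o≡ s≡ M C Q) = searching O z≡ x≡ o≡ s≡ M complete′ λ _ ()
        where
        complete′ : Complete (suc p) (mem S)
        complete′ start             le = C start z≤n
        complete′ (extend q i< a) le = Q _ i< a q (≤-pred le)

      m< : m < 2 ^ W
      m< = y<2^ (≤-<-trans (≤-trans (m≤m+n m m) (m≤m+n len len)) (m≤n+m (suc (len + len)) 1))

      pass-run : ∀ {p o s S φ} → Searching p 0 o s S →
        Run (loop rI rJ rM (relaxCode k)) S φ (loopCost m (size (relaxCode k))) λ S′ φ′ → Searching (suc p) 0 o s S′
      pass-run {p} {o} {s} {S} st = consequence
        (Loop.loop-rule refl refl refl refl refl refl m< (λ i j S φ → Searching p i o s S)
          (λ i j S φ e i≡ st → consequence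
            (relax-run (≤-trans (m≤m+n (suc i) j) (≤-reflexive (trans (sym (+-suc i j)) e))) i≡ (searching-≋ (≋-≔ rJ (≋-refl {S = S})) st))
            λ {S′} ((i′ , j′) , st′) → trans i′ i≡ , j′ , own (Searching.own′ st′) 1 _ , searching-≋ (≋-≔ rI (≋-refl {S = S′})) st′)
          (own (Searching.own′ st) 0 _) (own (Searching.own′ st) 1 _) (own (Searching.own′ st) 3 _)
          (searching-≋ (≋-≔ rJ (≋-≔ rI (≋-refl {S = S}))) st))
        next-pass

      k< : k < 2 ^ W
      k< = ≤-<-trans (≤-trans (m≤m+n k k) (m≤m+n (k + k) 2)) k-room

      search-run : ∀ {S φ} → Own S → (∀ a → a < base → mem S a ≡ low a) → reg S rFz ≡ z → reg S rFx ≡ x →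
        Run (searchCode k) S φ (searchCost k m) λ S′ φ′ → Own S′ × reg S′ rFx ≡ x × Marks (mem S′) × Complete k (mem S′)
      search-run {S} O low≡ z≡ x≡ =
        by-move z≡ (own O 0 _) (<-trans z< Z<) ▹
        by-add (own O 6 _) x≡ (<-≤-trans (P+y< (label<Y x<)) base≤) ▹
        by-store refl (own O 1 _) ▹
        consequence
          (Loop.loop-rule refl refl refl refl refl refl k< (λ i j S φ → Searching i 0 i j S)
            (λ i j S φ e i≡ st → consequence
              (pass-run {s = j} (searching-S st))
              λ {S′} st′ → Searching.o≡ st′ , Searching.s≡ st′ , own (Searching.own′ st′) 1 _ , next-O st′)
            (own O 0 _) (own O 1 _) (own O 11 _) first)
          λ st → Searching.own′ st , Searching.x≡ st , Searching.marks st , Searching.complete st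
        where
        searching-S : ∀ {p i o s s′ S} → Searching p i o s S → Searching p i o s′ (S ≔ (rS , s′))
        searching-S {S = S} (searching O z x o s M C Q) =
          searching (owning (own (own-≋ ≤-refl (≋-≔ rS (≋-refl {S = S})) O))) z x o refl M C Q
        next-O : ∀ {p i o o′ s S} → Searching p i o s S → Searching p i o′ s (S ≔ (rO , o′))
        next-O {S = S} (searching O z x o s M C Q) =
          searching (owning (own (own-≋ ≤-refl (≋-≔ rO (≋-refl {S = S})) O))) z x refl s M C Q
        μ₀ : ℕ → ℕ
        μ₀ = mem S [ P + x ↦ 1 ]
        marks₀ : Marks μ₀
        marks₀ .Marks.low≡ a a< = trans (update-other (mem S) 1 (λ e → <⇒≱ a< (subst (P ≤_) e (m≤m+n P x))))
          (low≡ a (<-≤-trans a< (≤-trans (m≤m+n P Y) parents)))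
        marks₀ .Marks.back y y< m≢ with y ≟ x
        ... | yes refl = start , inj₁ refl
        ... | no  y≢x  = contradiction
          (trans (update-other (mem S) 1 (λ e → y≢x (sym (+-cancelˡ-≡ P _ _ e)))) (trans (low≡ _ (P+y< y<)) (low-0 y y<))) m≢
        complete₀ : Complete 0 μ₀
        complete₀ start le e = contradiction (trans (sym (update-same (mem S) (P + x) 1)) e) λ ()
        first : Searching 0 0 0 k (⟨ reg S [ rZ ↦ z ] [ rE ↦ P + x ] , μ₀ , coins S ⟩ ≔ (rO , 0) ≔ (rS , k))
        first = searching (owning (own (own-≋ ≤-refl (≋-≔ rS (≋-≔ rO (≋-≔ rE (≋-≔ rZ (≋-refl {S = S}))))) O)))
          refl x≡ refl refl marks₀ complete₀ λ _ ()

      Traced : ℕ → State → (S : State) → ℕ → Set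
      Traced j S S′ y = ∃[ q ] (steps {z} {x} {y} q ≡ j × (∀ i → i < j → reg S′ (guest (suc i)) ≡ low (at q i)) ×
        (∀ r → j < r → reg S′ (guest r) ≡ reg S (guest r)))

      -- The level of `y` tells how many steps remain. So `x` cannot be met too early, and after the
      -- last step any path from `x` to `y` has no edges.
      trace-run : ∀ j {S φ y} → Own S → Marks (mem S) → reg S rU ≡ y → y < Y → mem S (P + y) ≢ 0 → lev z y ≡ lev z x + j →
        Run (traceCode j) S φ (size (traceCode j)) λ S′ φ′ → Traced j S S′ y
      trace-run zero {S} {y = y} O M u y< m≢ l = instruction skip (q , q-steps , (λ _ ()) , λ _ _ → refl)
        where
        q : Path z x y
        q = proj₁ (Marks.back M y y< m≢)
        q-steps : steps q ≡ 0
        q-steps = +-cancelˡ-≡ (lev z x) (steps q) 0 (trans (sym (lev-path q)) l)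
      trace-run (suc j) {S} {φ} {y} O M u y< m≢ l with Marks.back M y y< m≢
      ... | _ , inj₁ refl = contradiction (+-cancelˡ-≡ (lev z x) 0 (suc j) (trans (+-identityʳ _) l)) λ ()
      ... | _ , inj₂ (i , i< , a , refl , val , marked) =
        by-add (own O 6 _) u (<-≤-trans (P+y< y<) base≤) ▹
        by-load refl val ▹
        by-sub refl (own O 1 _) (m≤n+m 1 (src i)) (≤-<-trans (≤-reflexive (+-comm (src i) 1))
          (≤-<-trans (proj₂ sr) src-room)) ▹
        by-load refl (Marks.low≡ M _ (subst (_< P) (sym (m+n∸n≡m (src i) 1)) src<P)) ▹
        consequence
          (trace-run j {y = src i} (owning (own O₄)) M (m+n∸n≡m (src i) 1) (label<Y (proj₂ sr)) marked (suc-injective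
            (trans (sym (lev-edge i< a)) (trans l (+-suc (lev z x) j)))))
          λ {S′} (q , q≡ , vals , others) → extend q i< a , cong suc q≡ ,
            (λ i′ i′< → extended {S′} q q≡ vals others i′ i′<) ,
            λ r j<r → trans (others r (<-trans (n<1+n j) j<r)) (update-other (reg S₃) _ λ e → <⇒≢ j<r (guest-injective e))
        where
        sr = src-range i i<
        src-room : 2 + len < 2 ^ W
        src-room = ≤-<-trans (≤-trans (+-monoʳ-≤ 2 (m≤m+n len len)) (m≤m+n Y Wd)) label-room
        src<P : src i < P
        src<P = <-≤-trans (proj₂ sr) input≤
        S₃ : State
        S₃ = S ≔ (rE , P + dst z i) ≔ (rU , src i + 1) ≔ (rU , src i + 1 ∸ 1)
        O₄ : Own (S₃ ≔ (guest (suc j) , low (src i + 1 ∸ 1)))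
        O₄ = owning λ r h → trans (update-other (reg S₃) _ (guest≢ r h))
          (own (own-≋ ≤-refl (≋-≔ rU (≋-≔ rU (≋-≔ rE (≋-refl {S = S})))) O) r h)
          where
          guest≢ : ∀ r → T (r <ᵇ 13) → guest (suc j) ≢ r
          guest≢ r h e = <⇒≱ (<ᵇ⇒< r 13 h) (subst (13 ≤_) e (m≤m+n 13 (19 + suc j)))
        guest-injective : ∀ {a b} → guest a ≡ guest b → a ≡ b
        guest-injective = +-cancelˡ-≡ 32 _ _
        extended : ∀ {S′} (q : Path z x (src i)) → steps q ≡ j → (∀ i → i < j → reg S′ (guest (suc i)) ≡ low (at q i)) →
          (∀ r → j < r → reg S′ (guest r) ≡ reg (S₃ ≔ (guest (suc j) , low (src i + 1 ∸ 1))) (guest r)) →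
          ∀ i′ → i′ < suc j → reg S′ (guest (suc i′)) ≡ low (at (extend q i< a) i′)
        extended q refl vals others i′ i′< with i′ ≟ j
        ... | no  ne   = trans (vals i′ (≤∧≢⇒< (≤-pred i′<) ne)) (cong low (sym (at-extend {i = i} q {i<} {a} (≤-pred i′<))))
        ... | yes refl = trans (others (suc j) ≤-refl) (trans (update-same (reg S₃) (guest (suc j)) _)
          (cong low (trans (m+n∸n≡m (src i) 1) (trans (sym (at-steps q)) (sym (at-extend {i = i} q {i<} {a} ≤-refl))))))

      at-label : ∀ {y} (q : Path z x y) i → i < steps q → 2 ≤ at q i × at q i < 2 + len
      at-label q i i< = let e , e< , _ , s , _ = at-edge q i i< in subst (λ v → 2 ≤ v × v < 2 + len) (sym s) (src-range e e<)

      low< : ∀ {p} → 2 ≤ p → p < 2 + len → low p < 2 ^ W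
      low< {p} 2≤p p< = <-≤-trans (≤-<-trans (m≤n+m (low p) Tb) (proj₁ (table-range p 2≤p p<))) P≤

      output-run : ∀ j {S φ} → (∀ i → i < j → reg S (guest (suc i)) < 2 ^ W) →
        Run (outputCode j) S φ (size (outputCode j)) λ S′ φ′ →
          (∀ i → i < j → reg S′ (suc i) ≡ reg S (guest (suc i))) × (∀ r → j < r → reg S′ r ≡ reg S r)
      output-run zero v< = instruction skip ((λ _ ()) , λ _ _ → refl)
      output-run (suc j) {S} v< = bind (output-run j (λ i i< → v< i (m<n⇒m<1+n i<))) λ {S₁} (done , others) →
        by-const (m^n>0 2 W) ▹
        instruction (by-add (update-same (reg S₁) (suc j) 0)
            (trans (update-other (reg S₁) 0 (<⇒≢ (s≤s (m<n+m j (s≤s z≤n))))) (others (guest (suc j)) (m<n+m j (s≤s z≤n)))) (v< j ≤-refl))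
          ((λ i i< → outputs S₁ done i i<) ,
           (λ r j<r → trans (update-other (reg (S₁ ≔ (suc j , 0))) _ (<⇒≢ j<r))
             (trans (update-other (reg S₁) 0 (<⇒≢ j<r)) (others r (<-trans (n<1+n j) j<r)))))
        where
        outputs : ∀ S₁ → (∀ i → i < j → reg S₁ (suc i) ≡ reg S (guest (suc i))) →
          ∀ i → i < suc j → reg (S₁ ≔ (suc j , 0) ≔ (suc j , reg S (guest (suc j)))) (suc i) ≡ reg S (guest (suc i))
        outputs S₁ done i i< with i ≟ j
        ... | yes refl = update-same (reg (S₁ ≔ (suc j , 0))) (suc j) _
        ... | no ne = trans (update-other (reg (S₁ ≔ (suc j , 0))) _ (λ e → ne (sym (suc-injective e))))
          (trans (update-other (reg S₁) 0 (λ e → ne (sym (suc-injective e)))) (done i (≤∧≢⇒< (≤-pred i<) ne)))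

      found-run : ∀ {S φ} → Own S → (∀ a → a < base → mem S a ≡ low a) → reg S rFz ≡ z → reg S rFx ≡ x →
        ¬ ¬ Path z x (x + len) →
        Run (searchCode k ⨾ calc rU add rFx rLen ⨾ traceCode k ⨾ outputCode k ⨾ const 0 1) S φ
            (searchCost k m + (1 + (size (traceCode k) + (size (outputCode k) + 1)))) λ S′ φ′ →
          reg S′ 0 ≡ 1 × ∃[ q ] (steps {z} {x} {x + len} q ≡ k × (∀ i → i < k → reg S′ (suc i) ≡ low (at q i)))
      found-run O low≡ z≡ x≡ ¬¬path =
        bind (search-run O low≡ z≡ x≡) λ {S₁} (O₁ , x≡₁ , M , C) →
          by-add x≡₁ (own O₁ 4 _) (y<2^ x+len<Y) ▹
          bind (trace-run k {y = x + len} (owning (own (own-≋ {S = S₁} ≤-refl (≋-≔ rU (≋-refl {S = S₁})) O₁))) M refl x+len<Y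
                 -- A doubly negated path suffices to show that the cell of the copy is nonzero,
                 -- since this is a negation. From here on the trace yields an actual path.
                 (λ e → ¬¬path λ q → C q (≤-reflexive (steps-k q)) e)
                 (trans (lev-copy z 2≤x) (cong (_+ k) (sym (lev-label z x<)))))
            λ {S₂} (q , q≡ , vals , _) →
              bind (output-run k {S = S₂} λ i i< → subst (_< 2 ^ W) (sym (vals i i<)) (value< q q≡ i i<))
                λ {S₃} (outs , _) → instruction (by-const (≤-trans (s≤s (s≤s z≤n)) 2≤))
                  (refl , q , q≡ , λ i i< → trans (outs i i<) (vals i i<))
        where
        2≤ : 2 ≤ 2 ^ W
        2≤ = ≤-trans (m≤n+m 2 (k + k)) (<⇒≤ k-room)
        x+len<Y : x + len < Y
        x+len<Y = +-monoˡ-≤ len x<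
        value< : (q : Path z x (x + len)) → steps q ≡ k → ∀ i → i < k → low (at q i) < 2 ^ W
        value< q q≡ i i< = let 2≤p , p< = at-label q i (subst (i <_) (sym q≡) i<) in low< 2≤p p<

-- Initialization

-- The number of vertices, the guest's modulus and the base of the colourings advance together from
-- `2 ^ j`, `2 ^ (c * suc j)` and `j + j` to their values for `suc j`, so no logarithm has to be
-- computed.
growCode : Program
growCode = calc rE lt rN rC ⨾ cond rE (calc rN add rN rN ⨾ calc rMod mul rMod rF ⨾ calc rWidth add rWidth rTwo) skip

powerCode : ℕ → Program
powerCode zero    = skip
powerCode (suc j) = calc rZs mul rWidth rZs ⨾ powerCode j

tableCode : Program
tableCode = calc rE add rI rTwo ⨾ load rD rE ⨾ calc rD add rTable rD ⨾ store rD rE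

initCode : (c k : ℕ) → Program
initCode c k =
  const rOne 1 ⨾ const rTwo 2 ⨾ const rK k ⨾ load rM rOne ⨾ load rD rZero ⨾
  calc rLen add rM rM ⨾ calc rTable add rLen rTwo ⨾ calc rPar add rTable rD ⨾
  -- The values for `j = 2`, where `exponent` starts; `rF` holds the factor by which the modulus
  -- grows.
  const rN 4 ⨾ const rMod (2 ^ (c * 3)) ⨾ const rWidth 4 ⨾ const rF (2 ^ c) ⨾
  calc rC add rLen rLen ⨾ calc rC add rC rN ⨾
  loop rI rJ rM growCode ⨾
  calc rBase add rPar rN ⨾ const rZs 1 ⨾ powerCode (k * k) ⨾
  loop rI rJ rLen tableCode ⨾
  -- The guest starts from the empty graph, whose encoding is the number of vertices followed by
  -- zeros. One cell therefore sets up its input, reduced to a guest word as in `initial`.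
  calc rE rem rN rMod ⨾ store rBase rE

initCost : (k m : ℕ) → ℕ
initCost k m = 14 + (loopCost m (size growCode) + (2 + (size (powerCode (k * k)) + (loopCost (m + m) (size tableCode) + 2))))

-- For i large enough, 2 ^ exponent X i is the least power of two that is at least 4 and X.
grow : Bool → ℕ → ℕ
grow b j = if b then suc j else j

exponent : (X i : ℕ) → ℕ
exponent X zero    = 2
exponent X (suc i) = grow (2 ^ exponent X i <ᵇ X) (exponent X i)

j≤grow : ∀ b j → j ≤ grow b j
j≤grow true  j = n≤1+n j
j≤grow false j = ≤-refl

exponent-mono : ∀ X {i j} → i ≤ j → exponent X i ≤ exponent X j
exponent-mono X {i} {zero}  z≤n = ≤-refl
exponent-mono X {i} {suc j} i≤ with i ≟ suc j
... | yes refl = ≤-refl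
... | no  ne   = ≤-trans (exponent-mono X (≤-pred (≤∧≢⇒< i≤ ne))) (j≤grow (2 ^ exponent X j <ᵇ X) (exponent X j))

-- Doubling takes place only below `X`.
exponent-upper : ∀ X i → 4 ≤ X → 2 ^ exponent X i ≤ 2 * X
exponent-upper X zero 4≤ = ≤-trans 4≤ (m≤m+n X (X + 0))
exponent-upper X (suc i) 4≤ with 2 ^ exponent X i <ᵇ X in e
... | true  = *-monoʳ-≤ 2 (<⇒≤ (<ᵇ⇒< (2 ^ exponent X i) X (subst T (sym e) tt)))
... | false = exponent-upper X i 4≤

exponent-reached : ∀ X i → X ≤ 2 ^ exponent X i ⊎ exponent X i ≡ 2 + i
exponent-reached X zero = inj₂ refl
exponent-reached X (suc i) with 2 ^ exponent X i <ᵇ X in e | exponent-reached X i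
... | false | _      = inj₁ (≮⇒≥ λ lt′ → subst T e (<⇒<ᵇ lt′))
... | true  | inj₂ p = inj₂ (cong suc p)
... | true  | inj₁ p = contradiction p (<⇒≱ (<ᵇ⇒< (2 ^ exponent X i) X (subst T (sym e) tt)))

n<2^n : ∀ n → n < 2 ^ n
n<2^n zero    = s≤s z≤n
n<2^n (suc n) = ≤-trans (+-mono-≤ (m^n>0 2 n) (n<2^n n)) (≤-reflexive (cong (2 ^ n +_) (sym (+-identityʳ (2 ^ n)))))

-- `m` rounds are enough: if all of them doubled, the value is `2 ^ (2 + m)`, which is at least
-- `4 * suc m`.
exponent-lower : ∀ m → 4 + 4 * m ≤ 2 ^ exponent (4 + 4 * m) m
exponent-lower m with exponent-reached (4 + 4 * m) m
... | inj₁ p = p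
... | inj₂ p rewrite p = begin
  4 + 4 * m       ≡⟨ sym (*-suc 4 m) ⟩
  4 * suc m       ≤⟨ *-monoʳ-≤ 4 (n<2^n m) ⟩
  4 * 2 ^ m       ≡⟨ *-assoc 2 2 (2 ^ m) ⟩
  2 ^ (2 + m) ∎
  where open ≤-Reasoning

-- The contents of the memory after the first i positions of the edge list have
-- been entered into the table.
fill : (μ : ℕ → ℕ) (Tb i : ℕ) → ℕ → ℕ
fill μ Tb zero    = μ
fill μ Tb (suc i) = fill μ Tb i [ Tb + fill μ Tb i (i + 2) ↦ i + 2 ]

module Filled (μ : ℕ → ℕ) (n len : ℕ) (endpoint< : ∀ p → 2 ≤ p → p < 2 + len → μ p < n) where

  private
    Tb = len + 2

  fill-input : ∀ i {a} → a < Tb → fill μ Tb i a ≡ μ a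
  fill-input zero    a< = refl
  fill-input (suc i) {a} a< = trans
    (update-other (fill μ Tb i) (i + 2) (λ e → <⇒≱ a< (subst (Tb ≤_) e (m≤m+n Tb _)))) (fill-input i a<)

  position< : ∀ {i} → i < len → i + 2 < Tb
  position< = +-monoˡ-< 2

  endpoint-at : ∀ {i} → i < len → μ (i + 2) < n
  endpoint-at {i} i< = endpoint< (i + 2) (m≤n+m 2 i) (subst (i + 2 <_) (+-comm len 2) (position< i<))

  fill-above : ∀ i {a} → i ≤ len → Tb + n ≤ a → fill μ Tb i a ≡ μ a
  fill-above zero    i≤ ≤a = refl
  fill-above (suc i) {a} i≤ ≤a = trans (update-other (fill μ Tb i) (i + 2) differ) (fill-above i (<⇒≤ i≤) ≤a)
    where
    differ : Tb + fill μ Tb i (i + 2) ≢ a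
    differ e = <⇒≱ (+-monoʳ-< Tb (subst (_< n) (sym (fill-input i (position< i≤))) (endpoint-at i≤))) (subst (Tb + n ≤_) (sym e) ≤a)

  -- A later occurrence of the same vertex overwrites its entry, but the new entry is again a
  -- position of that vertex; in the end the label is the last occurrence.
  fill-table : ∀ i → i ≤ len → ∀ p → p < i →
    let l = fill μ Tb i (Tb + μ (p + 2)) in 2 ≤ l × l < 2 + i × μ l ≡ μ (p + 2)
  fill-table (suc i) i≤ p p< rewrite fill-input i (position< i≤) with μ (i + 2) ≟ μ (p + 2)
  ... | yes e rewrite sym e | update-same (fill μ Tb i) (Tb + μ (i + 2)) (i + 2) =
    m≤n+m 2 i , ≤-reflexive (cong suc (+-comm i 2)) , refl
  ... | no ne rewrite update-other (fill μ Tb i) (i + 2) (λ e → ne (+-cancelˡ-≡ Tb (μ (i + 2)) (μ (p + 2)) e))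
    with fill-table i (<⇒≤ i≤) p (≤∧≢⇒< (≤-pred p<) λ { refl → ne refl })
  ...   | 2≤ , below , same = 2≤ , m<n⇒m<1+n below , same


module Init (W c k n m n′ : ℕ) (μ : ℕ → ℕ) (cs : List Bool) where

  open Logic W

  len Tb P X J base Wd Z w : ℕ
  len  = m + m
  Tb   = len + 2
  P    = Tb + n
  X    = len + len + 4
  J    = exponent X m
  base = P + suc n′
  Wd   = J + J
  Z    = Wd ^ (k * k)
  w    = c * suc J

  module _ (N≡ : suc n′ ≡ 2 ^ J) (μ-n : μ 0 ≡ n) (μ-m : μ 1 ≡ m) (endpoint< : ∀ p → 2 ≤ p → p < 2 + len → μ p < n)
           (fits : base + 2 ^ w ≤ 2 ^ W) (X≤N : X ≤ 2 ^ J) (Z< : Z < 2 ^ W) (Wd< : Wd < 2 ^ W) (k< : k < 2 ^ W) where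

    private
      low<base : ∀ {x} → x ≤ base → x < 2 ^ W
      low<base x≤ = ≤-<-trans x≤ (<-≤-trans (m<m+n base (m^n>0 2 w)) fits)
      N<base : ∀ {x} → x ≤ 2 ^ J → x < 2 ^ W
      N<base x≤ = low<base (≤-trans x≤ (≤-trans (≤-reflexive (sym N≡)) (m≤n+m (suc n′) P)))
      X< : X < 2 ^ W
      X< = N<base X≤N
      4< : 4 < 2 ^ W
      4< = ≤-<-trans (m≤n+m 4 (len + len)) X<
      P≤base : P ≤ base
      P≤base = m≤m+n P (suc n′)
      2^w< : 2 ^ w < 2 ^ W
      2^w< = <-≤-trans (m<n+m (2 ^ w) (≤-trans (s≤s z≤n) (m≤n+m (suc n′) P))) fits
      2≤ : 2 ≤ 2 ^ W
      2≤ = ≤-trans (s≤s (s≤s z≤n)) (<⇒≤ 4<)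

    open Filled μ n len endpoint<

    Base : State → Set
    Base S = reg S rZero ≡ 0 × reg S rOne ≡ 1 × reg S rTwo ≡ 2 × reg S rM ≡ m × reg S rLen ≡ len × reg S rTable ≡ Tb ×
      reg S rPar ≡ P × reg S rK ≡ k × reg S rFound ≡ 0 × (∀ r → reg S (guest r) ≡ 0) × coins S ≡ cs

    Size : ℕ → State → Set
    Size j S = reg S rN ≡ 2 ^ j × reg S rMod ≡ 2 ^ (c * suc j) × reg S rWidth ≡ j + j

    Growing : ℕ → State → Set
    Growing i S = Base S × Size (exponent X i) S × reg S rC ≡ X × reg S rF ≡ 2 ^ c × mem S ≡ μ

    grow-run : ∀ {i S φ} → i < m → Growing i S →
      Run growCode S φ (size growCode) λ S′ φ′ → (reg S′ rI ≡ reg S rI × reg S′ rJ ≡ reg S rJ) × Growing (suc i) S′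
    grow-run {i} {S} i< (B@(_ , _ , two , _) , (N , M , V) , x , f , μ≡) =
      by-lt N x 2≤ ▹ step-up (2 ^ exponent X i <ᵇ X) (exponent-mono X i<)
      where
      j = exponent X i
      step-up : ∀ b → grow b j ≤ J → ∀ {φ} →
        Run (cond rE (calc rN add rN rN ⨾ calc rMod mul rMod rF ⨾ calc rWidth add rWidth rTwo) skip) (S ≔ (rE , bit b)) φ 5
          λ S′ φ′ → (reg S′ rI ≡ reg S rI × reg S′ rJ ≡ reg S rJ) × (Base S′ × Size (grow b j) S′ × reg S′ rC ≡ X × reg S′ rF ≡ 2 ^ c × mem S′ ≡ μ)
      step-up false _ = branch {B = 3} (λ ne → contradiction refl ne) λ _ → instruction skip ((refl , refl) , B , (N , M , V) , x , f , μ≡)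
      step-up true  j≤ = branch
        (λ _ → by-add N N (subst (_< 2 ^ W) (sym double) (N<base (^-monoʳ-≤ 2 j≤))) ▹
               by-mul M f (subst (_< 2 ^ W) (sym raise) (≤-<-trans (^-monoʳ-≤ 2 (*-monoʳ-≤ c (s≤s j≤))) 2^w<)) ▹
               instruction (by-add V two (≤-<-trans (≤-trans (≤-reflexive widen) (+-mono-≤ j≤ j≤)) Wd<))
                 ((refl , refl) , B , (double , raise , widen) , x , f , μ≡))
        (λ ())
        where
        double : 2 ^ j + 2 ^ j ≡ 2 ^ suc j
        double = cong (2 ^ j +_) (sym (+-identityʳ (2 ^ j)))
        raise : 2 ^ (c * suc j) * 2 ^ c ≡ 2 ^ (c * suc (suc j))
        raise = trans (sym (^-distribˡ-+-* 2 (c * suc j) c)) (cong (2 ^_) (trans (+-comm (c * suc j) c) (sym (*-suc c (suc j)))))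
        widen : j + j + 2 ≡ suc j + suc j
        widen = trans (+-comm (j + j) 2) (cong suc (sym (+-suc j j)))

    Sized : State → Set
    Sized S = Base S × Size J S × reg S rBase ≡ base

    power-run : ∀ j {a S φ} → Wd ^ j * a < 2 ^ W → Sized S → reg S rZs ≡ a → mem S ≡ μ →
      Run (powerCode j) S φ (size (powerCode j)) λ S′ φ′ → Sized S′ × reg S′ rZs ≡ Wd ^ j * a × mem S′ ≡ μ
    power-run zero {a} b C z μ≡ = instruction skip (C , trans z (sym (+-identityʳ a)) , μ≡)
    power-run (suc j) {a} b C@(_ , (_ , _ , V) , _) z μ≡ =
      by-mul V z (≤-<-trans (≤-trans (m≤n*m (Wd * a) (Wd ^ j) {{Wd^≢0}}) (≤-reflexive (sym assoc))) b) ▹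
      consequence (power-run j (subst (_< 2 ^ W) assoc b) C refl μ≡)
        λ (C , z , μ≡) → C , trans z (sym assoc) , μ≡
      where
      Wd^≢0 : NonZero (Wd ^ j)
      Wd^≢0 = m^n≢0 Wd j {{>-nonZero (≤-trans (≤-trans (s≤s z≤n) (exponent-mono X {0} {m} z≤n)) (m≤m+n J J))}}
      assoc : Wd ^ suc j * a ≡ Wd ^ j * (Wd * a)
      assoc = trans (cong (_* a) (*-comm Wd (Wd ^ j))) (*-assoc (Wd ^ j) Wd a)

    Tabled : ℕ → State → Set
    Tabled i S = Sized S × reg S rZs ≡ Z × mem S ≡ fill μ Tb i

    table-run : ∀ {i S φ} → i < len → reg S rI ≡ i → Tabled i S →
      Run tableCode S φ (size tableCode) λ S′ φ′ → (reg S′ rI ≡ reg S rI × reg S′ rJ ≡ reg S rJ) × Tabled (suc i) S′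
    table-run {i} {S} i< i≡ (C@((_ , _ , two , _ , _ , tb , _) , _) , z , refl) =
      by-add i≡ two (low<base (≤-trans (<⇒≤ (position< i<)) (≤-trans (m≤m+n Tb n) P≤base))) ▹
      by-load refl refl ▹
      by-add tb refl (low<base (≤-trans (+-monoʳ-≤ Tb (<⇒≤ (subst (_< n) (sym (fill-input i (position< i<))) (endpoint-at i<)))) P≤base)) ▹
      instruction (by-store refl refl) ((refl , refl) , C , z , refl)

    record Ready (S : State) : Set where
      field
        constants-ready : ∀ r → T (r <ᵇ 13) → reg S r ≡ constants m Tb P base (2 ^ w) (suc n′) Wd k Z r
        found-0         : reg S rFound ≡ 0
        guests-0        : ∀ r → reg S (guest r) ≡ 0
        memory          : mem S ≡ fill μ Tb len [ base ↦ wrap w (suc n′) ]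
        coins-kept      : coins S ≡ cs

    init-run : ∀ {φ} → Run (initCode c k) ⟨ (λ _ → 0) , μ , cs ⟩ φ (initCost k m) λ S _ → Ready S
    init-run {φ} =
      by-const 2≤ ▹
      by-const (<-trans (s≤s (s≤s (s≤s z≤n))) 4<) ▹
      by-const k< ▹
      by-load refl μ-m ▹
      by-load refl μ-n ▹
      by-add refl refl (low<base (≤-trans (≤-trans (m≤m+n len 2) (m≤m+n Tb n)) P≤base)) ▹
      by-add refl refl (low<base (≤-trans (m≤m+n Tb n) P≤base)) ▹
      by-add refl refl (low<base P≤base) ▹
      by-const 4< ▹
      by-const (≤-<-trans (^-monoʳ-≤ 2 (*-monoʳ-≤ c (s≤s (exponent-mono X {0} {m} z≤n)))) 2^w<) ▹
      by-const 4< ▹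
      by-const (≤-<-trans (^-monoʳ-≤ 2 (m≤m*n c (suc J))) 2^w<) ▹
      by-add refl refl (≤-<-trans (m≤m+n (len + len) 4) X<) ▹
      by-add refl refl X< ▹
      bind (Loop.loop-rule refl refl refl refl refl refl (low<base (≤-trans (m≤m+n m m) len≤base))
             (λ i j S _ → Growing i S)
             (λ i j S φ e i≡ G → consequence (grow-run (≤-trans (m≤m+n (suc i) j) (≤-reflexive (trans (sym (+-suc i j)) e))) G)
                λ { {S′} ((i′ , j′) , G′@((_ , one , _) , _)) → trans i′ i≡ , j′ , one , G′ })
             refl refl refl
             ((refl , refl , refl , refl , refl , refl , refl , refl , refl , (λ _ → refl) , refl) , (refl , refl , refl) , refl , refl , refl))
        λ { {S₁} (B@(_ , _ , _ , _ , _ , _ , p , _) , Sz@(N , _) , _ , _ , μ≡) →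
          by-add p (trans N (sym N≡)) (low<base ≤-refl) ▹
          by-const (≤-trans (s≤s (s≤s z≤n)) 2≤) ▹
          bind (power-run (k * k) {1} {S₁ ≔ (rBase , base) ≔ (rZs , 1)} (subst (_< 2 ^ W) (sym (*-identityʳ Z)) Z<) (B , Sz , refl) refl μ≡)
            λ { {S₂} (C@((zero′ , one′ , _ , _ , len′ , _) , _) , z , μ≡) →
              bind (Loop.loop-rule refl refl refl refl refl refl (low<base len≤base)
                     (λ i j S _ → Tabled i S)
                     (λ i j S φ e i≡ G → consequence (table-run (≤-trans (m≤m+n (suc i) j) (≤-reflexive (trans (sym (+-suc i j)) e))) i≡ G)
                       λ { {S′} ((i′ , j′) , G′@(((_ , one , _) , _) , _)) → trans i′ i≡ , j′ , one , G′ })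
                     zero′ one′ len′ (C , trans z (*-identityʳ Z) , μ≡))
                λ { {S₃} T → finish S₃ T } } }
      where
      len≤base : len ≤ base
      len≤base = ≤-trans (m≤m+n len 2) (≤-trans (m≤m+n Tb n) P≤base)
      finish : ∀ S → Tabled len S → ∀ {φ} → Run (calc rE rem rN rMod ⨾ store rBase rE) S φ 2 λ S′ _ → Ready S′
      finish S (((zero′ , one′ , two′ , m′ , len′ , tb′ , p′ , k′ , f′ , g′ , cs′) , (N , M , V) , b′) , z′ , μ≡) =
        by-calc (trans N (sym N≡)) M (evalOp-rem-2^ w≤W (suc n′)) ▹
        instruction (by-store {x = base} b′ refl) record
          { constants-ready = ready ; found-0 = f′ ; guests-0 = g′ ; memory = cong (λ h → h [ base ↦ wrap w (suc n′) ]) μ≡ ; coins-kept = cs′ }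
        where
        w≤W : w ≤ W
        w≤W = ≮⇒≥ λ W<w → <⇒≱ 2^w< (^-monoʳ-≤ 2 (<⇒≤ W<w))
        ready : ∀ r → T (r <ᵇ 13) → reg (S ≔ (rE , wrap w (suc n′))) r ≡ constants m Tb P base (2 ^ w) (suc n′) Wd k Z r
        ready 0 _ = zero′
        ready 1 _ = one′
        ready 2 _ = two′
        ready 3 _ = m′
        ready 4 _ = len′
        ready 5 _ = tb′
        ready 6 _ = p′
        ready 7 _ = b′
        ready 8 _ = M
        ready 9 _ = trans N (sym N≡)
        ready 10 _ = V
        ready 11 _ = k′
        ready 12 _ = z′

-- Cycles of the input graph

flatten : ∀ {n} → List (Edge n) → List ℕ
flatten = concatMap (λ (u , v) → toℕ u ∷ toℕ v ∷ [])

flatten-lookup : ∀ {n} (E : List (Edge n)) i → let (u , v) = lookup E i in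
  wordAt (flatten E) (toℕ i + toℕ i) ≡ toℕ u × wordAt (flatten E) (toℕ i + toℕ i + 1) ≡ toℕ v
flatten-lookup (e ∷ E) zero = refl , refl
flatten-lookup (e ∷ E) (suc i) rewrite +-suc (toℕ i) (toℕ i) = flatten-lookup E i

flatten-above : ∀ {n} (E : List (Edge n)) a → length E + length E ≤ a → wordAt (flatten E) a ≡ 0
flatten-above []      a             _  = refl
flatten-above (e ∷ E) (suc zero)    ≤a rewrite +-suc (length E) (length E) = contradiction ≤a λ { (s≤s ()) }
flatten-above (e ∷ E) (suc (suc a)) ≤a rewrite +-suc (length E) (length E) = flatten-above E a (≤-pred (≤-pred ≤a))

flatten-< : ∀ {n} (E : List (Edge n)) a → a < length E + length E → wordAt (flatten E) a < n
flatten-< ((u , v) ∷ E) zero          a< = Fin.toℕ<n u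
flatten-< ((u , v) ∷ E) (suc zero)    a< = Fin.toℕ<n v
flatten-< ((u , v) ∷ E) (suc (suc a)) a< rewrite +-suc (length E) (length E) = flatten-< E a (≤-pred (≤-pred a<))

lookup-injective : ∀ {A : Set} {xs : List A} → Unique xs → ∀ i j → lookup xs i ≡ lookup xs j → i ≡ j
lookup-injective (_ ∷ _)  zero    zero    _ = refl
lookup-injective {xs = _ ∷ xs} (p ∷ _) zero (suc j) e = contradiction e (All.lookup p (∈-lookup {xs = xs} j))
lookup-injective {xs = _ ∷ xs} (p ∷ _) (suc i) zero e = contradiction (sym e) (All.lookup p (∈-lookup {xs = xs} i))
lookup-injective (_ ∷ u) (suc i) (suc j) e = cong suc (lookup-injective u i j e)

-- The word size is measured in `n`, the numbers of the host in the number of edges; this bound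
-- connects the two.
edges≤n*n : ∀ {n} {E : List (Edge n)} → Unique E → length E ≤ n * n
edges≤n*n {n} {E} unique = Fin.injective⇒≤ {f = f} λ {i} {j} e →
  lookup-injective unique i j (let p , q = Fin.combine-injective _ _ _ _ e in cong₂ _,_ p q)
  where
  f : Fin (length E) → Fin (n * n)
  f i = combine (proj₁ (lookup E i)) (proj₂ (lookup E i))

separation : ∀ Wd .{{_ : NonZero Wd}} J → Wd ≡ J + J → 1 ≤ J → ∀ k (a : ℕ → ℕ) → (∀ i → i < k → a i < 2 ^ J) →
  (∀ i j → i < k → j < k → a i ≡ a j → i ≡ j) →
  ∃[ z ] (z < (Wd ^ k) ^ k × (∀ t → t < k → Colouring.colour Wd k z (a t) ≡ suc t))
separation _ (suc D) refl _ k a a< distinct = Separation.separating-colouring D k a a< distinct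

module Input (W n k′ : ℕ) (E : List (Edge n)) (unique : Unique E) (n< : n < 2 ^ W) (m< : length E < 2 ^ W) where

  k m len Tb P : ℕ
  k   = suc k′
  m   = length E
  len = m + m
  Tb  = len + 2
  P   = Tb + n

  μ low : ℕ → ℕ
  μ a = wrap W (wordAt (encode n E) a)
  low = fill μ Tb len

  μ-n : μ 0 ≡ n
  μ-n = wrap-small W n<

  μ-m : μ 1 ≡ m
  μ-m = wrap-small W m<

  μ-above : ∀ a → 2 + len ≤ a → μ a ≡ 0
  μ-above (suc zero)    (s≤s ())
  μ-above (suc (suc a)) ≤a = trans (cong (wrap W) (flatten-above E a (≤-pred (≤-pred ≤a)))) (wrap-small W (m^n>0 2 W))

  endpoint< : ∀ p → 2 ≤ p → p < 2 + len → μ p < n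
  endpoint< (suc zero)    (s≤s ()) _
  endpoint< (suc (suc a)) _ p< = subst (_< n) (sym (wrap-small W (<-trans a< n<))) a<
    where
    a< : wordAt (flatten E) a < n
    a< = flatten-< E a (≤-pred (≤-pred p<))

  open Filled μ n len endpoint<

  low-input : ∀ {p} → p < 2 + len → low p ≡ μ p
  low-input {p} p< = fill-input len (subst (p <_) (+-comm 2 len) p<)

  -- Both the parent table and the guest's memory rely on cells that start as zeros.
  low-0 : ∀ a → P ≤ a → low a ≡ 0
  low-0 a ≤a = trans (fill-above len ≤-refl ≤a)
    (μ-above a (≤-trans (≤-reflexive (+-comm 2 len)) (≤-trans (m≤m+n Tb n) ≤a)))

  module _ (base cap N Wd Z : ℕ) .{{_ : NonZero Wd}} where

    open Edges W m Tb P base cap N Wd k Z low hiding (len)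
    open Colouring Wd k
    open Paths m src dst act

    private
      Entry : ℕ → Set
      Entry p = Tb + low p < P × (2 ≤ low (Tb + low p) × low (Tb + low p) < 2 + len) × low (low (Tb + low p)) ≡ low p

      entry : ∀ a → a < len → Entry (a + 2)
      entry a a< rewrite fill-input len (position< a<) =
        let 2≤ , below , same = fill-table len ≤-refl a a< in
        +-monoʳ-< Tb (endpoint-at a<) , (2≤ , below) , trans (low-input below) same

      entries : ∀ p → 2 ≤ p → p < 2 + len → Entry p
      entries (suc zero)    (s≤s ()) _
      entries (suc (suc a)) _ p< = subst Entry (+-comm a 2) (entry a (≤-pred (≤-pred p<)))

    table : Table
    table .Table.input≤ = ≤-trans (≤-reflexive (+-comm 2 len)) (m≤m+n Tb n)
    table .Table.table-range p 2≤ p< = let b , r , _ = entries p 2≤ p< in b , r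
    table .Table.table-label p 2≤ p< = proj₂ (proj₂ (entries p 2≤ p<))

    open Table table

    src-value : ∀ (e : Fin m) → low (src-pos (toℕ e)) ≡ toℕ (proj₁ (lookup E e))
    src-value e = trans (low-input (proj₂ (src-pos-range (toℕ e) (Fin.toℕ<n e))))
      (trans (cong (wrap W ∘ wordAt (encode n E)) (+-comm (toℕ e + toℕ e) 2))
        (trans (cong (wrap W) (proj₁ (flatten-lookup E e))) (wrap-small W (<-trans (Fin.toℕ<n _) n<))))

    tgt-value : ∀ (e : Fin m) → low (tgt-pos (toℕ e)) ≡ toℕ (proj₂ (lookup E e))
    tgt-value e = trans (low-input (proj₂ (tgt-pos-range (toℕ e) (Fin.toℕ<n e))))
      (trans (cong (wrap W ∘ wordAt (encode n E)) (cong (_+ 1) (+-comm (toℕ e + toℕ e) 2)))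
        (trans (cong (wrap W) (proj₂ (flatten-lookup E e))) (wrap-small W (<-trans (Fin.toℕ<n _) n<))))

    index : ∀ {e} → e < m → ∃[ f ] (toℕ {m} f ≡ e)
    index e< = fromℕ< e< , Fin.toℕ-fromℕ< e<

    low-src : ∀ e → low (src (toℕ {m} e)) ≡ toℕ (proj₁ (lookup E e))
    low-src e = let 2≤ , below = src-pos-range (toℕ e) (Fin.toℕ<n e) in trans (table-label _ 2≤ below) (src-value e)

    low-tgt : ∀ e → low (tgt (toℕ {m} e)) ≡ toℕ (proj₂ (lookup E e))
    low-tgt e = let 2≤ , below = tgt-pos-range (toℕ e) (Fin.toℕ<n e) in trans (table-label _ 2≤ below) (tgt-value e)

    wraps-value : ∀ z i → wraps z i ≡ 0 ⊎ wraps z i ≡ 1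
    wraps-value z i with colour z (tgt i) ≡ᵇ 1
    ... | true  = inj₂ refl
    ... | false = inj₁ refl

    dst-label : ∀ z {i y} → i < m → y < 2 + len → dst z i ≡ y → tgt i ≡ y
    dst-label z {i} i< y< e with wraps-value z i
    ... | inj₁ p rewrite p = trans (sym (+-identityʳ (tgt i))) e
    ... | inj₂ p rewrite p | *-identityˡ len = contradiction (+-monoˡ-≤ len (proj₁ (tgt-range i i<))) (<⇒≱ (subst (_< 2 + len) (sym e) y<))

    dst-copy : ∀ z {i y} → i < m → 2 ≤ y → dst z i ≡ y + len → tgt i ≡ y
    dst-copy z {i} {y} i< 2≤y e with wraps-value z i
    ... | inj₂ p rewrite p | *-identityˡ len = +-cancelʳ-≡ len (tgt i) y e
    ... | inj₁ p rewrite p | +-identityʳ (tgt i) = contradiction (+-monoˡ-≤ len 2≤y) (<⇒≱ (subst (_< 2 + len) e (proj₂ (tgt-range i i<))))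

    -- Redirected targets are at least `2 + len` and the others lie below, so `dst` determines
    -- `tgt`. Reading the input at the labels recovers the edge, and the list has no duplicates.
    edge-injective : ∀ z i j → i < m → j < m → src i ≡ src j → dst z i ≡ dst z j → i ≡ j
    edge-injective z i j i< j< s d with index i< | index j<
    ... | e , refl | f , refl = cong toℕ (lookup-injective unique e f (cong₂ _,_
      (Fin.toℕ-injective (trans (sym (low-src e)) (trans (cong low s) (low-src f))))
      (Fin.toℕ-injective (trans (sym (low-tgt e)) (trans (cong low tgts) (low-tgt f))))))
      where
      tgts : tgt (toℕ e) ≡ tgt (toℕ f)
      tgts with wraps-value z (toℕ f)
      ... | inj₁ p = dst-label z i< (proj₂ (tgt-range (toℕ f) j<))
        (trans d (trans (cong (λ x → tgt (toℕ f) + x * len) p) (+-identityʳ _)))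
      ... | inj₂ p = dst-copy z i< (proj₁ (tgt-range (toℕ f) j<))
        (trans d (cong (tgt (toℕ f) +_) (trans (cong (_* len) p) (*-identityˡ len))))

    -- The last edge ends in the copy of `x`, so its target in the input is the first vertex and it
    -- closes the cycle. Distinct labels give distinct vertices because a vertex determines its
    -- label.
    path⇒cycle : ∀ {z x} → 2 ≤ x → (q : Path z x (x + len)) → steps q ≡ k →
      (∀ i j → i < k → j < k → at q i ≡ at q j → i ≡ j) →
      ∃[ v ] (IsCycle k E v × (∀ i → low (at q (toℕ i)) ≡ toℕ (v i)))
    path⇒cycle {z} {x} 2≤x q q≡ distinct = v , (injective , edges) , λ i → sym (v-value i)
      where
      arc : ∀ i → i < k → ∃[ e ] (at q i ≡ src (toℕ {m} e) × at q (suc i) ≡ dst z (toℕ e))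
      arc i i< with at-edge q i (subst (i <_) (sym q≡) i<)
      ... | e , e< , _ , s , d with index e<
      ...   | f , refl = f , s , d
      arcᶠ : ∀ (i : Fin k) → ∃[ e ] (at q (toℕ i) ≡ src (toℕ {m} e) × at q (suc (toℕ i)) ≡ dst z (toℕ e))
      arcᶠ i = arc (toℕ i) (Fin.toℕ<n i)
      v : Fin k → Fin n
      v i = proj₁ (lookup E (proj₁ (arcᶠ i)))
      v-value : ∀ i → toℕ (v i) ≡ low (at q (toℕ i))
      v-value i = let e , s , _ = arcᶠ i in trans (sym (low-src e)) (cong low (sym s))
      label : ∀ i → at q (toℕ i) ≡ low (Tb + toℕ (v i))
      label i = let e , s , _ = arcᶠ i in trans s (cong (λ y → low (Tb + y)) (src-value e))
      injective : ∀ {i j} → v i ≡ v j → i ≡ j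
      injective {i} {j} e = Fin.toℕ-injective (distinct (toℕ i) (toℕ j) (Fin.toℕ<n i) (Fin.toℕ<n j)
        (trans (label i) (trans (cong (λ u → low (Tb + toℕ u)) e) (sym (label j)))))
      next-label : ∀ i → tgt (toℕ (proj₁ (arcᶠ i))) ≡ at q (toℕ (suc (toℕ i) mod k))
      next-label i with arcᶠ i | suc (toℕ i) <? k
      ... | e , s , d | yes i+1< = trans (dst-label z (Fin.toℕ<n e) next< (sym d)) (cong (at q) (sym (toℕ-mod i+1<)))
        where
        next< : at q (suc (toℕ i)) < 2 + len
        next< = let f , s′ , _ = arc (suc (toℕ i)) i+1< in subst (_< 2 + len) (sym s′) (proj₂ (src-range (toℕ f) (Fin.toℕ<n f)))
      ... | e , s , d | no ¬i+1< = trans (dst-copy z (Fin.toℕ<n e) 2≤x (trans (sym d) last)) (sym (trans (cong (at q) wrapped) (at-0 q)))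
        where
        i+1≡k : suc (toℕ i) ≡ k
        i+1≡k = ≤-antisym (Fin.toℕ<n i) (≮⇒≥ ¬i+1<)
        last : at q (suc (toℕ i)) ≡ x + len
        last = trans (cong (at q) (trans i+1≡k (sym q≡))) (at-steps q)
        wrapped : toℕ (suc (toℕ i) mod k) ≡ 0
        wrapped = trans (Fin.toℕ-fromℕ< (m%n<n (suc (toℕ i)) k)) (trans (cong (_% k) i+1≡k) (n%n≡0 k))
      edges : ∀ i → (v i , v (suc (toℕ i) mod k)) ∈ E
      edges i = subst (λ w → (v i , w) ∈ E) (Fin.toℕ-injective same) (∈-lookup {xs = E} e)
        where
        e = proj₁ (arcᶠ i)
        same : toℕ (proj₂ (lookup E e)) ≡ toℕ (v (suc (toℕ i) mod k))
        same = trans (sym (low-tgt e)) (trans (cong low (next-label i)) (sym (v-value (suc (toℕ i) mod k))))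

    -- Some colouring gives the labels of the cycle the colours 1 to `k` in order. All its edges are
    -- then active, and only the closing edge, which enters colour 1, is redirected to a copy.
    cycle⇒path : ∀ J → Wd ≡ J + J → 1 ≤ J → 2 + len ≤ 2 ^ J → (v : Fin k → Fin n) → IsCycle k E v →
      ∃[ z ] ∃[ x ] (z < (Wd ^ k) ^ k × 2 ≤ x × x < 2 + len × Path z x (x + len))
    cycle⇒path J Wd≡ 1≤J room v (injective , edges) =
      let z , z< , coloured = separation Wd J Wd≡ 1≤J k a a< distinct
      in z , a 0 , z< , proj₁ (a-range 0) , proj₂ (a-range 0) , whole z coloured
      where
      u : ℕ → Fin k
      -- Indices are read modulo `k`, so that `a k` is `a 0`.
      u i = i mod k
      a : ℕ → ℕ
      a i = low (Tb + toℕ (v (u i)))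
      arc : ∀ i → i < k → ∃[ e ] (lookup E e ≡ (v (u i) , v (u (suc i))))
      arc i i< with ∈-index (edges (u i))
        where
        ∈-index : ∀ {x : Edge n} → x ∈ E → ∃[ e ] (lookup E e ≡ x)
        ∈-index h = Any.index h , sym (lookup-index h)
      ... | e , p = e , trans p (cong (λ w → v (u i) , v (suc w mod k)) (toℕ-mod i<))
      src-a : ∀ i e → lookup E e ≡ (v (u i) , v (u (suc i))) → src (toℕ e) ≡ a i
      src-a i e p = cong (λ y → low (Tb + y)) (trans (src-value e) (cong (toℕ ∘ proj₁) p))
      tgt-a : ∀ i e → lookup E e ≡ (v (u i) , v (u (suc i))) → tgt (toℕ e) ≡ a (suc i)
      tgt-a i e p = cong (λ y → low (Tb + y)) (trans (tgt-value e) (cong (toℕ ∘ proj₂) p))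
      u-mod : ∀ i → u (i % k) ≡ u i
      u-mod i = Fin.toℕ-injective (trans (toℕ-mod (m%n<n i k)) (sym (Fin.toℕ-fromℕ< (m%n<n i k))))
      a-range′ : ∀ i → i < k → 2 ≤ a i × a i < 2 + len
      a-range′ i i< = let e , p = arc i i< in subst (λ y → 2 ≤ y × y < 2 + len) (src-a i e p) (src-range (toℕ e) (Fin.toℕ<n e))
      a-range : ∀ i → 2 ≤ a i × a i < 2 + len
      a-range i = subst (λ w → 2 ≤ low (Tb + toℕ (v w)) × low (Tb + toℕ (v w)) < 2 + len) (u-mod i) (a-range′ (i % k) (m%n<n i k))
      a< : ∀ i → i < k → a i < 2 ^ J
      a< i _ = <-≤-trans (proj₂ (a-range i)) room
      low-a : ∀ i → i < k → low (a i) ≡ toℕ (v (u i))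
      low-a i i< = let e , p = arc i i< in trans (cong low (sym (src-a i e p))) (trans (low-src e) (cong (toℕ ∘ proj₁) p))
      distinct : ∀ i j → i < k → j < k → a i ≡ a j → i ≡ j
      distinct i j i< j< e = mod-injective i< j<
        (injective (Fin.toℕ-injective (trans (sym (low-a i i<)) (trans (cong low e) (low-a j j<)))))
      module _ (z : ℕ) (coloured : ∀ t → t < k → colour z (a t) ≡ suc t) where
        inside : ∀ i → suc i < k → ∃[ e ] (e < m × act z e ≢ 0 × src e ≡ a i × dst z e ≡ a (suc i))
        inside i i+1< with arc i (<-trans (n<1+n i) i+1<)
        ... | e , p = toℕ e , Fin.toℕ<n e , (λ q → 0≢1+n (trans (sym q) active)) , src-a i e p ,
          trans (cong₂ (λ y c → y + c * len) (tgt-a i e p) wraps≡0) (+-identityʳ _)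
          where
          colour-tgt : colour z (tgt (toℕ e)) ≡ suc (suc i)
          colour-tgt = trans (cong (colour z) (tgt-a i e p)) (coloured (suc i) i+1<)
          colour-src : colour z (src (toℕ e)) ≡ suc i
          colour-src = trans (cong (colour z) (src-a i e p)) (coloured i (<-trans (n<1+n i) i+1<))
          wraps≡0 : wraps z (toℕ e) ≡ 0
          wraps≡0 = cong (λ c → bit (c ≡ᵇ 1)) colour-tgt
          active : act z (toℕ e) ≡ 1
          active = bit-≡1 (trans (cong (_+ 1) colour-src) (trans (+-comm (suc i) 1)
            (sym (trans (cong₂ (λ c d → c + d * k) colour-tgt wraps≡0) (+-identityʳ _)))))
        closing : ∃[ e ] (e < m × act z e ≢ 0 × src e ≡ a k′ × dst z e ≡ a 0 + len)
        closing with arc k′ ≤-refl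
        ... | e , p = toℕ e , Fin.toℕ<n e , (λ q → 0≢1+n (trans (sym q) active)) , src-a k′ e p ,
          trans (cong₂ (λ y c → y + c * len) tgt≡ wraps≡1) (cong (a 0 +_) (*-identityˡ len))
          where
          tgt≡ : tgt (toℕ e) ≡ a 0
          tgt≡ = trans (tgt-a k′ e p) (cong (λ w → low (Tb + toℕ (v w)))
            (trans (sym (u-mod k)) (cong u (n%n≡0 k))))
          colour-tgt : colour z (tgt (toℕ e)) ≡ 1
          colour-tgt = trans (cong (colour z) tgt≡) (coloured 0 (s≤s z≤n))
          colour-src : colour z (src (toℕ e)) ≡ k
          colour-src = trans (cong (colour z) (src-a k′ e p)) (coloured k′ ≤-refl)
          wraps≡1 : wraps z (toℕ e) ≡ 1
          wraps≡1 = cong (λ c → bit (c ≡ᵇ 1)) colour-tgt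
          active : act z (toℕ e) ≡ 1
          active = bit-≡1 (trans (cong (_+ 1) colour-src) (trans (+-comm k 1)
            (sym (trans (cong₂ (λ c d → c + d * k) colour-tgt wraps≡1) (cong suc (+-identityʳ k))))))
        initial-part : ∀ i → i < k → Path z (a 0) (a i)
        initial-part zero    i< = start
        initial-part (suc i) i< with inside i i<
        ... | e , e< , act≢0 , s , d = subst (Path z (a 0)) d
          (extend (subst (Path z (a 0)) (sym s) (initial-part i (<-trans (n<1+n i) i<))) e< act≢0)
        whole : Path z (a 0) (a 0 + len)
        whole with closing
        ... | e , e< , act≢0 , s , d = subst (Path z (a 0)) d
          (extend (subst (Path z (a 0)) (sym s) (initial-part k′ ≤-refl)) e< act≢0)

-- The whole run

module Whole (A : DynamicAlgorithm) (π : Parameter) (k′ : ℕ) where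

  open DynamicAlgorithm A
  open HostCode A π (suc k′)

  hostCode : Program
  hostCode = initCode wordConstant (suc k′) ⨾ embed preprocess ⨾ mainCode ⨾ finishCode (suc k′)

  hostCost : (m n′ Z : ℕ) → ℕ
  hostCost m n′ Z = initCost (suc k′) m + (size (embed preprocess) + (mainCost n′ m Z + finishCost (suc k′) m))

  labels : ℕ → ℕ
  labels m = m + m + (m + m) + 4

  logN : ℕ → ℕ
  logN m = exponent (labels m) m

  n′ colourings : ℕ → ℕ
  n′ m = pred (2 ^ logN m)
  colourings m = (logN m + logN m) ^ (suc k′ * suc k′)

  N≡ : ∀ m → suc (n′ m) ≡ 2 ^ logN m
  N≡ m = suc-pred (2 ^ logN m) {{m^n≢0 2 (logN m)}}

  labels≡ : ∀ m → labels m ≡ 4 + 4 * m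
  labels≡ = solve 1 (λ m → m :+ m :+ (m :+ m) :+ con 4 := con 4 :+ con 4 :* m) refl
    where open +-*-Solver

  labels≤ : ∀ m → labels m ≤ 2 ^ logN m
  labels≤ m = subst (λ x → x ≤ 2 ^ exponent x m) (sym (labels≡ m)) (exponent-lower m)

  1≤logN : ∀ m → 1 ≤ logN m
  1≤logN m = ≤-trans (s≤s z≤n) (exponent-mono (labels m) {0} {m} z≤n)

  guestWord : ℕ → ℕ
  guestWord m = wordConstant * suc (logN m)

  guestWord≡ : ∀ m → wordSize wordConstant (suc (n′ m)) ≡ guestWord m
  guestWord≡ m = cong (λ l → wordConstant * suc l) (trans (cong ⌊log₂_⌋ (N≡ m)) (⌊log₂[2^n]⌋≡n (logN m)))

  -- The layout of the host's memory: the input, the table of labels indexed by the `n` vertices,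
  -- the parent table with room for all vertices of the constructed graph, then the guest.
  memoryBase : (n m : ℕ) → ℕ
  memoryBase n m = m + m + 2 + n + suc (n′ m)

  record Capacity (W n m : ℕ) : Set where
    field
      fits       : memoryBase n m + 2 ^ guestWord m ≤ 2 ^ W
      Z<         : colourings m < 2 ^ W
      label-room : 2 + (m + m + (m + m)) + (logN m + logN m) < 2 ^ W
      k-room     : suc k′ + suc k′ + 2 < 2 ^ W

  module Requests (W n : ℕ) (E : List (Edge n)) (unique : Unique E) (capacity : Capacity W n (length E)) where

    open Capacity capacity

    private
      m N w J Wd Z base : ℕ
      m = length E
      N = suc (n′ m)
      w = guestWord m
      J = logN m
      Wd = J + J
      Z = colourings m
      base = memoryBase n m

      instance
        Wd≢0 : NonZero Wd
        Wd≢0 = >-nonZero (≤-trans (1≤logN m) (m≤m+n J J))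

      base< : base < 2 ^ W
      base< = <-≤-trans (m<m+n base (m^n>0 2 w)) fits

      n< : n < 2 ^ W
      n< = ≤-<-trans (≤-trans (m≤n+m n (m + m + 2)) (m≤m+n _ N)) base<

      m< : m < 2 ^ W
      m< = ≤-<-trans (≤-trans (m≤m+n m m) (≤-trans (m≤m+n (m + m) 2) (≤-trans (m≤m+n _ n) (m≤m+n _ N)))) base<

    open Input W n k′ E unique n< m<
      using (k; len; Tb; P; low; μ-n; μ-m; endpoint<; low-0; table; edge-injective; path⇒cycle; cycle⇒path) renaming (μ to μ₀)
    open Edges W m Tb P base (2 ^ w) N Wd k Z low using (src; dst; act; Own; own)
    open Paths m src dst act

    private
      room : 4 + (len + len) ≤ N
      room = subst₂ _≤_ (+-comm (len + len) 4) (sym (N≡ m)) (labels≤ m)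

      P≤base : P ≤ base
      P≤base = m≤m+n P N

      w≤W : w ≤ W
      w≤W = ≮⇒≥ λ W<w → <⇒≱ (<-≤-trans (m<n+m (2 ^ w) (≤-trans (s≤s z≤n) (m≤n+m N P))) fits) (^-monoʳ-≤ 2 (<⇒≤ W<w))

      table′ : Edges.Table W m Tb P base (2 ^ w) N Wd k Z low
      table′ = table base (2 ^ w) N Wd Z

    open Main A π W w m Tb P base (n′ m) Wd k Z low

    facts : Facts
    facts = record
      { tab = table′ ; w≤W = w≤W ; fits = fits ; P≤base = P≤base ; vertex-room = room
      ; N< = ≤-<-trans (m≤n+m N P) base< ; label-room = label-room ; k-room = k-room ; Z< = Z<
      ; edge-injective = edge-injective base (2 ^ w) N Wd Z }

    open Edges.Table table′ using (src-range; dst-range)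
    private
      module Seq = Sequence π (n′ m) m len room src dst act src-range dst-range (edge-injective base (2 ^ w) N Wd Z)

    requests : List (Request N)
    requests = Seq.requests Z

    admissible-requests : Admissible (4 * N) [] requests
    admissible-requests = Seq.admissible-requests (m≤m+n m m) Z

    updates-requests : updates requests ≤ n′ m * 1 + (N * 1 + (Z * (m * 1 + ((m + m) * 4 + m * 1)) + 0))
    updates-requests = Seq.updates-requests Z

    queries-requests : queries requests ≤ Z * (m + m)
    queries-requests = Seq.queries-requests Z

    private
      Wd< : Wd < 2 ^ W
      Wd< = ≤-<-trans (m≤n+m Wd (2 + (len + len))) label-room

      k< : k < 2 ^ W
      k< = ≤-<-trans (≤-trans (m≤m+n k k) (m≤m+n (k + k) 2)) k-room

    module _ (cs extra : List Bool) where

      open Simulation w W base w≤W fits extra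
      open Logic W
      open Init W wordConstant k n m (n′ m) μ₀ (cs ++ extra) using (Ready; init-run)

      private
        Prepared : State → Set
        Prepared = Ready (N≡ m) μ-n μ-m endpoint< fits (labels≤ m) Z< Wd< k<

        module _ {S : State} (R : Prepared S) where
          open Ready R

          ready-own : Own S
          ready-own = Edges.owning constants-ready

          ready-low : ∀ a → a < base → mem S a ≡ low a
          ready-low a a< = trans (cong (λ h → h a) memory) (update-other low _ (λ e → <⇒≢ a< (sym e)))

          ready-sim : Sim S (initial w (encode N []) cs)
          ready-sim = record
            { base-reg = constants-ready rBase _ ; mod-reg = constants-ready rMod _ ; regs = guests-0
            ; mems = λ a _ → trans (cong (λ h → h (base + a)) memory) (cell a)
            ; coins≡ = coins-kept ; reg-< = λ _ → m^n>0 2 w ; mem-< = λ a _ → wrap-< w _ }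
            where
            above : ∀ a → wordAt (encode N []) (suc a) ≡ 0
            above zero    = refl
            above (suc a) = refl
            cell : ∀ a → (low [ base ↦ wrap w N ]) (base + a) ≡ wrap w (wordAt (encode N []) a)
            cell zero    = trans (cong (low [ base ↦ wrap w N ]) (+-identityʳ base)) (update-same low base _)
            cell (suc a) = trans (update-other low _ (λ e → m≢1+m+n base (trans e (+-suc base a))))
              (trans (low-0 _ (≤-trans P≤base (m≤m+n base (suc a))))
                (sym (trans (cong (wrap w) (above a)) (wrap-small w (m^n>0 2 w)))))

        finish-run : ∀ {S φ} → Own S → (∀ a → a < base → mem S a ≡ low a) → Record facts extra (Everything facts extra) S →
          Run (finishCode k) S φ (finishCost k m) λ S′ _ → ReportsCycle k E (reg S′)
        finish-run {S} o l (inj₁ (f , none-seen)) = branch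
          {B = searchCost k m + (1 + (size (traceCode k) + (size (outputCode k) + 1)))}
          (contradiction f)
          (λ _ → instruction (by-const (≤-<-trans z≤n base<)) (none refl λ v cycle →
            let z , x , z< , 2≤x , x< , p = cycle⇒path base (2 ^ w) N Wd Z J refl (1≤logN m) label-J v cycle
            in none-seen z x (subst (z <_) (^-*-assoc Wd k k) z< , 2≤x , x<) tt p))
          where
          label-J : 2 + len ≤ 2 ^ J
          label-J = ≤-trans (≤-trans (+-mono-≤ (m≤m+n 2 2) (m≤m+n len len)) (≤-reflexive (+-comm 4 (len + len)))) (labels≤ m)
        finish-run {S} o l (inj₂ (f , (z< , 2≤x , x<) , ¬¬path)) = branch
          (λ _ → consequence (Search.found-run W m Tb P base (2 ^ w) N Wd k Z low table′ parents (<⇒≤ base<) label-room k-room Z<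
            (λ y _ → low-0 (P + y) (m≤m+n P y)) z< 2≤x x< o l refl refl ¬¬path) λ {S′} → report {S′})
          (λ p → contradiction (trans (sym f) p) λ ())
          where
          open Search W m Tb P base (2 ^ w) N Wd k Z low using (lev; module Levels)
          z = reg S rFz
          x = reg S rFx
          parents : P + (2 + (len + len)) ≤ base
          parents = +-monoʳ-≤ P (≤-trans (m≤n+m (2 + (len + len)) 2) room)
          report : ∀ {S′ : State} → reg S′ 0 ≡ 1 × ∃[ q ] (steps {z} {x} {x + len} q ≡ k × (∀ i → i < k → reg S′ (suc i) ≡ low (at q i))) →
            ReportsCycle k E (reg S′)
          report (r0 , q , q≡ , outs) =
            let v , cycle , vals = path⇒cycle base (2 ^ w) N Wd Z 2≤x q q≡ distinct
            in found v r0 cycle λ i → trans (outs (toℕ i) (Fin.toℕ<n i)) (vals i)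
            where
            distinct : ∀ i j → i < k → j < k → at q i ≡ at q j → i ≡ j
            distinct i j i< j< e = +-cancelˡ-≡ (lev z x) i j
              (trans (sym (level i i<)) (trans (cong (lev z) e) (level j j<)))
              where
              level : ∀ i → i < k → lev z (at q i) ≡ lev z x + i
              level i i< = Levels.lev-at table′ q i (<⇒≤ (subst (i <_) (sym q≡) i<))

      host-run : ∀ {s t₁ t₂} → w ⊢ preprocess , initial w (encode N []) cs ⇓ s , t₁ → Serves w A π s [] requests t₂ →
        ∃[ S ] ∃[ t ] (W ⊢ hostCode , initial W (encode n E) (cs ++ extra) ⇓ S , t ×
          t ≤ hostCost m (n′ m) Z + 2 * (t₁ + t₂) × ReportsCycle k E (reg S))
      host-run {s} {t₁} {t₂} pre serves = conclude
        -- The potential covers preprocessing and all requests; initialization leaves it untouched.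
        (bind (no-charge {φ = 2 * (t₁ + t₂)} (init-run (N≡ m) μ-n μ-m endpoint< fits (labels≤ m) Z< Wd< k<))
          λ { {S₁} (refl , R) →
            bind (guest-run facts extra {u = t₂} pre (ready-sim R) refl) λ { {S₂} (refl , sim , f) →
              bind (main-run facts extra (record
                { own′ = own-frame facts extra f (ready-own R) ; low≡ = low-frame facts extra f (ready-low R)
                ; sim = sim ; serves = serves ; pot = refl })
                (trans (Frame.regs f rFound _) (Ready.found-0 R))) λ { {S₃} (I , rec) →
                  finish-run (Inv.own′ I) (Inv.low≡ I) rec } } })
        where
        conclude : ∀ {S φ B} → Run hostCode S φ B (λ S′ _ → ReportsCycle k E (reg S′)) →
          ∃[ S′ ] ∃[ t ] (W ⊢ hostCode , S ⇓ S′ , t × t ≤ B + φ × ReportsCycle k E (reg S′))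
        conclude (ran (S , t , φ , d , t≤ , report)) = S , t , d , ≤-trans (m≤m+n t φ) t≤ , report

-- Unused coins

allVecs : ∀ L → List (Vec Bool L)
allVecs zero    = Vec.[] ∷ []
allVecs (suc L) = map (true Vec.∷_) (allVecs L) ++ map (false Vec.∷_) (allVecs L)

length-allVecs : ∀ L → length (allVecs L) ≡ 2 ^ L
length-allVecs zero    = refl
length-allVecs (suc L) = trans (List.length-++ (map (true Vec.∷_) (allVecs L)))
  (cong₂ _+_ (trans (List.length-map (true Vec.∷_) (allVecs L)) (length-allVecs L))
    (trans (List.length-map (false Vec.∷_) (allVecs L)) (trans (length-allVecs L) (sym (+-identityʳ (2 ^ L))))))

unique-allVecs : ∀ L → Unique (allVecs L)
unique-allVecs zero    = [] ∷ []
unique-allVecs (suc L) = Unique.++⁺ (Unique.map⁺ Vec.∷-injectiveʳ (unique-allVecs L)) (Unique.map⁺ Vec.∷-injectiveʳ (unique-allVecs L))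
  λ (p , q) → disjoint (∈-map⁻ (true Vec.∷_) p) (∈-map⁻ (false Vec.∷_) q)
  where
  disjoint : ∀ {v : Vec Bool (suc L)} → ∃[ x ] (x ∈ allVecs L × v ≡ true Vec.∷ x) → ¬ (∃[ y ] (y ∈ allVecs L × v ≡ false Vec.∷ y))
  disjoint (_ , _ , refl) (_ , _ , ())

length-product : ∀ {A B C : Set} (f : A → B → C) xs ys → length (List.cartesianProductWith f xs ys) ≡ length xs * length ys
length-product f []       ys = refl
length-product f (x ∷ xs) ys = trans (List.length-++ (map (f x) ys)) (cong₂ _+_ (List.length-map (f x) ys) (length-product f xs ys))

-- The cycle finder owns as many coins as its own time bound. Extending every good outcome in all
-- possible ways preserves the proportion of good outcomes.
more-coins : ∀ {L L′} {P Q : List Bool → Set} → L ≤ L′ → (∀ cs extra → P cs → Q (cs ++ extra)) →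
  WithProbability≥2/3 L P → WithProbability≥2/3 L′ Q
more-coins {L} {L′} {P} {Q} L≤ f (good , unique , holds , many) =
  subst (λ l → WithProbability≥2/3 l Q) (m+[n∸m]≡n L≤)
    ( List.cartesianProductWith Vec._++_ good rest
    , Unique.cartesianProductWith⁺ Vec._++_ (λ {w} {x} e → Vec.++-injective w x e) unique (unique-allVecs D)
    , All.cartesianProductWith⁺ (setoid _) (setoid _) Vec._++_ good rest
        (λ {x} {y} x∈ _ → subst Q (sym (Vec.toList-++ x y)) (f (toList x) (toList y) (All.lookup holds x∈)))
    , enough )
  where
  D = L′ ∸ L
  rest = allVecs D
  open ≤-Reasoning
  enough : 2 * 2 ^ (L + D) ≤ 3 * length (List.cartesianProductWith Vec._++_ good rest)
  enough = begin
    2 * 2 ^ (L + D)             ≡⟨ cong (2 *_) (^-distribˡ-+-* 2 L D) ⟩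
    2 * (2 ^ L * 2 ^ D)         ≡⟨ sym (*-assoc 2 (2 ^ L) (2 ^ D)) ⟩
    2 * 2 ^ L * 2 ^ D           ≤⟨ *-monoˡ-≤ (2 ^ D) many ⟩
    3 * length good * 2 ^ D     ≡⟨ *-assoc 3 (length good) (2 ^ D) ⟩
    3 * (length good * 2 ^ D)   ≡⟨ cong (λ x → 3 * (length good * x)) (sym (length-allVecs D)) ⟩
    3 * (length good * length rest) ≡⟨ cong (3 *_) (sym (length-product Vec._++_ good rest)) ⟩
    3 * length (List.cartesianProductWith Vec._++_ good rest) ∎

-- The word size suffices

n<2^log : ∀ n → n < 2 ^ suc ⌊log₂ n ⌋
n<2^log n = ≰⇒> λ 2^≤n → <⇒≱ (n<1+n ⌊log₂ n ⌋)
  (≤-trans (≤-reflexive (sym (⌊log₂[2^n]⌋≡n (suc ⌊log₂ n ⌋)))) (⌊log₂⌋-mono-≤ 2^≤n))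

module WordSize (A : DynamicAlgorithm) (π : Parameter) (k′ : ℕ) where

  open DynamicAlgorithm A
  open Whole A π k′

  private
    k = suc k′

  -- All quantities are compared with powers of `b = 2 ^ suc ⌊log₂ n ⌋`: the memory base is at most
  -- `b ^ 8`, the guest's modulus `b ^ (7 * wordConstant)`, the number of colourings
  -- `b ^ (7 * (k * k))`, and `suc k` is at most `b ^ k`. The constant 10 absorbs the additions.
  hostConstant : ℕ
  hostConstant = 10 + (7 * wordConstant + (7 * (k * k) + k))

  capacity : ∀ {n} {E : List (Edge n)} → Unique E → Capacity (wordSize hostConstant n) n (length E)
  capacity {n} {E} unique = record
    { fits       = ≤-trans (double-≤ (8 + 7 * wordConstant) (≤-trans base≤ (b^≤ {8} (m≤m+n 8 (7 * wordConstant)))) (≤-trans 2^w≤ (b^≤ {7 * wordConstant} (m≤n+m (7 * wordConstant) 8))))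
                     (within (+-mono-≤ (n≤1+n 9) (m≤m+n (7 * wordConstant) _)))
    ; Z<         = <-≤-trans (b^-< (7 * (k * k)) Z≤) (within (+-mono-≤ {1} {10} (s≤s z≤n) (≤-trans (m≤m+n (7 * (k * k)) k) (m≤n+m _ (7 * wordConstant)))))
    ; label-room = <-≤-trans (b^-< 8 (double-≤ 7 (≤-trans inputs≤ (b^≤ (m≤m+n 5 2))) Wd≤)) (within (≤-trans (n≤1+n 9) (m≤m+n 10 _)))
    ; k-room     = <-≤-trans (b^-< (suc k) (≤-trans k-shape (double-≤ k suc-k≤ suc-k≤)))
                     (within (+-mono-≤ {2} {10} (s≤s (s≤s z≤n)) (≤-trans (m≤n+m k (7 * (k * k))) (m≤n+m _ (7 * wordConstant)))))
    }
    where
    m = length E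
    b = 2 ^ suc ⌊log₂ n ⌋
    J = logN m
    open ≤-Reasoning

    2≤b : 2 ≤ b
    2≤b = ≤-trans (≤-reflexive (sym (*-identityʳ 2))) (*-monoʳ-≤ 2 (m^n>0 2 ⌊log₂ n ⌋))

    instance
      b≢0 : NonZero b
      b≢0 = m^n≢0 2 (suc ⌊log₂ n ⌋)

    b^≤ : ∀ {i j} → i ≤ j → b ^ i ≤ b ^ j
    b^≤ = ^-monoʳ-≤ b

    within : ∀ {i} → i ≤ hostConstant → b ^ i ≤ 2 ^ wordSize hostConstant n
    within i≤ = ≤-trans (b^≤ i≤) (≤-reflexive (trans (^-*-assoc 2 (suc ⌊log₂ n ⌋) hostConstant)
      (cong (2 ^_) (*-comm (suc ⌊log₂ n ⌋) hostConstant))))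

    double-≤ : ∀ i {x y} → x ≤ b ^ i → y ≤ b ^ i → x + y ≤ b ^ suc i
    double-≤ i {x} {y} x≤ y≤ = begin
      x + y             ≤⟨ +-mono-≤ x≤ y≤ ⟩
      b ^ i + b ^ i     ≡⟨ cong (b ^ i +_) (sym (+-identityʳ (b ^ i))) ⟩
      2 * b ^ i         ≤⟨ *-monoˡ-≤ (b ^ i) 2≤b ⟩
      b ^ suc i ∎

    b^-< : ∀ i {x} → x ≤ b ^ i → x < b ^ suc i
    b^-< i x≤ = double-≤ i (m^n>0 b i) x≤

    n≤ : n ≤ b
    n≤ = <⇒≤ (n<2^log n)

    m≤ : m ≤ b ^ 2
    m≤ = ≤-trans (edges≤n*n unique) (≤-trans (*-mono-≤ n≤ n≤) (≤-reflexive (cong (b *_) (sym (*-identityʳ b)))))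

    labels≤b : labels m ≤ b ^ 5
    labels≤b = double-≤ 4 (double-≤ 3 (double-≤ 2 m≤ m≤) (double-≤ 2 m≤ m≤)) 4≤
      where
      4≤ : 4 ≤ b ^ 4
      4≤ = ≤-trans (*-mono-≤ 2≤b (≤-trans 2≤b (≤-reflexive (sym (*-identityʳ b))))) (b^≤ {2} {4} (m≤m+n 2 2))

    inputs≤ : 2 + (m + m + (m + m)) ≤ b ^ 5
    inputs≤ = ≤-trans (≤-trans (+-monoˡ-≤ (m + m + (m + m)) (m≤m+n 2 2)) (≤-reflexive (+-comm 4 (m + m + (m + m))))) labels≤b

    N≤ : 2 ^ J ≤ b ^ 6
    N≤ = ≤-trans (exponent-upper (labels m) m (m≤n+m 4 _)) (≤-trans (≤-reflexive (cong (labels m +_) (+-identityʳ (labels m)))) (double-≤ 5 labels≤b labels≤b))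

    Wd≤ : J + J ≤ b ^ 7
    Wd≤ = double-≤ 6 (≤-trans (<⇒≤ (n<2^n J)) N≤) (≤-trans (<⇒≤ (n<2^n J)) N≤)

    2^w≤ : 2 ^ guestWord m ≤ b ^ (7 * wordConstant)
    2^w≤ = begin
      2 ^ (wordConstant * suc J)    ≡⟨ cong (2 ^_) (*-comm wordConstant (suc J)) ⟩
      2 ^ (suc J * wordConstant)    ≡⟨ sym (^-*-assoc 2 (suc J) wordConstant) ⟩
      (2 ^ suc J) ^ wordConstant    ≤⟨ ^-monoˡ-≤ wordConstant (*-mono-≤ 2≤b N≤) ⟩
      (b ^ 7) ^ wordConstant        ≡⟨ ^-*-assoc b 7 wordConstant ⟩
      b ^ (7 * wordConstant) ∎

    base≤ : memoryBase n m ≤ b ^ 8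
    base≤ = double-≤ 7 (double-≤ 6 (≤-trans small (b^≤ (n≤1+n 5))) (≤-trans n≤ (≤-trans (≤-reflexive (sym (*-identityʳ b))) (b^≤ {1} {6} (s≤s z≤n)))))
      (≤-trans (≤-reflexive (N≡ m)) (≤-trans N≤ (b^≤ (n≤1+n 6))))
      where
      small : m + m + 2 ≤ b ^ 5
      small = ≤-trans (+-mono-≤ (m≤m+n (m + m) (m + m)) (m≤m+n 2 2)) labels≤b

    Z≤ : colourings m ≤ b ^ (7 * (k * k))
    Z≤ = ≤-trans (^-monoˡ-≤ (k * k) Wd≤) (≤-reflexive (^-*-assoc b 7 (k * k)))

    suc-k≤ : suc k ≤ b ^ k
    suc-k≤ = ≤-trans (n<2^n k) (^-monoˡ-≤ k 2≤b)

    k-shape : k + k + 2 ≤ suc k + suc k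
    k-shape = ≤-reflexive (trans (+-comm (k + k) 2) (cong suc (sym (+-suc k k))))

-- The cycle-finding algorithm

module Reduction (A : DynamicAlgorithm) (π : Parameter) (k′ : ℕ) (p u q : ℕ → ℕ) where

  open DynamicAlgorithm A
  open Whole A π k′
  open WordSize A π k′

  private
    k = suc k′

  -- Up to constants the sequence has length `N * Z`, with `Z` colourings and
  -- `Z ≤ N ^ (2 * (k * k))`; the constant 5 is at most `N * N`, which explains the 3.
  lengthExponent : ℕ
  lengthExponent = 3 + 2 * (k * k)

  vertices maxUpdates maxQueries maxTime : ℕ → ℕ
  vertices m = suc (n′ m)
  maxUpdates m = n′ m * 1 + (vertices m * 1 + (colourings m * (m * 1 + ((m + m) * 4 + m * 1)) + 0))
  maxQueries m = colourings m * (m + m)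
  maxTime m = p (vertices m) + maxUpdates m * u (vertices m) + maxQueries m * q (vertices m)

  opaque

    runningTime : ℕ → ℕ
    runningTime m = hostCost m (n′ m) (colourings m) + 2 * maxTime m

    runningTime≡ : ∀ m → runningTime m ≡ hostCost m (n′ m) (colourings m) + 2 * maxTime m
    runningTime≡ m = refl

  algorithm : Algorithm
  algorithm = record { wordConstant = hostConstant ; program = hostCode }

  4+4m≤vertices : ∀ m → 4 + 4 * m ≤ vertices m
  4+4m≤vertices m = subst₂ _≤_ (labels≡ m) (sym (N≡ m)) (labels≤ m)

  maxLength : ∀ m → maxUpdates m + maxQueries m ≤ vertices m ^ lengthExponent
  maxLength m = begin
    maxUpdates m + maxQueries m
      ≡⟨ solve 4 (λ n′ N Z m → n′ :* con 1 :+ (N :* con 1 :+ (Z :* (m :* con 1 :+ ((m :+ m) :* con 4 :+ m :* con 1)) :+ con 0)) :+ Z :* (m :+ m)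
                  := n′ :+ N :+ con 3 :* (con 4 :* m) :* Z) refl (n′ m) N Z m ⟩
    n′ m + N + 3 * (4 * m) * Z
      ≤⟨ +-mono-≤ (+-monoˡ-≤ N (n≤1+n (n′ m))) (*-monoˡ-≤ Z (*-monoʳ-≤ 3 (≤-trans (m≤n+m (4 * m) 4) (4+4m≤vertices m)))) ⟩
    N + N + 3 * N * Z
      ≤⟨ +-monoˡ-≤ (3 * N * Z) (m≤m*n (N + N) Z {{>-nonZero 1≤Z}}) ⟩
    (N + N) * Z + 3 * N * Z
      ≡⟨ solve 2 (λ N Z → (N :+ N) :* Z :+ con 3 :* N :* Z := con 5 :* N :* Z) refl N Z ⟩
    5 * N * Z
      ≤⟨ *-mono-≤ (*-monoˡ-≤ N 5≤) Z≤ ⟩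
    N * N * N * N ^ (2 * (k * k))
      ≡⟨ solve 2 (λ N M → N :* N :* N :* M := N :* (N :* (N :* M))) refl N (N ^ (2 * (k * k))) ⟩
    N ^ lengthExponent ∎
    where
    open ≤-Reasoning
    open +-*-Solver
    N = vertices m
    Z = colourings m
    J = logN m
    4≤N : 4 ≤ N
    4≤N = ≤-trans (m≤m+n 4 (4 * m)) (4+4m≤vertices m)
    5≤ : 5 ≤ N * N
    5≤ = ≤-trans (m≤m+n 5 11) (*-mono-≤ 4≤N 4≤N)
    1≤Z : 1 ≤ Z
    1≤Z = m^n>0 (J + J) {{>-nonZero (≤-trans (1≤logN m) (m≤m+n J J))}} (k * k)
    J≤N : J ≤ N
    J≤N = ≤-trans (<⇒≤ (n<2^n J)) (≤-reflexive (sym (N≡ m)))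
    2J≤ : J + J ≤ N ^ 2
    2J≤ = ≤-trans (+-mono-≤ J≤N J≤N) (≤-trans (≤-reflexive (cong (N +_) (sym (+-identityʳ N))))
      (≤-trans (*-monoˡ-≤ N (≤-trans (s≤s (s≤s z≤n)) 4≤N)) (≤-reflexive (cong (N *_) (sym (*-identityʳ N))))))
    Z≤ : Z ≤ N ^ (2 * (k * k))
    Z≤ = ≤-trans (^-monoˡ-≤ (k * k) 2J≤) (≤-reflexive (^-*-assoc N 2 (k * k)))

  module _ {n} (E : List (Edge n)) (unique : Unique E) where

    private
      m = length E
      Z = colourings m
      W = wordSize hostConstant n
      w = wordSize wordConstant (vertices m)
      σ = Whole.Requests.requests A π k′ W n E unique (capacity unique)
      bound = p (vertices m) + updates σ * u (vertices m) + queries σ * q (vertices m)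

      updates≤ : updates σ ≤ maxUpdates m
      updates≤ = Whole.Requests.updates-requests A π k′ W n E unique (capacity unique)

      queries≤ : queries σ ≤ maxQueries m
      queries≤ = Whole.Requests.queries-requests A π k′ W n E unique (capacity unique)

    bound≤ : bound ≤ maxTime m
    bound≤ = +-mono-≤ (+-monoʳ-≤ (p (vertices m)) (*-monoˡ-≤ (u (vertices m)) updates≤))
      (*-monoˡ-≤ (q (vertices m)) queries≤)

    short : length σ ≤ vertices m ^ lengthExponent
    short = ≤-trans (≤-reflexive (length≡updates+queries σ))
      (≤-trans (+-mono-≤ updates≤ queries≤) (maxLength m))

    Serving Reporting : List Bool → Set
    Serving cs = ∃[ s ] ∃[ t₁ ] ∃[ t₂ ] (w ⊢ preprocess , initial w (encode (vertices m) []) cs ⇓ s , t₁ × Serves w A π s [] σ t₂ × t₁ + t₂ ≤ bound)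
    Reporting cs = ∃[ s ] ∃[ t ] (W ⊢ hostCode , initial W (encode n E) cs ⇓ s , t × t ≤ runningTime m × ReportsCycle k E (reg s))

    run : ∀ cs extra → Serving cs → Reporting (cs ++ extra)
    run cs extra (s , t₁ , t₂ , pre , serves , t≤) =
      let S , t , d , t′≤ , report = Whole.Requests.host-run A π k′ W n E unique (capacity unique) cs extra
            (subst (λ w → w ⊢ preprocess , initial w (encode (vertices m) []) cs ⇓ s , t₁) (guestWord≡ m) pre)
            (subst (λ w → Serves w A π s [] σ t₂) (guestWord≡ m) serves)
      in S , t , d , ≤-trans (≤-trans t′≤ (+-monoʳ-≤ (hostCost m (n′ m) Z) (*-monoʳ-≤ 2 (≤-trans t≤ bound≤)))) (≤-reflexive (sym (runningTime≡ m))) , report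

    enough : bound ≤ runningTime m
    enough = ≤-trans bound≤ (≤-trans (≤-trans (m≤m+n (maxTime m) (maxTime m + 0)) (m≤n+m (2 * maxTime m) (hostCost m (n′ m) Z))) (≤-reflexive (sym (runningTime≡ m))))

    reports : Maintains A π (λ n → 4 * n) (λ n → n ^ lengthExponent) p u q → WithProbability≥2/3 (runningTime m) Reporting
    reports maintains = more-coins {P = Serving} {Q = Reporting} enough run
      (maintains (n′ m) [] σ [] (Whole.Requests.admissible-requests A π k′ W n E unique (capacity unique)) short)

  finds-cycles : Maintains A π (λ n → 4 * n) (λ n → n ^ lengthExponent) p u q → FindsCycles k algorithm runningTime
  finds-cycles maintains n E unique = reports E unique maintains

-- Growth rates

infix 4 _≼_

_≼_ : (f g : ℕ → ℕ) → Set
f ≼ g = ∃[ H ] (∀ m → f m ≤ H * g m)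

≼-const : ∀ {g} c → (∀ m → 1 ≤ g m) → (λ _ → c) ≼ g
≼-const c 1≤ = c , λ m → m≤m*n c _ {{>-nonZero (1≤ m)}}

≼-+ : ∀ {f f′ g} → f ≼ g → f′ ≼ g → (λ m → f m + f′ m) ≼ g
≼-+ {g = g} (H , p) (H′ , p′) = H + H′ , λ m → ≤-trans (+-mono-≤ (p m) (p′ m)) (≤-reflexive (sym (*-distribʳ-+ (g m) H H′)))

≼-* : ∀ {f f′ g g′} → f ≼ g → f′ ≼ g′ → (λ m → f m * f′ m) ≼ (λ m → g m * g′ m)
≼-* {g = g} {g′} (H , p) (H′ , p′) = H * H′ , λ m → ≤-trans (*-mono-≤ (p m) (p′ m))
  (≤-reflexive (solve 4 (λ a b c d → a :* b :* (c :* d) := a :* c :* (b :* d)) refl H (g m) H′ (g′ m)))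
  where open +-*-Solver

≼-id : ∀ {f g} → (∀ m → f m ≤ g m) → f ≼ g
≼-id {g = g} p = 1 , λ m → ≤-trans (p m) (≤-reflexive (sym (*-identityˡ (g m))))

≼-trans : ∀ {f g h} → f ≼ g → g ≼ h → f ≼ h
≼-trans {h = h} (H , p) (H′ , p′) = H * H′ , λ m → ≤-trans (p m) (≤-trans (*-monoʳ-≤ H (p′ m)) (≤-reflexive (sym (*-assoc H H′ (h m)))))

≼-scale : ∀ {f g} c → f ≼ g → (λ m → c * f m) ≼ g
≼-scale {g = g} c (H , p) = c * H , λ m → ≤-trans (*-monoʳ-≤ c (p m)) (≤-reflexive (sym (*-assoc c H (g m))))

≼-loop : ∀ {L f g h} → (λ m → L m * g m) ≼ h → f ≼ g → (∀ m → 1 ≤ g m) → (∀ m → 1 ≤ h m) → (λ m → loopCost (L m) (f m)) ≼ h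
≼-loop {L} {f} {g} Lg≼h f≼g 1≤g 1≤h = ≼-+ (≼-const 3 1≤h)
  (≼-trans (≼-* {g = L} (≼-id λ _ → ≤-refl) (≼-+ {f′ = f} (≼-const 3 1≤g) f≼g)) Lg≼h)

-- Time spent outside the simulated algorithm

module Cost (A : DynamicAlgorithm) (π : Parameter) (k′ : ℕ) (p u q : ℕ → ℕ) where

  open DynamicAlgorithm A
  open HostCode A π (suc k′)
  open Whole A π k′
  open Reduction A π k′ p u q

  private
    1≤N : ∀ m → 1 ≤ vertices m
    1≤N m = s≤s z≤n

    4m≤N : ∀ m → 4 * m ≤ vertices m
    4m≤N m = ≤-trans (m≤n+m (4 * m) 4) (4+4m≤vertices m)

    m≤N : ∀ m → m ≤ vertices m
    m≤N m = ≤-trans (m≤n*m m 4) (4m≤N m)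

    2m≤N : ∀ m → m + m ≤ vertices m
    2m≤N m = ≤-trans (≤-trans (m≤m+n (m + m) (m + m)) (≤-reflexive
      (solve 1 (λ m → m :+ m :+ (m :+ m) := con 4 :* m) refl m))) (4m≤N m)
      where open +-*-Solver

    n′≤N : ∀ m → n′ m ≤ vertices m
    n′≤N m = n≤1+n (n′ m)

  1≤Z : ∀ m → 1 ≤ colourings m
  1≤Z m = m^n>0 (logN m + logN m) {{>-nonZero (≤-trans (1≤logN m) (m≤m+n (logN m) (logN m)))}} (suc k′ * suc k′)

  work : ℕ → ℕ
  work m = colourings m * vertices m

  private
    1≤work : ∀ m → 1 ≤ work m
    1≤work m = *-mono-≤ (1≤Z m) (1≤N m)

    N≤work : ∀ m → vertices m ≤ work m
    N≤work m = m≤n*m (vertices m) (colourings m) {{>-nonZero (1≤Z m)}}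

    one-loop : ∀ {L : ℕ → ℕ} {Y : ℕ → ℕ} B → (∀ m → L m ≤ Y m) → (∀ m → 1 ≤ Y m) → (λ m → loopCost (L m) B) ≼ Y
    one-loop {L} B L≤ 1≤Y = ≼-loop {L = L} {g = λ _ → 1} (≼-id λ m → ≤-trans (≤-reflexive (*-identityʳ _)) (L≤ m)) (≼-const B λ _ → ≤-refl) (λ _ → ≤-refl) 1≤Y

    to-work : ∀ {f} → f ≼ vertices → f ≼ work
    to-work f≼ = ≼-trans f≼ (≼-id N≤work)

  private
    init≼ : (λ m → initCost (suc k′) m) ≼ work
    init≼ = to-work (≼-+ (≼-const 14 1≤N) (≼-+ (one-loop (size growCode) m≤N 1≤N) (≼-+ (≼-const 2 1≤N)
      (≼-+ (≼-const (size (powerCode (suc k′ * suc k′))) 1≤N) (≼-+ (one-loop (size tableCode) 2m≤N 1≤N) (≼-const 2 1≤N))))))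

    search≼ : (λ m → searchCost (suc k′) m) ≼ vertices
    search≼ = ≼-+ (≼-const 3 1≤N) (≼-+ (≼-const 3 1≤N)
      (≼-scale (suc k′) (≼-+ (≼-const 3 1≤N) (one-loop (size (relaxCode (suc k′))) m≤N 1≤N))))

    finish≼ : (λ m → finishCost (suc k′) m) ≼ work
    finish≼ = to-work (≼-+ (≼-const 1 1≤N) (≼-+ (≼-+ search≼
      (≼-const (1 + (size (traceCode (suc k′)) + (size (outputCode (suc k′)) + 1))) 1≤N)) (≼-const 1 1≤N)))

    block≼ : blockCost ≼ vertices
    block≼ = ≼-+ (one-loop (size insertCode) m≤N 1≤N)
      (≼-+ (one-loop (size phaseCode) 2m≤N 1≤N) (one-loop (size deleteCode) m≤N 1≤N))

    main≼ : (λ m → mainCost (n′ m) m (colourings m)) ≼ work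
    main≼ = ≼-+ (to-work (≼-+ (≼-const 1 1≤N)
        (≼-+ (one-loop (size fromTargetCode) n′≤N 1≤N) (one-loop (size toSourceCode) (λ _ → ≤-refl) 1≤N))))
      (≼-loop {L = colourings} {g = vertices} (≼-id λ _ → ≤-refl) block≼ 1≤N 1≤work)

  hostCost≼ : (λ m → hostCost m (n′ m) (colourings m)) ≼ work
  hostCost≼ = ≼-+ init≼ (≼-+ (≼-const (size (embed preprocess)) 1≤work) (≼-+ main≼ finish≼))

^-distribʳ-* : ∀ n x y → (x * y) ^ n ≡ x ^ n * y ^ n
^-distribʳ-* zero    x y = refl
^-distribʳ-* (suc n) x y = trans (cong (x * y *_) (^-distribʳ-* n x y))
  (solve 4 (λ a b c d → a :* b :* (c :* d) := a :* c :* (b :* d)) refl x y (x ^ n) (y ^ n))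
  where open +-*-Solver

-- Since `j ≤ e * suc (j / e) ≤ e * 2 ^ (j / e)`, raising to the power `e` gives `2 ^ j`. With `j`
-- the logarithm of the number of vertices, any fixed power of the number of colourings is linear in
-- that number.
polynomial-≤-exponential : ∀ e → ∃[ F ] (∀ j → (j + j) ^ e ≤ F * 2 ^ j)
polynomial-≤-exponential zero = 1 , λ j → ≤-trans (m^n>0 2 j) (≤-reflexive (sym (*-identityˡ (2 ^ j))))
polynomial-≤-exponential e@(suc _) = (2 * e) ^ e , bound
  where
  open ≤-Reasoning
  linear : ∀ j → j + j ≤ 2 * e * 2 ^ (j / e)
  linear j = begin
    j + j                       ≡⟨ cong (j +_) (sym (+-identityʳ j)) ⟩
    2 * j                       ≤⟨ *-monoʳ-≤ 2 j≤ ⟩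
    2 * (e * suc (j / e))       ≤⟨ *-monoʳ-≤ 2 (*-monoʳ-≤ e (n<2^n (j / e))) ⟩
    2 * (e * 2 ^ (j / e))       ≡⟨ sym (*-assoc 2 e (2 ^ (j / e))) ⟩
    2 * e * 2 ^ (j / e) ∎
    where
    j≤ : j ≤ e * suc (j / e)
    j≤ = begin
      j                         ≡⟨ m≡m%n+[m/n]*n j e ⟩
      j % e + j / e * e         ≤⟨ +-monoˡ-≤ (j / e * e) (<⇒≤ (m%n<n j e)) ⟩
      suc (j / e) * e           ≡⟨ *-comm (suc (j / e)) e ⟩
      e * suc (j / e) ∎
  bound : ∀ j → (j + j) ^ e ≤ (2 * e) ^ e * 2 ^ j
  bound j = begin
    (j + j) ^ e                       ≤⟨ ^-monoˡ-≤ e (linear j) ⟩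
    (2 * e * 2 ^ (j / e)) ^ e         ≡⟨ ^-distribʳ-* e (2 * e) (2 ^ (j / e)) ⟩
    (2 * e) ^ e * (2 ^ (j / e)) ^ e   ≡⟨ cong ((2 * e) ^ e *_) (^-*-assoc 2 (j / e) e) ⟩
    (2 * e) ^ e * 2 ^ (j / e * e)     ≤⟨ *-monoʳ-≤ ((2 * e) ^ e) (^-monoʳ-≤ 2 (m/n*n≤m j e)) ⟩
    (2 * e) ^ e * 2 ^ j ∎

^-cancelˡ-≤ : ∀ d .{{_ : NonZero d}} {x y} → x ^ d ≤ y ^ d → x ≤ y
^-cancelˡ-≤ d x^≤ = ≮⇒≥ λ y<x → <⇒≱ (^-monoˡ-< d y<x) x^≤

m≤m^n : ∀ m n .{{_ : NonZero n}} → m ≤ m ^ n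
m≤m^n zero    (suc n) = z≤n
m≤m^n (suc m) (suc n) = m≤m*n (suc m) (suc m ^ n) {{m^n≢0 (suc m) n}}

module Rate (N : ℕ → ℕ) (g : ℕ) .{{_ : NonZero g}} where

  -- f m = O(N m ^ (a / g))
  Root : ℕ → (ℕ → ℕ) → Set
  Root a f = ∃[ C ] ∃[ n₀ ] (∀ m → n₀ ≤ m → f m ^ g ≤ C ^ g * N m ^ a)

  root-+ : ∀ {a f f′} → Root a f → Root a f′ → Root a (λ m → f m + f′ m)
  root-+ {a} {f} {f′} (C , n₀ , p) (C′ , n₀′ , p′) = 2 * (C + C′) , n₀ + n₀′ , λ m m≥ →
    begin
      (f m + f′ m) ^ g                          ≤⟨ ^-monoˡ-≤ g (+-mono-≤ (m≤m⊔n (f m) (f′ m)) (m≤n⊔m (f m) (f′ m))) ⟩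
      (f m ⊔ f′ m + (f m ⊔ f′ m)) ^ g           ≡⟨ cong (λ x → (f m ⊔ f′ m + x) ^ g) (sym (+-identityʳ (f m ⊔ f′ m))) ⟩
      (2 * (f m ⊔ f′ m)) ^ g                    ≡⟨ ^-distribʳ-* g 2 (f m ⊔ f′ m) ⟩
      2 ^ g * (f m ⊔ f′ m) ^ g                  ≤⟨ *-monoʳ-≤ (2 ^ g) (larger m m≥ (⊔-sel (f m) (f′ m))) ⟩
      2 ^ g * ((C + C′) ^ g * N m ^ a)          ≡⟨ sym (*-assoc (2 ^ g) ((C + C′) ^ g) (N m ^ a)) ⟩
      2 ^ g * (C + C′) ^ g * N m ^ a            ≡⟨ cong (_* N m ^ a) (sym (^-distribʳ-* g 2 (C + C′))) ⟩
      (2 * (C + C′)) ^ g * N m ^ a ∎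
    where
    open ≤-Reasoning
    larger : ∀ m → n₀ + n₀′ ≤ m → f m ⊔ f′ m ≡ f m ⊎ f m ⊔ f′ m ≡ f′ m → (f m ⊔ f′ m) ^ g ≤ (C + C′) ^ g * N m ^ a
    larger m m≥ (inj₁ e) rewrite e = ≤-trans (p m (≤-trans (m≤m+n n₀ n₀′) m≥)) (*-monoˡ-≤ (N m ^ a) (^-monoˡ-≤ g (m≤m+n C C′)))
    larger m m≥ (inj₂ e) rewrite e = ≤-trans (p′ m (≤-trans (m≤n+m n₀′ n₀) m≥)) (*-monoˡ-≤ (N m ^ a) (^-monoˡ-≤ g (m≤n+m C′ C)))

  root-scale : ∀ {a f} c → Root a f → Root a (λ m → c * f m)
  root-scale {a} {f} c (C , n₀ , p) = c * C , n₀ , λ m m≥ → begin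
    (c * f m) ^ g               ≡⟨ ^-distribʳ-* g c (f m) ⟩
    c ^ g * f m ^ g             ≤⟨ *-monoʳ-≤ (c ^ g) (p m m≥) ⟩
    c ^ g * (C ^ g * N m ^ a)   ≡⟨ sym (*-assoc (c ^ g) (C ^ g) (N m ^ a)) ⟩
    c ^ g * C ^ g * N m ^ a     ≡⟨ cong (_* N m ^ a) (sym (^-distribʳ-* g c C)) ⟩
    (c * C) ^ g * N m ^ a ∎
    where open ≤-Reasoning

  root-N* : ∀ {a f} → Root a f → Root (g + a) (λ m → N m * f m)
  root-N* {a} {f} (C , n₀ , p) = C , n₀ , λ m m≥ → begin
    (N m * f m) ^ g               ≡⟨ ^-distribʳ-* g (N m) (f m) ⟩
    N m ^ g * f m ^ g             ≤⟨ *-monoʳ-≤ (N m ^ g) (p m m≥) ⟩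
    N m ^ g * (C ^ g * N m ^ a)   ≡⟨ solve 3 (λ x y z → x :* (y :* z) := y :* (x :* z)) refl (N m ^ g) (C ^ g) (N m ^ a) ⟩
    C ^ g * (N m ^ g * N m ^ a)   ≡⟨ cong (C ^ g *_) (sym (^-distribˡ-+-* (N m) g a)) ⟩
    C ^ g * N m ^ (g + a) ∎
    where open ≤-Reasoning
          open +-*-Solver

  root-N : ∀ {a} → (∀ m → 1 ≤ N m) → g ≤ a → Root a N
  root-N {a} 1≤N g≤a = 1 , 0 , λ m _ → ≤-trans (^-monoʳ-≤ (N m) {{>-nonZero (1≤N m)}} g≤a)
    (≤-reflexive (trans (sym (*-identityˡ (N m ^ a))) (cong (_* N m ^ a) (sym (^-zeroˡ g)))))

-- The exponent of the running time

module Exponent (A : DynamicAlgorithm) (π : Parameter) (k′ : ℕ) (p u q : ℕ → ℕ) (x : ℕ) where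

  open Whole A π k′
  open Reduction A π k′ p u q
  open Cost A π k′ p u q
  open Rate vertices (suc x)

  private
    g a G : ℕ
    g = suc x
    a = g + x
    G = suc a

    3N : ∀ m → m * 1 + ((m + m) * 4 + m * 1) ≤ 3 * vertices m
    3N m = begin
      m * 1 + ((m + m) * 4 + m * 1)  ≤⟨ m≤m+n _ (2 * m) ⟩
      m * 1 + ((m + m) * 4 + m * 1) + 2 * m
        ≡⟨ solve 1 (λ m → m :* con 1 :+ ((m :+ m) :* con 4 :+ m :* con 1) :+ con 2 :* m := con 3 :* (con 4 :* m)) refl m ⟩
      3 * (4 * m)                    ≤⟨ *-monoʳ-≤ 3 (≤-trans (m≤n+m (4 * m) 4) (4+4m≤vertices m)) ⟩
      3 * vertices m ∎
      where open ≤-Reasoning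
            open +-*-Solver

    updates≤ : ∀ m → maxUpdates m ≤ 5 * work m
    updates≤ m = begin
      maxUpdates m                     ≤⟨ +-mono-≤ (*-monoˡ-≤ 1 (n≤1+n (n′ m))) (+-monoʳ-≤ (N * 1) (+-monoˡ-≤ 0 (*-monoʳ-≤ Z (3N m)))) ⟩
      N * 1 + (N * 1 + (Z * (3 * N) + 0))
        ≤⟨ +-mono-≤ N≤ (+-monoˡ-≤ (Z * (3 * N) + 0) N≤) ⟩
      Z * N + (Z * N + (Z * (3 * N) + 0))
        ≡⟨ solve 2 (λ Z N → Z :* N :+ (Z :* N :+ (Z :* (con 3 :* N) :+ con 0)) := con 5 :* (Z :* N)) refl Z N ⟩
      5 * work m ∎
      where
      open ≤-Reasoning
      open +-*-Solver
      N = vertices m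
      Z = colourings m
      N≤ : N * 1 ≤ Z * N
      N≤ = ≤-trans (≤-reflexive (*-comm N 1)) (*-monoˡ-≤ N (1≤Z m))

    queries≤ : ∀ m → maxQueries m ≤ work m
    queries≤ m = *-monoʳ-≤ (colourings m) (≤-trans (≤-trans (m≤m+n (m + m) (m + m)) (≤-reflexive
      (solve 1 (λ m → m :+ m :+ (m :+ m) := con 4 :* m) refl m))) (≤-trans (m≤n+m (4 * m) 4) (4+4m≤vertices m)))
      where open +-*-Solver

  perColouring : ℕ → ℕ
  perColouring m = proj₁ hostCost≼ * vertices m + 2 * (p (vertices m) + (5 * (vertices m * u (vertices m)) + vertices m * q (vertices m)))

  runningTime≤ : ∀ m → runningTime m ≤ colourings m * perColouring m
  runningTime≤ m = begin
    runningTime m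
      ≡⟨ runningTime≡ m ⟩
    hostCost m (n′ m) Z + 2 * (pN + maxUpdates m * uN + maxQueries m * qN)
      ≤⟨ +-mono-≤ (proj₂ hostCost≼ m) (*-monoʳ-≤ 2 (+-mono-≤ (+-mono-≤ p≤ (*-monoˡ-≤ uN (updates≤ m))) (*-monoˡ-≤ qN (queries≤ m)))) ⟩
    H * (Z * N) + 2 * (Z * pN + 5 * (Z * N) * uN + Z * N * qN)
      ≡⟨ solve 6 (λ H Z N p u q → H :* (Z :* N) :+ con 2 :* (Z :* p :+ con 5 :* (Z :* N) :* u :+ Z :* N :* q)
                   := Z :* (H :* N :+ con 2 :* (p :+ (con 5 :* (N :* u) :+ N :* q)))) refl H Z N pN uN qN ⟩
    Z * perColouring m ∎
    where
    open ≤-Reasoning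
    open +-*-Solver
    H = proj₁ hostCost≼
    Z = colourings m
    N = vertices m
    pN = p N
    uN = u N
    qN = q N
    p≤ : pN ≤ Z * pN
    p≤ = m≤n*m pN Z {{>-nonZero (1≤Z m)}}

  vertices≤ : ∀ m → 1 ≤ m → vertices m ≤ 16 * m
  vertices≤ m 1≤m = begin
    vertices m          ≡⟨ N≡ m ⟩
    2 ^ logN m          ≤⟨ exponent-upper (labels m) m (m≤n+m 4 (m + m + (m + m))) ⟩
    2 * labels m        ≡⟨ cong (2 *_) (labels≡ m) ⟩
    2 * (4 + 4 * m)     ≤⟨ *-monoʳ-≤ 2 (+-monoˡ-≤ (4 * m) (*-monoʳ-≤ 4 1≤m)) ⟩
    2 * (4 * m + 4 * m) ≡⟨ solve 1 (λ m → con 2 :* (con 4 :* m :+ con 4 :* m) := con 16 :* m) refl m ⟩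
    16 * m ∎
    where open ≤-Reasoning
          open +-*-Solver

  -- With `g = suc x`, the hypotheses bound preprocessing by the exponent `a / g = 2 - 1 / g` and
  -- single operations by `x / g = 1 - 1 / g`, so one colouring costs `N ^ (a / g)` up to a
  -- constant. The number of colourings is `O(N ^ (1 / G))` with `G = 2 * g`. The product has the
  -- exponent `(2 * a + 1) / G`, which is `(a + G) / G = 2 - 1 / G`.
  running-rate : Root a (p ∘ vertices) → Root x (u ∘ vertices) → Root x (q ∘ vertices) →
    ∃[ C ] ∃[ n₀ ] (1 ≤ n₀ × (∀ m → n₀ ≤ m → runningTime m ^ G ≤ C ^ G * m ^ (a + G)))
  -- The factor 256 is `16 ^ 2`, from `vertices≤` and an exponent below 2. The threshold is positive
  -- because `vertices≤` fails at 0.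
  running-rate pR uR qR = F * D * 256 , suc n₀ , s≤s z≤n , bound
    where
    perColouringR : Root a perColouring
    perColouringR = root-+ {a = a} {f = λ m → proj₁ hostCost≼ * vertices m} (root-scale {a = a} {f = vertices} (proj₁ hostCost≼) (root-N {a = a} (λ _ → s≤s z≤n) (m≤m+n g x)))
      (root-scale {a = a} {f = λ m → p (vertices m) + (5 * (vertices m * u (vertices m)) + vertices m * q (vertices m))} 2
        (root-+ {a = a} {f = p ∘ vertices} pR (root-+ {a = a} {f = λ m → 5 * (vertices m * u (vertices m))}
          (root-scale {a = a} {f = λ m → vertices m * u (vertices m)} 5 (root-N* {a = x} {f = u ∘ vertices} uR)) (root-N* {a = x} {f = q ∘ vertices} qR))))
    D = proj₁ perColouringR
    n₀ = proj₁ (proj₂ perColouringR)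
    K = suc k′ * suc k′
    F = proj₁ (polynomial-≤-exponential (K * G))
    colourings≤ : ∀ m → colourings m ^ G ≤ F * vertices m
    colourings≤ m = ≤-trans (≤-reflexive (^-*-assoc (logN m + logN m) K G))
      (≤-trans (proj₂ (polynomial-≤-exponential (K * G)) (logN m)) (≤-reflexive (cong (F *_) (sym (N≡ m)))))
    G≡ : G ≡ g + g
    G≡ = sym (+-suc g x)
    open ≤-Reasoning
    open +-*-Solver
    perColouring^ : ∀ m → n₀ ≤ m → perColouring m ^ G ≤ D ^ G * (vertices m ^ a * vertices m ^ a)
    perColouring^ m m≥ = begin
      perColouring m ^ G                             ≡⟨ cong (perColouring m ^_) G≡ ⟩
      perColouring m ^ (g + g)                       ≡⟨ ^-distribˡ-+-* (perColouring m) g g ⟩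
      perColouring m ^ g * perColouring m ^ g        ≤⟨ *-mono-≤ (proj₂ (proj₂ perColouringR) m m≥) (proj₂ (proj₂ perColouringR) m m≥) ⟩
      D ^ g * vertices m ^ a * (D ^ g * vertices m ^ a)
        ≡⟨ solve 2 (λ d n → d :* n :* (d :* n) := d :* d :* (n :* n)) refl (D ^ g) (vertices m ^ a) ⟩
      D ^ g * D ^ g * (vertices m ^ a * vertices m ^ a)
        ≡⟨ cong (_* (vertices m ^ a * vertices m ^ a)) (trans (sym (^-distribˡ-+-* D g g)) (cong (D ^_) (sym G≡))) ⟩
      D ^ G * (vertices m ^ a * vertices m ^ a) ∎
    vertices^ : ∀ m → 1 ≤ m → vertices m ^ (a + G) ≤ 256 ^ G * m ^ (a + G)
    vertices^ m 1≤m = begin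
      vertices m ^ (a + G)          ≤⟨ ^-monoˡ-≤ (a + G) (vertices≤ m 1≤m) ⟩
      (16 * m) ^ (a + G)            ≡⟨ ^-distribʳ-* (a + G) 16 m ⟩
      16 ^ (a + G) * m ^ (a + G)    ≤⟨ *-monoˡ-≤ (m ^ (a + G)) (^-monoʳ-≤ 16 (+-monoˡ-≤ G (n≤1+n a))) ⟩
      16 ^ (G + G) * m ^ (a + G)    ≡⟨ cong (_* m ^ (a + G)) (trans (^-distribˡ-+-* 16 G G) (sym (^-distribʳ-* G 16 16))) ⟩
      256 ^ G * m ^ (a + G) ∎
    bound : ∀ m → suc n₀ ≤ m → runningTime m ^ G ≤ (F * D * 256) ^ G * m ^ (a + G)
    bound m m≥ = begin
      runningTime m ^ G                               ≤⟨ ^-monoˡ-≤ G (runningTime≤ m) ⟩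
      (colourings m * perColouring m) ^ G             ≡⟨ ^-distribʳ-* G (colourings m) (perColouring m) ⟩
      colourings m ^ G * perColouring m ^ G           ≤⟨ *-mono-≤ (colourings≤ m) (perColouring^ m (<⇒≤ m≥)) ⟩
      F * vertices m * (D ^ G * (vertices m ^ a * vertices m ^ a))
        ≡⟨ solve 4 (λ f n d v → f :* n :* (d :* (v :* v)) := f :* d :* (v :* (n :* v))) refl F (vertices m) (D ^ G) (vertices m ^ a) ⟩
      F * D ^ G * (vertices m ^ a * vertices m ^ G)   ≡⟨ cong (F * D ^ G *_) (sym (^-distribˡ-+-* (vertices m) a G)) ⟩
      F * D ^ G * vertices m ^ (a + G)                ≤⟨ *-mono-≤ (*-monoˡ-≤ (D ^ G) (m≤m^n F G)) (vertices^ m (≤-trans (s≤s z≤n) m≥)) ⟩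
      F ^ G * D ^ G * (256 ^ G * m ^ (a + G))         ≡⟨ sym (*-assoc (F ^ G * D ^ G) (256 ^ G) (m ^ (a + G))) ⟩
      F ^ G * D ^ G * 256 ^ G * m ^ (a + G)           ≡⟨ cong (_* m ^ (a + G)) (sym (trans (^-distribʳ-* G (F * D) 256) (cong (_* 256 ^ G) (^-distribʳ-* G F D)))) ⟩
      (F * D * 256) ^ G * m ^ (a + G) ∎

-- Rational exponents

open import Data.Integer using (+_; -[1+_])

unit-fraction : ∀ s → ∃[ x ] (suc x ≡ 2 ^ s × ℚ.toℚᵘ (2⁻ s) ℚᵘ.≃ mkℚᵘ (+ 1) x)
unit-fraction zero    = 0 , refl , *≡* refl
unit-fraction (suc s) with unit-fraction s
... | x , e , eq≃ = x + suc (x + 0) , cong (2 *_) e ,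
  ℚᵘ.≃-trans (ℚ.toℚᵘ-homo-* ½ (2⁻ s)) (ℚᵘ.≃-trans (ℚᵘ.*-congˡ {ℚ.toℚᵘ ½} eq≃) (*≡* refl))

-- (c + 1) − 1 / (x + 1)
below : (c x : ℕ) → ℚ
below c x = ℚ.fromℚᵘ (mkℚᵘ (+ (x + c * suc x)) x)

below-sum : ∀ c s x → ℚ.toℚᵘ (2⁻ s) ℚᵘ.≃ mkℚᵘ (+ 1) x → below c x ℚ.+ (2⁻ s) ≡ + suc c ℚ./ 1
below-sum c s x e = ℚ.toℚᵘ-injective (ℚᵘ.≃-trans (ℚ.toℚᵘ-homo-+ (below c x) (2⁻ s))
  (ℚᵘ.≃-trans (ℚᵘ.+-cong (ℚ.toℚᵘ-fromℚᵘ (mkℚᵘ (+ (x + c * suc x)) x)) e)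
    (ℚᵘ.≃-trans (*≡* sum) (ℚᵘ.≃-sym (ℚ.toℚᵘ-fromℚᵘ (mkℚᵘ (+ suc c) 0))))))
  where
  open +-*-Solver
  X = suc x
  sum : (+ (x + c * X) ℤ.* + X ℤ.+ + 1 ℤ.* + X) ℤ.* + 1 ≡ + suc c ℤ.* + (X * X)
  sum = trans (ℤ.*-identityʳ _) (trans (cong₂ ℤ._+_ (sym (ℤ.pos-* (x + c * X) X)) (sym (ℤ.pos-* 1 X)))
    (trans (sym (ℤ.pos-+ ((x + c * X) * X) (1 * X)))
      (trans (cong +_ (solve 2 (λ x c → (x :+ c :* (con 1 :+ x)) :* (con 1 :+ x) :+ con 1 :* (con 1 :+ x)
                                   := (con 1 :+ c) :* ((con 1 :+ x) :* (con 1 :+ x))) refl x c))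
        (ℤ.pos-* (suc c) (X * X)))))

power-of-power : ∀ x a b → (x ^ a) ^ b ≡ (x ^ b) ^ a
power-of-power x a b = trans (^-*-assoc x a b) (trans (cong (x ^_) (*-comm a b)) (sym (^-*-assoc x b a)))

-- `PowerBound` is stated with the lowest terms of `q`. Raising each side to the denominator of the
-- other fraction makes the exponents agree, and a root is taken at the end.
powerBound⇒ : ∀ {t C n a x} q → ℚ.toℚᵘ q ℚᵘ.≃ mkℚᵘ (+ a) x → PowerBound t C n q → t ^ suc x ≤ C ^ suc x * n ^ a
powerBound⇒ {t} {C} {n} {a} {x} (mkℚ (+ b) d-1 _) (*≡* e) t≤ = ^-cancelˡ-≤ d (begin
  (t ^ X) ^ d                     ≡⟨ power-of-power t X d ⟩
  (t ^ d) ^ X                     ≤⟨ ^-monoˡ-≤ X t≤ ⟩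
  (C ^ d * n ^ b) ^ X             ≡⟨ ^-distribʳ-* X (C ^ d) (n ^ b) ⟩
  (C ^ d) ^ X * (n ^ b) ^ X       ≡⟨ cong₂ _*_ (power-of-power C d X) (trans (^-*-assoc n b X) (trans (cong (n ^_) cross) (sym (^-*-assoc n a d)))) ⟩
  (C ^ X) ^ d * (n ^ a) ^ d       ≡⟨ sym (^-distribʳ-* d (C ^ X) (n ^ a)) ⟩
  (C ^ X * n ^ a) ^ d ∎)
  where
  open ≤-Reasoning
  d = suc d-1
  X = suc x
  cross : b * X ≡ a * d
  cross = ℤ.+-injective (trans (ℤ.pos-* b X) (trans e (sym (ℤ.pos-* a d))))
powerBound⇒ {a = a} (mkℚ -[1+ b ] d-1 _) (*≡* e) _ = contradiction (trans e (sym (ℤ.pos-* a (suc d-1)))) λ ()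

⇒powerBound : ∀ {t C n a x} q → mkℚᵘ (+ a) x ℚᵘ.≤ ℚ.toℚᵘ q → 1 ≤ n → t ^ suc x ≤ C ^ suc x * n ^ a → PowerBound t C n q
⇒powerBound {t} {C} {n} {a} {x} (mkℚ (+ b) d-1 _) (*≤* le) 1≤n t≤ = ^-cancelˡ-≤ X (begin
  (t ^ d) ^ X                     ≡⟨ power-of-power t d X ⟩
  (t ^ X) ^ d                     ≤⟨ ^-monoˡ-≤ d t≤ ⟩
  (C ^ X * n ^ a) ^ d             ≡⟨ ^-distribʳ-* d (C ^ X) (n ^ a) ⟩
  (C ^ X) ^ d * (n ^ a) ^ d       ≤⟨ *-mono-≤ (≤-reflexive (power-of-power C X d))
      (≤-trans (≤-reflexive (^-*-assoc n a d)) (≤-trans (^-monoʳ-≤ n {{>-nonZero 1≤n}} cross) (≤-reflexive (sym (^-*-assoc n b X))))) ⟩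
  (C ^ d) ^ X * (n ^ b) ^ X       ≡⟨ sym (^-distribʳ-* X (C ^ d) (n ^ b)) ⟩
  (C ^ d * n ^ b) ^ X ∎)
  where
  open ≤-Reasoning
  d = suc d-1
  X = suc x
  cross : a * d ≤ b * X
  cross = ℤ.drop‿+≤+ (subst₂ ℤ._≤_ (sym (ℤ.pos-* a d)) (sym (ℤ.pos-* b X)) le)
⇒powerBound {a = a} (mkℚ -[1+ b ] d-1 _) (*≤* le) _ _ with subst (ℤ._≤ _) (sym (ℤ.pos-* a (suc d-1))) le
... | ()

-- Comparisons of reals

0≤2⁻ : ∀ s → 0ℚ ℚ.≤ 2⁻ s
0≤2⁻ zero    = ℚ.nonNegative⁻¹ ℚ.1ℚ
0≤2⁻ (suc s) = subst (ℚ._≤ ½ ℚ.* (2⁻ s)) (ℚ.*-zeroʳ ½) (ℚ.*-monoˡ-≤-nonNeg ½ (0≤2⁻ s))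

0<2⁻ : ∀ s → 0ℚ ℚ.< 2⁻ s
0<2⁻ zero    = ℚ.positive⁻¹ ℚ.1ℚ
0<2⁻ (suc s) = subst (ℚ._< ½ ℚ.* (2⁻ s)) (ℚ.*-zeroʳ ½) (ℚ.*-monoʳ-<-pos ½ (0<2⁻ s))

p≤∣p∣ : ∀ p → p ℚ.≤ ℚ.∣ p ∣
p≤∣p∣ p with ℚ.≤-total 0ℚ p
... | inj₁ 0≤p = ℚ.≤-reflexive (sym (ℚ.0≤p⇒∣p∣≡p 0≤p))
... | inj₂ p≤0 = ℚ.≤-trans p≤0 (ℚ.0≤∣p∣ p)

regular-≤ : ∀ x m n → approx x m ℚ.- approx x n ℚ.≤ (2⁻ m) ℚ.+ (2⁻ n)
regular-≤ x m n = ℚ.≤-trans (p≤∣p∣ (approx x m ℚ.- approx x n)) (regular x m n)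

0<ℝ2⁻ : ∀ s → fromℕ 0 <ℝ fromℚ (2⁻ s)
0<ℝ2⁻ s = suc (suc s) , (begin-strict
  0ℚ ℚ.+ ¼c        ≡⟨ ℚ.+-comm 0ℚ ¼c ⟩
  ¼c ℚ.+ 0ℚ        <⟨ ℚ.+-monoʳ-< ¼c (0<2⁻ (suc s)) ⟩
  ¼c ℚ.+ (2⁻ suc s) ≡⟨ solve 1 (λ c → con ½ :* (con ½ :* c) :+ con ½ :* c := c :- con ½ :* (con ½ :* c)) refl (2⁻ s) ⟩
  (2⁻ s) ℚ.- ¼c ∎)
  where
  open ℚ.≤-Reasoning
  open ℚ.+-*-Solver
  ¼c = 2⁻ suc (suc s)

-- The witness `n` of `0 < ε` gives `ε` more than `2⁻ n`, while `below c x` lies only `2⁻ suc n`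
-- below `suc c`. The gap exceeds `2⁻ suc n`, and index `n + 3` is fine enough to exhibit it.
minus-ε : ∀ ε n → approx (fromℕ 0) n ℚ.+ (2⁻ n) ℚ.< approx ε n ℚ.- (2⁻ n) →
  ∀ c x → below c x ℚ.+ (2⁻ suc n) ≡ + suc c ℚ./ 1 → fromℕ (suc c) -ℝ ε <ℝ fromℚ (below c x)
minus-ε ε n ε> c x sum = suc (suc (suc n)) , (begin-strict
  (+ suc c ℚ./ 1 ℚ.- E′) ℚ.+ (2⁻ suc (suc (suc n)))
    ≡⟨ cong (λ r → (r ℚ.- E′) ℚ.+ (2⁻ suc (suc (suc n)))) (sym sum) ⟩
  ((Q ℚ.+ ½ ℚ.* a) ℚ.- E′) ℚ.+ ½ ℚ.* (½ ℚ.* (½ ℚ.* a))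
    ≡⟨ solve 4 (λ Q a E E′ → ((Q :+ con ½ :* a) :- E′) :+ con ½ :* (con ½ :* (con ½ :* a))
         := (Q :+ con ½ :* a :+ con ½ :* (con ½ :* (con ½ :* a)) :- E) :+ (E :- E′)) refl Q a E E′ ⟩
  (Q ℚ.+ ½ ℚ.* a ℚ.+ ½ ℚ.* (½ ℚ.* (½ ℚ.* a)) ℚ.- E) ℚ.+ (E ℚ.- E′)
    ≤⟨ ℚ.+-monoʳ-≤ (Q ℚ.+ ½ ℚ.* a ℚ.+ ½ ℚ.* (½ ℚ.* (½ ℚ.* a)) ℚ.- E) (regular-≤ ε n (suc (suc (suc (suc n))))) ⟩
  (Q ℚ.+ ½ ℚ.* a ℚ.+ ½ ℚ.* (½ ℚ.* (½ ℚ.* a)) ℚ.- E) ℚ.+ (a ℚ.+ h)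
    ≡⟨ solve 3 (λ Q a E → (Q :+ con ½ :* a :+ con ½ :* (con ½ :* (con ½ :* a)) :- E) :+ (a :+ con ½ :* (con ½ :* (con ½ :* (con ½ :* a))))
         := ((Q :- con ½ :* (con ½ :* a) :- con ½ :* (con ½ :* (con ½ :* (con ½ :* a)))) :- (E :- a)) :+ (con 0ℚ :+ a)) refl Q a E ⟩
  (V ℚ.- (E ℚ.- a)) ℚ.+ (0ℚ ℚ.+ a)
    <⟨ ℚ.+-monoʳ-< (V ℚ.- (E ℚ.- a)) ε> ⟩
  (V ℚ.- (E ℚ.- a)) ℚ.+ (E ℚ.- a)
    ≡⟨ solve 2 (λ V D → (V :- D) :+ D := V :+ con 0ℚ :+ con 0ℚ) refl V (E ℚ.- a) ⟩
  V ℚ.+ 0ℚ ℚ.+ 0ℚ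
    ≤⟨ ℚ.+-mono-≤ (ℚ.+-monoʳ-≤ V (0≤2⁻ (suc (suc (suc n))))) (0≤2⁻ (suc (suc (suc (suc n))))) ⟩
  V ℚ.+ (2⁻ suc (suc (suc n))) ℚ.+ h
    ≡⟨ solve 2 (λ Q a → (Q :- con ½ :* (con ½ :* a) :- con ½ :* (con ½ :* (con ½ :* (con ½ :* a)))) :+ con ½ :* (con ½ :* (con ½ :* a)) :+ con ½ :* (con ½ :* (con ½ :* (con ½ :* a)))
         := Q :- con ½ :* (con ½ :* (con ½ :* a))) refl Q a ⟩
  Q ℚ.- (2⁻ suc (suc (suc n))) ∎)
  where
  open ℚ.≤-Reasoning
  open ℚ.+-*-Solver
  Q = below c x
  a = 2⁻ n
  E = approx ε n
  E′ = approx ε (suc (suc (suc (suc n))))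
  h = 2⁻ suc (suc (suc (suc n)))
  V = Q ℚ.- ½ ℚ.* (½ ℚ.* a) ℚ.- h

-- Both `F` and `2⁻ suc s` are at most half of `2⁻ s`, the distance of `below 1 x` from 2, so
-- together they do not lower 2 past it.
exponent-≥ : ∀ F s x → below 1 x ℚ.+ (2⁻ s) ≡ + 2 ℚ./ 1 → Within (fromℚ (2⁻ suc s)) F (fromℕ 0) →
  ∀ q → fromℕ 2 -ℝ F -ℝ fromℚ (2⁻ suc s) <ℝ fromℚ q → below 1 x ℚ.≤ q
-- At index `suc j` the contradiction reads the same approximation of `F` as `r<q` does at index
-- `j`, so regularity is not invoked.
exponent-≥ F s x sum (F≤ , _) q (j , r<q) = ℚ.≮⇒≥ λ q<Q → F≤ (suc j , (begin-strict
  (½ ℚ.* b) ℚ.+ ½ ℚ.* h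
    ≡⟨ solve 4 (λ Q b h G → con ½ :* b :+ con ½ :* h := (G :- Q :- con ½ :* h) :+ ((((Q :+ b) :- G) :- con ½ :* b) :+ h)) refl Q b h G ⟩
  Z ℚ.+ ((((Q ℚ.+ b) ℚ.- G) ℚ.- ½ ℚ.* b) ℚ.+ h)
    ≡⟨ cong (λ r → Z ℚ.+ (((r ℚ.- G) ℚ.- ½ ℚ.* b) ℚ.+ h)) sum ⟩
  Z ℚ.+ (((+ 2 ℚ./ 1 ℚ.- G) ℚ.- ½ ℚ.* b) ℚ.+ h)
    <⟨ ℚ.+-monoʳ-< Z r<q ⟩
  Z ℚ.+ (q ℚ.- h)
    <⟨ ℚ.+-monoʳ-< Z (ℚ.+-monoˡ-< (ℚ.- h) q<Q) ⟩
  Z ℚ.+ (Q ℚ.- h)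
    ≡⟨ solve 3 (λ Q h G → (G :- Q :- con ½ :* h) :+ (Q :- h) := (G :- h :- con ½ :* h) :+ con 0ℚ) refl Q h G ⟩
  (G ℚ.- h ℚ.- ½ ℚ.* h) ℚ.+ 0ℚ
    ≤⟨ ℚ.+-monoʳ-≤ (G ℚ.- h ℚ.- ½ ℚ.* h) (0≤2⁻ j) ⟩
  (G ℚ.- h ℚ.- ½ ℚ.* h) ℚ.+ h
    ≡⟨ solve 2 (λ h G → (G :- h :- con ½ :* h) :+ h := (G :- con 0ℚ) :- con ½ :* h) refl h G ⟩
  (G ℚ.- 0ℚ) ℚ.- ½ ℚ.* h ∎))
  where
  open ℚ.≤-Reasoning
  open ℚ.+-*-Solver
  Q = below 1 x
  b = 2⁻ s
  h = 2⁻ j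
  G = approx F (suc (suc j))
  Z = G ℚ.- Q ℚ.- ½ ℚ.* h

ceiling : ∀ q → q ℚ.≤ + (3 + ℤ.∣ ℚ.↥ q ∣) ℚ./ 1
ceiling q@record{} = ℚ.toℚᵘ-cancel-≤ (ℚᵘ.≤-respʳ-≃ (ℚᵘ.≃-sym (ℚ.toℚᵘ-fromℚᵘ (mkℚᵘ (+ (3 + ℤ.∣ ℚ.↥ q ∣)) 0))) (*≤* (bound q)))
  where
  bound : ∀ q → ℚ.↥ q ℤ.* + 1 ℤ.≤ + (3 + ℤ.∣ ℚ.↥ q ∣) ℤ.* ℚ.↧ q
  bound (mkℚ (+ a) d-1 _) = subst₂ ℤ._≤_ (ℤ.pos-* a 1) (ℤ.pos-* (3 + a) (suc d-1))
    (ℤ.+≤+ (≤-trans (≤-reflexive (*-identityʳ a)) (≤-trans (m≤n+m a 3) (m≤m*n (3 + a) (suc d-1)))))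
  bound (mkℚ -[1+ a ] d-1 _) = subst (-[1+ a ] ℤ.* + 1 ℤ.≤_) (ℤ.pos-* (4 + a) (suc d-1)) (ℤ.≤-trans (ℤ.≤-reflexive (ℤ.*-identityʳ -[1+ a ])) ℤ.-≤+)

-- The approximation with index 0 is off by at most 1. The summand 3 makes the bound one of the
-- lengths `3 + j` of the hypothesis.
archimedean : ∀ b → b ≤ℝ fromℕ (3 + ℤ.∣ ℚ.↥ (approx b 0 ℚ.+ ℚ.1ℚ) ∣)
archimedean b (i , k<b) = ℚ.<-irrefl refl (begin-strict
  k ℚ.+ 0ℚ                        ≤⟨ ℚ.+-monoʳ-≤ k (0≤2⁻ i) ⟩
  k ℚ.+ (2⁻ i)                    <⟨ k<b ⟩
  B ℚ.- (2⁻ i)                    ≡⟨ solve 3 (λ B B₀ h → B :- h := (B₀ :- h) :+ (B :- B₀)) refl B B₀ (2⁻ i) ⟩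
  (B₀ ℚ.- (2⁻ i)) ℚ.+ (B ℚ.- B₀)  ≤⟨ ℚ.+-monoʳ-≤ (B₀ ℚ.- (2⁻ i)) (regular-≤ b i 0) ⟩
  (B₀ ℚ.- (2⁻ i)) ℚ.+ ((2⁻ i) ℚ.+ ℚ.1ℚ) ≡⟨ solve 2 (λ B₀ h → (B₀ :- h) :+ (h :+ con ℚ.1ℚ) := B₀ :+ con ℚ.1ℚ) refl B₀ (2⁻ i) ⟩
  B₀ ℚ.+ ℚ.1ℚ                     ≤⟨ ceiling (B₀ ℚ.+ ℚ.1ℚ) ⟩
  k                               ≡⟨ sym (ℚ.+-identityʳ k) ⟩
  k ℚ.+ 0ℚ ∎)
  where
  open ℚ.≤-Reasoning
  open ℚ.+-*-Solver
  B = approx b i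
  B₀ = approx b 0
  k = + (3 + ℤ.∣ ℚ.↥ (B₀ ℚ.+ ℚ.1ℚ) ∣) ℚ./ 1

-- From a positive `ε` to a contradiction with the hypothesis

module _ (A : DynamicAlgorithm) (π : Parameter) (k′ : ℕ) (p u q : ℕ → ℕ) (ε : ℝ) (n : ℕ)
         (ε> : approx (fromℕ 0) n ℚ.+ (2⁻ n) ℚ.< approx ε n ℚ.- (2⁻ n)) where

  open Reduction A π k′ p u q

  private
    -- `suc x` is `2 ^ suc n`; its reciprocal is half of `2⁻ n`, which `ε` exceeds.
    x = proj₁ (unit-fraction (suc n))
    suc-x = proj₁ (proj₂ (unit-fraction (suc n)))
    x≃ = proj₂ (proj₂ (unit-fraction (suc n)))
    a = suc x + x

    m≤vertices : ∀ m → m ≤ vertices m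
    m≤vertices m = ≤-trans (m≤n*m m 4) (≤-trans (m≤n+m (4 * m) 4) (4+4m≤vertices m))

    root : ∀ c f → f ∈O[n^ fromℕ (suc c) -ℝ ε ] → Rate.Root vertices (suc x) (x + c * suc x) (f ∘ vertices)
    root c f (C , n₀ , bound) = C , n₀ , λ m m≥ →
      powerBound⇒ (below c x) (ℚ.toℚᵘ-fromℚᵘ (mkℚᵘ (+ (x + c * suc x)) x))
        (bound (vertices m) (≤-trans m≥ (m≤vertices m)) (below c x) (minus-ε ε n ε> c x (below-sum c (suc n) x x≃)))

  running-bound : p ∈O[n^ fromℕ 2 -ℝ ε ] → u ∈O[n^ fromℕ 1 -ℝ ε ] → q ∈O[n^ fromℕ 1 -ℝ ε ] →
    ∀ F → Within (fromℚ (2⁻ suc (suc (suc n)))) F (fromℕ 0) → runningTime ∈O[n^ fromℕ 2 -ℝ F -ℝ fromℚ (2⁻ suc (suc (suc n))) ]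
  running-bound pO uO qO F F≈0 = conclude
    (Exponent.running-rate A π k′ p u q x
      (subst (λ b → Rate.Root vertices (suc x) b (p ∘ vertices)) (trans (cong (x Nat.+_) (*-identityˡ (suc x))) (+-comm x (suc x))) (root 1 p pO))
      (subst (λ b → Rate.Root vertices (suc x) b (u ∘ vertices)) (+-identityʳ x) (root 0 u uO))
      (subst (λ b → Rate.Root vertices (suc x) b (q ∘ vertices)) (+-identityʳ x) (root 0 q qO)))
    where
    y = proj₁ (unit-fraction (suc (suc n)))
    y≃ = proj₂ (proj₂ (unit-fraction (suc (suc n))))
    -- `suc y` is twice `suc x`, hence `suc a`, and the exponent `(a + suc a) / suc a` is 2 minus
    -- the reciprocal of `suc y`.
    y≡a : y ≡ a
    y≡a = suc-injective (trans (proj₁ (proj₂ (unit-fraction (suc (suc n))))) (trans (cong (2 Nat.*_) (sym suc-x))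
      (trans (cong (λ z → suc x Nat.+ z) (+-identityʳ (suc x))) (+-suc (suc x) x))))
    exponent≡ : a + suc a ≡ y + 1 * suc y
    exponent≡ = trans (cong (λ z → z Nat.+ suc z) (sym y≡a)) (cong (y Nat.+_) (sym (*-identityˡ (suc y))))
    conclude : ∃[ C ] ∃[ n₀ ] (1 ≤ n₀ × (∀ m → n₀ ≤ m → runningTime m ^ suc a ≤ C ^ suc a * m ^ (a + suc a))) →
      runningTime ∈O[n^ fromℕ 2 -ℝ F -ℝ fromℚ (2⁻ suc (suc (suc n))) ]
    conclude (C , n₀ , 1≤n₀ , bound) = C , n₀ , λ m m≥ r F+δ<r →
      ⇒powerBound r
        (ℚᵘ.≤-respˡ-≃ (ℚ.toℚᵘ-fromℚᵘ (mkℚᵘ (+ (y + 1 * suc y)) y))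
          (ℚ.toℚᵘ-mono-≤ (exponent-≥ F (suc (suc n)) y (below-sum 1 (suc (suc n)) y y≃) F≈0 r F+δ<r)))
        (≤-trans 1≤n₀ m≥)
        (subst₂ (λ g e → runningTime m ^ g ≤ C ^ g * m ^ e) (cong suc (sym y≡a)) exponent≡ (bound m m≥))

theorem3p7 : (ε : ℝ) → fromℕ 0 <ℝ ε → KCycleHypothesis →
    ∃[ M ] (SoftLinear M × ∃[ d ] ((π : Parameter) →
    ¬ (∃[ A ] ∃[ p ] ∃[ u ] ∃[ q ]
    (Maintains A π M (λ n → n ^ d) p u q
    × p ∈O[n^ fromℕ 2 -ℝ ε ]
    × u ∈O[n^ fromℕ 1 -ℝ ε ]
    × q ∈O[n^ fromℕ 1 -ℝ ε ]))))
theorem3p7 ε (n , ε>) (f , _ , vanishes , hard) =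
  -- The edge bound and the exponent, which is `lengthExponent`, do not depend on `π`, so one choice
  -- serves all three parameters.
  (λ n → 4 * n) , (4 , 0 , 0 , λ n _ → ≤-reflexive (sym (*-identityʳ (4 * n)))) , 3 + 2 * (suc k′ * suc k′) ,
  λ π (A , p , u , q , maintains , pO , uO , qO) →
    hard j δ 0<δ
      ( Reduction.algorithm A π k′ p u q , Reduction.runningTime A π k′ p u q
      , Reduction.finds-cycles A π k′ p u q maintains
      , running-bound A π k′ p u q ε n ε> pO uO qO (f (fromℕ (suc k′))) (proj₂ (vanishes δ 0<δ) (fromℕ (suc k′)) (archimedean b)) )
  where
  -- The running time saves `2⁻ suc (suc n)` in the exponent; `f` at the cycle length and `δ` may
  -- use up half of it each.
  δ = fromℚ (2⁻ suc (suc (suc n)))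
  0<δ = 0<ℝ2⁻ (suc (suc (suc n)))
  b = proj₁ (vanishes δ 0<δ)
  j = ℤ.∣ ℚ.↥ (approx b 0 ℚ.+ ℚ.1ℚ) ∣
  k′ = 2 + j
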